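{- Let $n\geqslant 2$, let $q$ be a prime power and let $c\in C_{n-1}(n,q)$ with $\mathrm{wt}(c)\leqslant\min\{(3q-6)\theta_{n-2}+2,\,B_{n,q}\}$. Then $c$ is an $\mathbb{F}_p$-linear combination of the incidence vectors of at most two distinct hyperplanes of $\mathrm{PG}(n,q)$.
   Context: $q=p^h$, $p$ prime. $\mathrm{PG}(n,q)$ is the Desarguesian projective space over $\mathbb{F}_q$; $\mathcal{V}(n,q)$ is the $\mathbb{F}_p$-space of functions from its points to $\mathbb{F}_p$; hyperplanes are identified with their incidence vectors; $C_{n-1}(n,q)$ is the $\mathbb{F}_p$-span of the incidence vectors of all hyperplanes. $\mathrm{wt}(v)$ is the number of points $P$ with $v(P)\neq0$. $\theta_m=(q^{m+1}-1)/(q-1)$ for $m\geqslant 0$ and $\theta_m=0$ for $m<0$. $B_{n,q}$: $2q^{n-1}$ if $q<7$ or $q\in\{8,9,16,25,27,49\}$; $(3q-\sqrt{6q}-\tfrac12)q^{n-2}$ if $q\in\{7,11,13,17\}$; $(3q-\sqrt{6q}+\tfrac92)q^{n-2}$ if $q\in\{19,121\}$; $(4q-4\sqrt{q}-\tfrac{25}{2})q^{n-2}$ if $q\in\{29,31,32\}$; $(4q-\sqrt{8q}-\tfrac{33}{2})q^{n-2}$ otherwise. -}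

module Defs where

open import Data.Nat using (ℕ; zero; suc; _+_; _*_; _∸_; _^_; _≤_; _<ᵇ_; _≡ᵇ_; NonZero)
open import Data.Nat.DivMod using (_mod_)
open import Data.Nat.Primality using (Prime)
open import Data.Fin using (Fin; toℕ)
open import Data.Bool using (Bool; true; false; _∧_; _∨_; not; if_then_else_)
open import Data.List using (List; []; _∷_; length; filterᵇ; concatMap; map; foldr)
open import Data.Vec using (Vec; []; _∷_; zipWith)
open import Data.Product using (_×_; _,_; Σ; ∃)
open import Data.Sum using (_⊎_)
open import Data.Empty using (⊥)
open import Relation.Binary.PropositionalEquality using (_≡_; _≢_)
open import Relation.Nullary using (¬_)
open import Algebra.Structures using (IsCommutativeRing)
open import Function using (_∘_)

-- Finite fields of order q, with carrier Fin q and propositional equality.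
-- (Every finite field of order q is isomorphic to one of these.)

record FiniteField (q : ℕ) : Set where
  field
    _+F_ _*F_ : Fin q → Fin q → Fin q
    -F_       : Fin q → Fin q
    0F 1F     : Fin q
    isCommutativeRing : IsCommutativeRing _≡_ _+F_ _*F_ -F_ 0F 1F
    0≢1       : 0F ≢ 1F
    inverse   : ∀ x → x ≢ 0F → Σ (Fin q) λ y → x *F y ≡ 1F

allFinL : (q : ℕ) → List (Fin q)
allFinL zero    = []
allFinL (suc q) = Fin.zero ∷ map Fin.suc (allFinL q)

allVecs : (q m : ℕ) → List (Vec (Fin q) m)
allVecs q zero    = [] ∷ []
allVecs q (suc m) = concatMap (λ x → map (x ∷_) (allVecs q m)) (allFinL q)

_==F_ : ∀ {q} → Fin q → Fin q → Bool
a ==F b = toℕ a ≡ᵇ toℕ b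

-- PG(n,q) over a finite field F of order q.
-- Points of PG(n,q) are represented by their unique normalised
-- homogeneous coordinate vector in F^(n+1): the first nonzero coordinate is 1.

module PG {q : ℕ} (F : FiniteField q) where
  open FiniteField F

  isPoint : ∀ {m} → Vec (Fin q) m → Bool
  isPoint []       = false
  isPoint (x ∷ xs) = (x ==F 1F) ∨ ((x ==F 0F) ∧ isPoint xs)

  isZeroVec : ∀ {m} → Vec (Fin q) m → Bool
  isZeroVec []       = true
  isZeroVec (x ∷ xs) = (x ==F 0F) ∧ isZeroVec xs

  dot : ∀ {m} → Vec (Fin q) m → Vec (Fin q) m → Fin q
  dot []       []       = 0F
  dot (a ∷ as) (x ∷ xs) = (a *F x) +F dot as xs

  -- The hyperplane with dual coordinates a (a ≠ 0) is {x : a·x = 0}.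
  -- Its incidence vector, with values in F_p = Fin p.
  incHyp : (p : ℕ) .{{_ : NonZero p}} → ∀ {m} → Vec (Fin q) m → Vec (Fin q) m → Fin p
  incHyp p a x = if dot a x ==F 0F then (1 mod p) else (0 mod p)

  addp : (p : ℕ) .{{_ : NonZero p}} → Fin p → Fin p → Fin p
  addp p a b = (toℕ a + toℕ b) mod p

  mulp : (p : ℕ) .{{_ : NonZero p}} → Fin p → Fin p → Fin p
  mulp p a b = (toℕ a * toℕ b) mod p

  evalComb : (p : ℕ) .{{_ : NonZero p}} → ∀ {m} →
             List (Fin p × Vec (Fin q) m) → Vec (Fin q) m → Fin p
  evalComb p []             x = 0 mod p
  evalComb p ((α , a) ∷ ls) x = addp p (mulp p α (incHyp p a x)) (evalComb p ls x)

  -- A vector of V(n,q) (function on points of PG(n,q) with values in F_p),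
  -- represented as a function on normalised coordinate vectors; only its values
  -- at points matter.
  Word : (p n : ℕ) → Set
  Word p n = Vec (Fin q) (suc n) → Fin p

  _≗P_ : ∀ {p n} → Word p n → Word p n → Set
  c ≗P d = ∀ x → isPoint x ≡ true → c x ≡ d x

  data AllHyp {p m : ℕ} : List (Fin p × Vec (Fin q) m) → Set where
    []  : AllHyp []
    _∷_ : ∀ {α a ls} → isZeroVec a ≡ false → AllHyp ls → AllHyp ((α , a) ∷ ls)

  InCode : (p n : ℕ) .{{_ : NonZero p}} → Word p n → Set
  InCode p n c = Σ (List (Fin p × Vec (Fin q) (suc n))) λ ls →
                   AllHyp ls × (c ≗P evalComb p ls)

  wt : ∀ {p n} → Word p n → ℕ
  wt {p} {n} c = length (filterᵇ (λ x → isPoint x ∧ not (toℕ (c x) ≡ᵇ 0))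
                                (allVecs q (suc n)))

θ : ℕ → ℕ → ℕ
θ q zero    = 1
θ q (suc m) = θ q m + q ^ suc m

-- w ≤ B_{n,q}, with the irrational bounds written in exact integer form:
--   w ≤ (a q - √(k q) + b/2) Q   ⇔   2w + 2√(kq) Q ≤ (2aq + b) Q
--                               ⇔   2w ≤ (2aq+b)Q  ∧  4 k q Q² ≤ ((2aq+b)Q - 2w)²
-- where Q = q^{n-2}.

memb : ℕ → List ℕ → Bool
memb x []       = false
memb x (y ∷ ys) = (x ≡ᵇ y) ∨ memb x ys

sqrtBound : (L k q Q w : ℕ) → Set
sqrtBound L k q Q w = (2 * w ≤ L) × (4 * k * q * (Q * Q) ≤ (L ∸ 2 * w) * (L ∸ 2 * w))

≤B : (n q w : ℕ) → Set
≤B n q w =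
  if (q <ᵇ 7) ∨ memb q (8 ∷ 9 ∷ 16 ∷ 25 ∷ 27 ∷ 49 ∷ [])
  then w ≤ 2 * q ^ (n ∸ 1)
  else if memb q (7 ∷ 11 ∷ 13 ∷ 17 ∷ [])
  then sqrtBound ((6 * q ∸ 1) * Q) 6 q Q w         -- (3q - √(6q) - 1/2) Q
  else if memb q (19 ∷ 121 ∷ [])
  then sqrtBound ((6 * q + 9) * Q) 6 q Q w         -- (3q - √(6q) + 9/2) Q
  else if memb q (29 ∷ 31 ∷ 32 ∷ [])
  then sqrtBound ((8 * q ∸ 25) * Q) 16 q Q w       -- (4q - 4√q - 25/2) Q, 4√q = √(16q)
  else sqrtBound ((8 * q ∸ 33) * Q) 8 q Q w        -- (4q - √(8q) - 33/2) Q
  where Q = q ^ (n ∸ 2)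

{-# OPTIONS --safe #-}

-- Extend a codeword c to f on all of V = F^(n+1), with f(0) = κ the sum of the coefficients.
-- For a point R, the moments s_k(v) = Σ_y f(v + yR) y^k with k ≤ q - 2 are forms of degree k in v,
-- because a hyperplane not containing R meets the line v + ⟨R⟩ at a height linear in v; s₀ = κ - f(R)
-- is constant.  Along an affine plane z + ⟨d, R⟩ a Hankel determinant of the moments is therefore a
-- polynomial whose leading coefficient is its value at d; if this is nonzero, then few lines of the
-- plane through R carry few support points, so the plane is dense.  Averaging over z, a word of small
-- weight has sparse planes through every line, which excludes 3-secants (3 × 3 determinants) and makes
-- s₀s₂ - s₁² vanish for every support point R.
-- If moreover s₀ ≠ 0, subtract s₀ times the hyperplane s₁ = 0.  The first three moments of the
-- remainder g vanish, so a line through R is either free of g or long for g; in a sparse plane few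
-- lines are long, so more moments of g vanish and long lines become longer, until g is constant on
-- each line through R.  Such a cone g has few nonzeros, and the same argument, one size smaller,
-- shows that it is a multiple of a hyperplane.  If s₀ = 0 for all support points, the support is
-- closed under addition, and is a hyperplane.

module Submission where

open import Defs
open import Algebra.Bundles using (CommutativeRing; CommutativeMonoid; RawRing)
import Algebra.Properties.CommutativeMonoid.Sum
import Algebra.Properties.Ring
import Algebra.Properties.Semiring.Exp
import Algebra.Properties.Semiring.Mult
import Algebra.Properties.Semiring.Sum
import Algebra.Solver.Ring
open import Algebra.Solver.Ring.AlmostCommutativeRing using (fromCommutativeRing; _-Raw-AlmostCommutative⟶_)
open import Data.Bool using (Bool; true; false; _∧_; _∨_; not; if_then_else_; T)
open import Data.Empty using (⊥; ⊥-elim)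
open import Data.Fin using (Fin; zero; suc; toℕ; _≟_)
open import Data.Fin.Permutation using (Permutation; permutation)
open import Data.Fin.Properties using (any?; punchInᵢ≢i; toℕ-fromℕ<; toℕ-injective; toℕ<n; ¬Fin0)
open import Data.Integer as ℤ using (ℤ; -[1+_]; _⊖_) renaming (+_ to pos)
import Data.Integer.Properties as ℤ
open import Data.List using (List; []; _∷_; _++_; length; filterᵇ; concat; concatMap) renaming (map to mapᴸ)
open import Data.List.Properties using () renaming (map-∘ to mapᴸ-∘)
open import Data.Maybe using (just; nothing)
open import Data.Nat using (ℕ; zero; suc; _+_; _*_; _∸_; _^_; _≤_; _<_; z≤n; s≤s; _≤?_; _≡ᵇ_; NonZero; >-nonZero)
open import Data.Nat.Coprimality using (prime⇒coprime; coprime-Bézout)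
open import Data.Nat.DivMod using (_mod_; _%_; _/_; m≡m%n+[m/n]*n; m%n<n)
open import Data.Nat.GCD using (module Bézout)
open import Data.Nat.Primality using (Prime)
open import Data.Nat.Properties hiding (_≟_)
open import Data.Nat.Solver using (module +-*-Solver)
open import Data.Product using (Σ; ∃; _×_; _,_; proj₁; proj₂)
open import Data.Sum using (_⊎_; inj₁; inj₂)
open import Data.Unit using (tt)
open import Data.Vec using (Vec; []; _∷_; zipWith; map; replicate)
open import Data.Vec.Functional using (removeAt)
open import Data.Vec.Properties using (≡-dec)
open import Function using (_∘_)
open import Level using (0ℓ)
open import Relation.Binary.Definitions using (WeaklyDecidable)
open import Relation.Binary.PropositionalEquality
open import Relation.Nullary using (¬_; Dec; yes; no; contradiction; _×-dec_; ¬?)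

-- The threshold `3 * q ∸ 6` is a count with multiplicity. In an affine plane z + ⟨d, R⟩ each of the
-- q lines in direction R is expected to carry three support points; a line with fewer owes the
-- difference, and these debts are paid by roots of the 3 × 3 Hankel determinant. Its plain root
-- count would charge an empty or one-point line only once, so common roots of the entries are
-- divided out first. If s₀ = 0, no line has exactly one point and the entries are s₁, ..., s₄; if
-- s₀ ≠ 0, no line is empty and the entries are minors with pivot s₀. Both ways the total debt is at
-- most 6. Hypotheses of the form `7 + planes ls d R z ≤ 3 * q` ask for one point less than the
-- resulting minimum. This takes moments up to order 4, hence q ≥ 6. For q = 2 and q = 3 the weight
-- bound leaves room for at most one hyperplane. For q = 4 and q = 5 only 2 × 2 determinants are
-- available: they call for a plane with fewer than 2q - 2 points, while the weight bound makes 2q -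
-- 2 an upper bound for the average. Planes through the origin are heavier than that, which forces a
-- lighter plane elsewhere.

private module S = +-*-Solver

-- The concave function `x * (s ∸ x)` is symmetric about s/2, so between `c` and `s ∸ c` it is least
-- at the ends. This verifies the last hypothesis of `growth` for all heights from its value at the
-- initial one.
product-bound : ∀ s c u → c ≤ u → c + u ≤ s → c * (s ∸ c) ≤ (s ∸ u) * u
product-bound s c u c≤u c+u≤s with m≤n⇒∃[o]m+o≡n c≤u | m≤n⇒∃[o]m+o≡n c+u≤s
... | a , refl | b , refl = begin
  c * (c + (c + a) + b ∸ c)           ≡⟨ cong (c *_) (trans (cong (_∸ c) (+-assoc c (c + a) b)) (m+n∸m≡n c (c + a + b))) ⟩
  c * (c + a + b)                     ≤⟨ m≤m+n _ (a * b) ⟩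
  c * (c + a + b) + a * b             ≡⟨ S.solve 3 (λ a b c → c S.:* (c S.:+ a S.:+ b) S.:+ a S.:* b S.:= (c S.:+ b) S.:* (c S.:+ a)) refl a b c ⟩
  (c + b) * (c + a)                   ≡⟨ cong (_* (c + a)) (sym (trans (cong (_∸ (c + a)) (S.solve 3 (λ a b c → c S.:+ (c S.:+ a) S.:+ b S.:= (c S.:+ a) S.:+ (c S.:+ b)) refl a b c)) (m+n∸m≡n (c + a) (c + b)))) ⟩
  (c + (c + a) + b ∸ (c + a)) * (c + a) ∎
  where open ≤-Reasoning

m+n≤o⇒n≤o∸m : ∀ m {n o} → m + n ≤ o → n ≤ o ∸ m
m+n≤o⇒n≤o∸m m {n} le = m+n≤o⇒m≤o∸n n (≤-trans (≤-reflexive (+-comm n m)) le)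

-- Finite sums of natural numbers and indicators.

module ℕ∑ = Algebra.Properties.Semiring.Sum +-*-semiring

∑ : ∀ {n} → (Fin n → ℕ) → ℕ
∑ = ℕ∑.sum

module SumSupport {c ℓ} (M : CommutativeMonoid c ℓ) where
  open CommutativeMonoid M renaming (refl to ≈-refl; trans to ≈-trans; sym to ≈-sym)
  open Algebra.Properties.CommutativeMonoid.Sum M

  sum-zero : ∀ {n} (g : Fin n → Carrier) → (∀ i → g i ≈ ε) → sum g ≈ ε
  sum-zero {n} g g≈ε = ≈-trans (sum-cong-≋ g≈ε) (sum-replicate-zero n)

  sum-single : ∀ {n} (g : Fin n → Carrier) a → (∀ i → i ≢ a → g i ≈ ε) → sum g ≈ g a
  sum-single {suc n} g a g≈ε = ≈-trans (sum-remove {i = a} g)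
    (≈-trans (∙-congˡ (sum-zero (removeAt g a) λ j → g≈ε _ (punchInᵢ≢i a j))) (identityʳ _))

∑-mono : ∀ {n} {f g : Fin n → ℕ} → (∀ i → f i ≤ g i) → ∑ f ≤ ∑ g
∑-mono {zero}  f≤g = z≤n
∑-mono {suc n} f≤g = +-mono-≤ (f≤g zero) (∑-mono λ i → f≤g (suc i))

∑-const : ∀ n c → ∑ {n} (λ _ → c) ≡ n * c
∑-const zero    c = refl
∑-const (suc n) c = cong (c +_) (∑-const n c)

∑-+ : ∀ {n} (f g : Fin n → ℕ) → ∑ (λ i → f i + g i) ≡ ∑ f + ∑ g
∑-+ = ℕ∑.∑-distrib-+

∑-* : ∀ {n} c (f : Fin n → ℕ) → ∑ (λ i → c * f i) ≡ c * ∑ f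
∑-* c f = sym (ℕ∑.*-distribˡ-sum c f)

∑-member : ∀ {n} (f : Fin n → ℕ) i → f i ≤ ∑ f
∑-member f zero    = m≤m+n _ _
∑-member f (suc i) = ≤-trans (∑-member (λ j → f (suc j)) i) (m≤n+m _ _)

𝟙 : ∀ {P : Set} → Dec P → ℕ
𝟙 (yes _) = 1
𝟙 (no _)  = 0

𝟙-yes : ∀ {P : Set} (P? : Dec P) → P → 𝟙 P? ≡ 1
𝟙-yes (yes _) p = refl
𝟙-yes (no ¬p) p = contradiction p ¬p

𝟙-no : ∀ {P : Set} (P? : Dec P) → ¬ P → 𝟙 P? ≡ 0
𝟙-no (yes p) ¬p = contradiction p ¬p
𝟙-no (no _)  ¬p = refl

𝟙≤1 : ∀ {P : Set} (P? : Dec P) → 𝟙 P? ≤ 1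
𝟙≤1 (yes _) = s≤s z≤n
𝟙≤1 (no _)  = z≤n

∑-𝟙≡ : ∀ {n} (a : Fin n) → ∑ (λ i → 𝟙 (i ≟ a)) ≡ 1
∑-𝟙≡ a = trans (SumSupport.sum-single +-0-commutativeMonoid _ a λ i i≢a → 𝟙-no (i ≟ a) i≢a)
               (𝟙-yes (a ≟ a) refl)

-- Arithmetic of the finite field, sums over it, and roots of polynomial functions.

module FieldTheory {q : ℕ} (F : FiniteField q) where
  open FiniteField F public using (0≢1; inverse)

  commutativeRing : CommutativeRing 0ℓ 0ℓ
  commutativeRing = record { isCommutativeRing = FiniteField.isCommutativeRing F }

  open CommutativeRing commutativeRing public
    using (semiring; ring; +-commutativeMonoid; zeroˡ; zeroʳ; -‿inverseʳ)
    renaming ( _+_ to infixl 6 _+ᶠ_; _*_ to infixl 7 _*ᶠ_; -_ to infix 8 -ᶠ_; _-_ to infixl 6 _-ᶠ_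
             ; 0# to 0ᶠ; 1# to 1ᶠ
             ; +-identityˡ to +ᶠ-identityˡ; +-identityʳ to +ᶠ-identityʳ
             ; *-identityˡ to *ᶠ-identityˡ; *-identityʳ to *ᶠ-identityʳ
             ; +-comm to +ᶠ-comm; *-comm to *ᶠ-comm; *-assoc to *ᶠ-assoc)
  open Algebra.Properties.Semiring.Exp semiring public using () renaming (_^_ to infixr 8 _^ᶠ_)
  open Algebra.Properties.Semiring.Mult semiring public using (×1-homo-*; ×-homo-+) renaming (_×_ to infixr 8 _·_)
  open Algebra.Properties.Ring ring public
    using (-‿involutive; -0#≈0#; -‿distribˡ-*; -‿distribʳ-*; -‿+-comm)
  module K∑ = Algebra.Properties.Semiring.Sum semiring

  K : Set
  K = Fin q

  ∑ᶠ : (K → K) → K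
  ∑ᶠ = K∑.sum

  fromℕ : ℕ → K
  fromℕ n = n · 1ᶠ

  -- The operations of `K` are abstract and do not compute, so the ring solver normalises with
  -- integer coefficients and maps them to `K`.
  fromℤ : ℤ → K
  fromℤ (pos n)    = fromℕ n
  fromℤ -[1+ n ] = -ᶠ fromℕ (suc n)

  private
    fromℤ-⊖ : ∀ m n → fromℤ (m ⊖ n) ≡ fromℕ m +ᶠ -ᶠ fromℕ n
    fromℤ-⊖ m zero = sym (trans (cong (fromℕ m +ᶠ_) -0#≈0#) (+ᶠ-identityʳ _))
    fromℤ-⊖ zero (suc n) = sym (+ᶠ-identityˡ _)
    fromℤ-⊖ (suc m) (suc n) = begin
      fromℤ (suc m ⊖ suc n)                      ≡⟨ cong fromℤ (ℤ.[1+m]⊖[1+n]≡m⊖n m n) ⟩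
      fromℤ (m ⊖ n)                              ≡⟨ fromℤ-⊖ m n ⟩
      fromℕ m +ᶠ -ᶠ fromℕ n                      ≡⟨ sym (cong₂ _+ᶠ_ refl (+ᶠ-identityˡ _)) ⟩
      fromℕ m +ᶠ (0ᶠ +ᶠ -ᶠ fromℕ n)              ≡⟨ cong (λ z → fromℕ m +ᶠ (z +ᶠ -ᶠ fromℕ n)) (sym (-‿inverseʳ 1ᶠ)) ⟩
      fromℕ m +ᶠ ((1ᶠ +ᶠ -ᶠ 1ᶠ) +ᶠ -ᶠ fromℕ n)   ≡⟨ cong (fromℕ m +ᶠ_) (CommutativeRing.+-assoc commutativeRing _ _ _) ⟩
      fromℕ m +ᶠ (1ᶠ +ᶠ (-ᶠ 1ᶠ +ᶠ -ᶠ fromℕ n))   ≡⟨ sym (CommutativeRing.+-assoc commutativeRing _ _ _) ⟩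
      fromℕ m +ᶠ 1ᶠ +ᶠ (-ᶠ 1ᶠ +ᶠ -ᶠ fromℕ n)     ≡⟨ cong₂ _+ᶠ_ (+ᶠ-comm _ _) (-‿+-comm _ _) ⟩
      fromℕ (suc m) +ᶠ -ᶠ fromℕ (suc n)          ∎
      where open ≡-Reasoning

    fromℤ-neg : ∀ i → fromℤ (ℤ.- i) ≡ -ᶠ fromℤ i
    fromℤ-neg (pos zero)   = sym -0#≈0#
    fromℤ-neg (pos (suc n))  = refl
    fromℤ-neg -[1+ n ]   = sym (-‿involutive _)

    fromℤ-+ : ∀ i j → fromℤ (i ℤ.+ j) ≡ fromℤ i +ᶠ fromℤ j
    fromℤ-+ (pos m) (pos n) = ×-homo-+ 1ᶠ m n
    fromℤ-+ (pos m) -[1+ n ] = fromℤ-⊖ m (suc n)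
    fromℤ-+ -[1+ m ] (pos n) = trans (fromℤ-⊖ n (suc m)) (+ᶠ-comm _ _)
    fromℤ-+ -[1+ m ] -[1+ n ] = trans
      (cong -ᶠ_ (trans (cong fromℕ (cong suc (sym (+-suc m n)))) (×-homo-+ 1ᶠ (suc m) (suc n))))
      (sym (-‿+-comm _ _))

    fromℤ-ℕ* : ∀ m j → fromℤ (pos m ℤ.* j) ≡ fromℕ m *ᶠ fromℤ j
    fromℤ-ℕ* m (pos n) = trans (cong fromℤ (sym (ℤ.pos-* m n))) (×1-homo-* m n)
    fromℤ-ℕ* m -[1+ n ] = begin
      fromℤ (pos m ℤ.* ℤ.- (pos (suc n)))    ≡⟨ cong fromℤ (sym (ℤ.neg-distribʳ-* (pos m) (pos (suc n)))) ⟩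
      fromℤ (ℤ.- (pos m ℤ.* pos (suc n)))    ≡⟨ fromℤ-neg (pos m ℤ.* pos (suc n)) ⟩
      -ᶠ fromℤ (pos m ℤ.* pos (suc n))       ≡⟨ cong -ᶠ_ (fromℤ-ℕ* m (pos (suc n))) ⟩
      -ᶠ (fromℕ m *ᶠ fromℕ (suc n))    ≡⟨ -‿distribʳ-* _ _ ⟩
      fromℕ m *ᶠ -ᶠ fromℕ (suc n)      ∎
      where open ≡-Reasoning

    fromℤ-* : ∀ i j → fromℤ (i ℤ.* j) ≡ fromℤ i *ᶠ fromℤ j
    fromℤ-* (pos m) j = fromℤ-ℕ* m j
    fromℤ-* -[1+ m ] j = begin
      fromℤ (ℤ.- (pos (suc m)) ℤ.* j)      ≡⟨ cong fromℤ (sym (ℤ.neg-distribˡ-* (pos (suc m)) j)) ⟩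
      fromℤ (ℤ.- (pos (suc m) ℤ.* j))      ≡⟨ fromℤ-neg (pos (suc m) ℤ.* j) ⟩
      -ᶠ fromℤ (pos (suc m) ℤ.* j)         ≡⟨ cong -ᶠ_ (fromℤ-ℕ* (suc m) j) ⟩
      -ᶠ (fromℕ (suc m) *ᶠ fromℤ j)    ≡⟨ -‿distribˡ-* _ _ ⟩
      -ᶠ fromℕ (suc m) *ᶠ fromℤ j      ∎
      where open ≡-Reasoning

    ℤ-rawRing : RawRing 0ℓ 0ℓ
    ℤ-rawRing = CommutativeRing.rawRing ℤ.+-*-commutativeRing

    ℤ⟶K : ℤ-rawRing -Raw-AlmostCommutative⟶ fromCommutativeRing commutativeRing
    ℤ⟶K = record
      { ⟦_⟧ = fromℤ ; +-homo = fromℤ-+ ; *-homo = fromℤ-* ; -‿homo = fromℤ-neg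
      ; 0-homo = refl ; 1-homo = +ᶠ-identityʳ 1ᶠ }

    _coeff≟_ : WeaklyDecidable (λ i j → fromℤ i ≡ fromℤ j)
    i coeff≟ j with i ℤ.≟ j
    ... | yes i≡j = just (cong fromℤ i≡j)
    ... | no _    = nothing

  module Solver = Algebra.Solver.Ring ℤ-rawRing (fromCommutativeRing commutativeRing) ℤ⟶K _coeff≟_
  open Solver using (solve; _:=_; _:+_; _:*_; :-_; _:-_)

  infix 9 _⁻¹
  _⁻¹ : K → K
  x ⁻¹ with x ≟ 0ᶠ
  ... | yes _  = 0ᶠ
  ... | no x≢0 = proj₁ (inverse x x≢0)

  *-inverseʳ : ∀ {x} → x ≢ 0ᶠ → x *ᶠ x ⁻¹ ≡ 1ᶠ
  *-inverseʳ {x} x≢0 with x ≟ 0ᶠ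
  ... | yes x≡0 = contradiction x≡0 x≢0
  ... | no x≢0′ = proj₂ (inverse x x≢0′)

  *-inverseˡ : ∀ {x} → x ≢ 0ᶠ → x ⁻¹ *ᶠ x ≡ 1ᶠ
  *-inverseˡ x≢0 = trans (*ᶠ-comm _ _) (*-inverseʳ x≢0)

  *-cancel-0 : ∀ {x y} → x ≢ 0ᶠ → x *ᶠ y ≡ 0ᶠ → y ≡ 0ᶠ
  *-cancel-0 {x} {y} x≢0 xy≡0 = begin
    y                  ≡⟨ sym (*ᶠ-identityˡ y) ⟩
    1ᶠ *ᶠ y            ≡⟨ cong (_*ᶠ y) (sym (*-inverseˡ x≢0)) ⟩
    x ⁻¹ *ᶠ x *ᶠ y     ≡⟨ *ᶠ-assoc _ _ _ ⟩
    x ⁻¹ *ᶠ (x *ᶠ y)   ≡⟨ cong (x ⁻¹ *ᶠ_) xy≡0 ⟩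
    x ⁻¹ *ᶠ 0ᶠ         ≡⟨ zeroʳ _ ⟩
    0ᶠ                 ∎
    where open ≡-Reasoning

  *-nonzero : ∀ {x y} → x ≢ 0ᶠ → y ≢ 0ᶠ → x *ᶠ y ≢ 0ᶠ
  *-nonzero x≢0 y≢0 xy≡0 = y≢0 (*-cancel-0 x≢0 xy≡0)

  ⁻¹-nonzero : ∀ {x} → x ≢ 0ᶠ → x ⁻¹ ≢ 0ᶠ
  ⁻¹-nonzero {x} x≢0 x⁻¹≡0 =
    0≢1 (trans (sym (trans (cong (x *ᶠ_) x⁻¹≡0) (zeroʳ x))) (*-inverseʳ x≢0))

  x-y≡0⇒x≡y : ∀ {x y} → x -ᶠ y ≡ 0ᶠ → x ≡ y
  x-y≡0⇒x≡y {x} {y} eq = begin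
    x               ≡⟨ solve 2 (λ x y → x := x :- y :+ y) refl x y ⟩
    x -ᶠ y +ᶠ y     ≡⟨ cong (_+ᶠ y) eq ⟩
    0ᶠ +ᶠ y         ≡⟨ +ᶠ-identityˡ y ⟩
    y               ∎
    where open ≡-Reasoning

  x-x≡0 : ∀ {x y} → x ≡ y → x -ᶠ y ≡ 0ᶠ
  x-x≡0 refl = -‿inverseʳ _

  open SumSupport +-commutativeMonoid public
    renaming (sum-zero to ∑ᶠ-zero; sum-single to ∑ᶠ-single)

  ∑ᶠ-cong : ∀ {f g : K → K} → (∀ i → f i ≡ g i) → ∑ᶠ f ≡ ∑ᶠ g
  ∑ᶠ-cong = K∑.sum-cong-≗

  ∑-cong : ∀ {f g : K → ℕ} → (∀ i → f i ≡ g i) → ∑ f ≡ ∑ g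
  ∑-cong = ℕ∑.sum-cong-≗

  translation : K → Permutation q q
  translation t = permutation (_+ᶠ t) (_-ᶠ t)
    (λ y → solve 2 (λ y t → y :- t :+ t := y) refl y t)
    (λ y → solve 2 (λ y t → y :+ t :- t := y) refl y t)

  homothety : ∀ {s} → s ≢ 0ᶠ → Permutation q q
  homothety {s} s≢0 = permutation (s *ᶠ_) (s ⁻¹ *ᶠ_) (cancel (*-inverseʳ s≢0)) (cancel (*-inverseˡ s≢0))
    where
    cancel : ∀ {a b} → a *ᶠ b ≡ 1ᶠ → ∀ y → a *ᶠ (b *ᶠ y) ≡ y
    cancel {a} {b} ab≡1 y = trans (sym (*ᶠ-assoc a b y)) (trans (cong (_*ᶠ y) ab≡1) (*ᶠ-identityˡ y))

  ∑-translate : ∀ (f : K → ℕ) t → ∑ (λ y → f (y +ᶠ t)) ≡ ∑ f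
  ∑-translate f t = sym (ℕ∑.sum-permute f (translation t))

  ∑ᶠ-translate : ∀ (f : K → K) t → ∑ᶠ (λ y → f (y +ᶠ t)) ≡ ∑ᶠ f
  ∑ᶠ-translate f t = sym (K∑.sum-permute f (translation t))

  ∑-scale : ∀ (f : K → ℕ) {s} → s ≢ 0ᶠ → ∑ (λ y → f (s *ᶠ y)) ≡ ∑ f
  ∑-scale f s≢0 = sym (ℕ∑.sum-permute f (homothety s≢0))

  ∑ᶠ-scale : ∀ (f : K → K) {s} → s ≢ 0ᶠ → ∑ᶠ (λ y → f (s *ᶠ y)) ≡ ∑ᶠ f
  ∑ᶠ-scale f s≢0 = sym (K∑.sum-permute f (homothety s≢0))

  ∑ᶠ-+ : ∀ (f g : K → K) → ∑ᶠ (λ y → f y +ᶠ g y) ≡ ∑ᶠ f +ᶠ ∑ᶠ g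
  ∑ᶠ-+ = K∑.∑-distrib-+

  ∑ᶠ-* : ∀ c (f : K → K) → ∑ᶠ (λ y → c *ᶠ f y) ≡ c *ᶠ ∑ᶠ f
  ∑ᶠ-* c f = sym (K∑.*-distribˡ-sum c f)

  -- Translation by `1ᶠ` permutes the field and so preserves the sum `s` of all its elements, yet it
  -- adds `1ᶠ` to each of the `q` terms.
  q·1≡0 : fromℕ q ≡ 0ᶠ
  q·1≡0 = begin
    fromℕ q                                ≡⟨ solve 2 (λ s t → t := t :+ s :- s) refl s (fromℕ q) ⟩
    fromℕ q +ᶠ s -ᶠ s                      ≡⟨ cong (_-ᶠ s) (trans (+ᶠ-comm _ s) (cong (s +ᶠ_) (sym (K∑.sum-replicate q)))) ⟩
    s +ᶠ ∑ᶠ (λ _ → 1ᶠ) -ᶠ s                ≡⟨ cong (_-ᶠ s) (sym (∑ᶠ-+ (λ y → y) (λ _ → 1ᶠ))) ⟩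
    ∑ᶠ (λ y → y +ᶠ 1ᶠ) -ᶠ s                ≡⟨ cong (_-ᶠ s) (∑ᶠ-translate (λ y → y) 1ᶠ) ⟩
    s -ᶠ s                                 ≡⟨ -‿inverseʳ s ⟩
    0ᶠ                                     ∎
    where
    open ≡-Reasoning
    s = ∑ᶠ (λ y → y)

  isz nz : K → ℕ
  isz x = 𝟙 (x ≟ 0ᶠ)
  nz x = 1 ∸ isz x

  isz-0 : ∀ {x} → x ≡ 0ᶠ → isz x ≡ 1
  isz-0 {x} = 𝟙-yes (x ≟ 0ᶠ)

  nz-0 : ∀ {x} → x ≡ 0ᶠ → nz x ≡ 0
  nz-0 {x} eq = cong (1 ∸_) (isz-0 eq)

  nz-≢0 : ∀ {x} → x ≢ 0ᶠ → nz x ≡ 1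
  nz-≢0 {x} x≢0 = cong (1 ∸_) (𝟙-no (x ≟ 0ᶠ) x≢0)

  nz≤1 : ∀ x → nz x ≤ 1
  nz≤1 x = m∸n≤m 1 (isz x)

  -- Deg k g ℓ: the function g is ℓ xᵏ + (lower terms), in Horner form.
  data Deg : ℕ → (K → K) → K → Set where
    base   : ∀ {g ℓ} → (∀ x → g x ≡ ℓ) → Deg zero g ℓ
    horner : ∀ {k g h ℓ} → Deg k h ℓ → ∀ b → (∀ x → g x ≡ x *ᶠ h x +ᶠ b) → Deg (suc k) g ℓ

  Deg-cong : ∀ k {g g′ ℓ ℓ′} → (∀ x → g x ≡ g′ x) → ℓ ≡ ℓ′ → Deg k g ℓ → Deg k g′ ℓ′
  Deg-cong zero    eq refl (base D) = base λ x → trans (sym (eq x)) (D x)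
  Deg-cong (suc k) eq refl (horner D b e) = horner D b λ x → trans (sym (eq x)) (e x)

  Deg-+ : ∀ k {g g′ ℓ ℓ′} → Deg k g ℓ → Deg k g′ ℓ′ → Deg k (λ x → g x +ᶠ g′ x) (ℓ +ᶠ ℓ′)
  Deg-+ zero    (base D) (base D′) = base λ x → cong₂ _+ᶠ_ (D x) (D′ x)
  Deg-+ (suc k) (horner {h = h} D b e) (horner {h = h′} D′ b′ e′) =
    horner (Deg-+ k D D′) (b +ᶠ b′) λ x → trans (cong₂ _+ᶠ_ (e x) (e′ x))
      (solve 5 (λ x h h′ b b′ → x :* h :+ b :+ (x :* h′ :+ b′) := x :* (h :+ h′) :+ (b :+ b′)) refl
        x (h x) (h′ x) b b′)

  Deg-scale : ∀ k c {g ℓ} → Deg k g ℓ → Deg k (λ x → c *ᶠ g x) (c *ᶠ ℓ)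
  Deg-scale zero    c (base D) = base λ x → cong (c *ᶠ_) (D x)
  Deg-scale (suc k) c (horner {h = h} D b e) =
    horner (Deg-scale k c D) (c *ᶠ b) λ x → trans (cong (c *ᶠ_) (e x))
      (solve 4 (λ c x h b → c :* (x :* h :+ b) := x :* (c :* h) :+ c :* b) refl c x (h x) b)

  Deg-neg : ∀ k {g ℓ} → Deg k g ℓ → Deg k (λ x → -ᶠ g x) (-ᶠ ℓ)
  Deg-neg k D = Deg-cong k (λ x → -1* _) (-1* _) (Deg-scale k (-ᶠ 1ᶠ) D)
    where
    -1* : ∀ y → -ᶠ 1ᶠ *ᶠ y ≡ -ᶠ y
    -1* y = trans (sym (-‿distribˡ-* 1ᶠ y)) (cong -ᶠ_ (*ᶠ-identityˡ y))

  -- The leading coefficient may be `0ᶠ`, so the degree is only formal; raising it aligns two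
  -- summands for `Deg-+`.
  Deg-raise : ∀ k {g ℓ} → Deg k g ℓ → Deg (suc k) g 0ᶠ
  Deg-raise zero {g} {ℓ} (base D) = horner {h = λ _ → 0ᶠ} (base λ _ → refl) ℓ
    λ x → trans (D x) (sym (trans (cong (_+ᶠ ℓ) (zeroʳ x)) (+ᶠ-identityˡ ℓ)))
  Deg-raise (suc k) (horner D b e) = horner (Deg-raise k D) b e

  Deg-raise⁺ : ∀ k l {g ℓ} → Deg l g ℓ → Deg (suc k + l) g 0ᶠ
  Deg-raise⁺ zero    l D = Deg-raise l D
  Deg-raise⁺ (suc k) l D = Deg-raise (suc k + l) (Deg-raise⁺ k l D)

  Deg-* : ∀ k l {g h ℓ ℓ′} → Deg k g ℓ → Deg l h ℓ′ → Deg (k + l) (λ x → g x *ᶠ h x) (ℓ *ᶠ ℓ′)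
  Deg-* zero l {ℓ = ℓ} (base D) E = Deg-cong l (λ x → cong (_*ᶠ _) (sym (D x))) refl (Deg-scale l ℓ E)
  Deg-* (suc k) l {g} {h} (horner {h = g′} D b e) E =
    Deg-cong (suc k + l)
      (λ x → trans (solve 4 (λ x g h b → x :* (g :* h) :+ b :* h := (x :* g :+ b) :* h) refl x (g′ x) (h x) b)
                   (cong (_*ᶠ h x) (sym (e x))))
      (+ᶠ-identityʳ _)
      (Deg-+ (suc k + l) (horner (Deg-* k l D E) 0ᶠ λ x → sym (+ᶠ-identityʳ _)) (Deg-raise⁺ k l (Deg-scale l b E)))

  Deg-^ : ∀ k u w → Deg k (λ x → (u +ᶠ x *ᶠ w) ^ᶠ k) (w ^ᶠ k)
  Deg-^ zero    u w = base λ x → refl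
  Deg-^ (suc k) u w = Deg-* 1 k (horner {h = λ _ → w} (base λ _ → refl) u λ x → +ᶠ-comm _ _) (Deg-^ k u w)

  -- Synthetic division. The quotient keeps the leading coefficient, so a determinant of leading
  -- coefficients stays nonzero when common roots are divided out of its entries.
  Deg-factor : ∀ k {g ℓ} → Deg (suc k) g ℓ → ∀ a → Σ (K → K) λ h → Deg k h ℓ × (∀ x → g x ≡ (x -ᶠ a) *ᶠ h x +ᶠ g a)
  Deg-factor zero {g} {ℓ} (horner {h = h} (base D) b e) a = h , base D , λ x → begin
    g x                                     ≡⟨ e x ⟩
    x *ᶠ h x +ᶠ b                           ≡⟨ solve 4 (λ x h b a → x :* h :+ b := (x :- a) :* h :+ (a :* h :+ b)) refl x (h x) b a ⟩
    (x -ᶠ a) *ᶠ h x +ᶠ (a *ᶠ h x +ᶠ b)      ≡⟨ cong (λ z → (x -ᶠ a) *ᶠ h x +ᶠ (a *ᶠ z +ᶠ b)) (trans (D x) (sym (D a))) ⟩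
    (x -ᶠ a) *ᶠ h x +ᶠ (a *ᶠ h a +ᶠ b)      ≡⟨ cong ((x -ᶠ a) *ᶠ h x +ᶠ_) (sym (e a)) ⟩
    (x -ᶠ a) *ᶠ h x +ᶠ g a                  ∎
    where open ≡-Reasoning
  Deg-factor (suc k) {g} {ℓ} (horner {h = h} D b e) a with Deg-factor k D a
  ... | h₁ , D₁ , e₁ = (λ x → h x +ᶠ a *ᶠ h₁ x)
    , Deg-cong (suc k) (λ _ → refl) (+ᶠ-identityʳ ℓ) (Deg-+ (suc k) D (Deg-raise k (Deg-scale k a D₁)))
    , λ x → begin
    g x                                                     ≡⟨ e x ⟩
    x *ᶠ h x +ᶠ b                                           ≡⟨ cong (λ z → x *ᶠ z +ᶠ b) (e₁ x) ⟩
    x *ᶠ ((x -ᶠ a) *ᶠ h₁ x +ᶠ h a) +ᶠ b                     ≡⟨ solve 5 (λ x a h₁ h b → x :* ((x :- a) :* h₁ :+ h) :+ b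
                                                                 := (x :- a) :* ((x :- a) :* h₁ :+ h :+ a :* h₁) :+ (a :* h :+ b)) refl x a (h₁ x) (h a) b ⟩
    (x -ᶠ a) *ᶠ ((x -ᶠ a) *ᶠ h₁ x +ᶠ h a +ᶠ a *ᶠ h₁ x) +ᶠ (a *ᶠ h a +ᶠ b)
                                                            ≡⟨ cong₂ (λ z w → (x -ᶠ a) *ᶠ (z +ᶠ a *ᶠ h₁ x) +ᶠ w) (sym (e₁ x)) (sym (e a)) ⟩
    (x -ᶠ a) *ᶠ (h x +ᶠ a *ᶠ h₁ x) +ᶠ g a                   ∎
    where open ≡-Reasoning

  Deg-divide : ∀ k {g ℓ} → Deg (suc k) g ℓ → ∀ {a} → g a ≡ 0ᶠ →
               Σ (K → K) λ h → Deg k h ℓ × (∀ x → g x ≡ (x -ᶠ a) *ᶠ h x)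
  Deg-divide k D {a} ga≡0 with Deg-factor k D a
  ... | h , E , e = h , E , λ x → trans (e x) (trans (cong (_ +ᶠ_) ga≡0) (+ᶠ-identityʳ _))

  quotient-root : ∀ {x a y} → x ≢ a → (x -ᶠ a) *ᶠ y ≡ 0ᶠ → y ≡ 0ᶠ
  quotient-root x≢a = *-cancel-0 (λ eq → x≢a (x-y≡0⇒x≡y eq))

  roots≤degree : ∀ k {g ℓ} → Deg k g ℓ → ℓ ≢ 0ᶠ → ∑ (λ x → isz (g x)) ≤ k
  roots≤degree k {g} D ℓ≢0 with any? (λ x → g x ≟ 0ᶠ)
  roots≤degree k {g} D ℓ≢0 | no ¬root = ≤-trans
    (≤-reflexive (SumSupport.sum-zero +-0-commutativeMonoid _ λ x → 𝟙-no (g x ≟ 0ᶠ) λ eq → ¬root (x , eq))) z≤n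
  roots≤degree zero (base D) ℓ≢0 | yes (a , ga≡0) = contradiction (trans (sym (D a)) ga≡0) ℓ≢0
  roots≤degree (suc k) {g} D ℓ≢0 | yes (a , ga≡0) with Deg-divide k D ga≡0
  ... | h , E , e = begin
    ∑ (λ x → isz (g x))                                  ≤⟨ ∑-mono bound ⟩
    ∑ (λ x → 𝟙 (x ≟ a) + isz (h x))                      ≡⟨ ∑-+ (λ x → 𝟙 (x ≟ a)) (λ x → isz (h x)) ⟩
    ∑ (λ x → 𝟙 (x ≟ a)) + ∑ (λ x → isz (h x))            ≤⟨ +-mono-≤ (≤-reflexive (∑-𝟙≡ a)) (roots≤degree k E ℓ≢0) ⟩
    suc k                                                ∎
    where
    open ≤-Reasoning
    bound : ∀ x → isz (g x) ≤ 𝟙 (x ≟ a) + isz (h x)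
    bound x with x ≟ a
    ... | yes _ = ≤-trans (𝟙≤1 (g x ≟ 0ᶠ)) (s≤s z≤n)
    ... | no x≢a with g x ≟ 0ᶠ
    ...   | no _ = z≤n
    ...   | yes gx≡0 = ≤-reflexive (sym (isz-0 (quotient-root x≢a (trans (sym (e x)) gx≡0))))

-- Power sums, supports and moments of functions on the field.

module FiniteFunctions {q : ℕ} (F : FiniteField q) where
  open FieldTheory F
  open Solver using (solve; _:=_; _:+_; _:*_; :-_; _:-_; con)

  Deg-const : ∀ k c → Deg (suc k) (λ _ → c) 0ᶠ
  Deg-const zero    c = Deg-raise zero (base λ _ → refl)
  Deg-const (suc k) c = Deg-raise (suc k) (Deg-const k c)

  1^ : ∀ k → 1ᶠ ^ᶠ k ≡ 1ᶠ
  1^ zero    = refl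
  1^ (suc k) = trans (*ᶠ-identityˡ _) (1^ k)

  *-^ : ∀ x y k → (x *ᶠ y) ^ᶠ k ≡ x ^ᶠ k *ᶠ y ^ᶠ k
  *-^ x y zero    = sym (*ᶠ-identityˡ _)
  *-^ x y (suc k) = trans (cong (x *ᶠ y *ᶠ_) (*-^ x y k))
    (solve 4 (λ x y a b → x :* y :* (a :* b) := x :* a :* (y :* b)) refl x y (x ^ᶠ k) (y ^ᶠ k))

  nz+isz : ∀ x → nz x + isz x ≡ 1
  nz+isz x = m∸n+n≡m (𝟙≤1 (x ≟ 0ᶠ))

  -- Otherwise all `q ∸ 1` nonzero elements would be roots of x^(k+1) - 1, whose degree is at most
  -- `q ∸ 2`. The element found stands in for a generator of the multiplicative group.
  nonzero-power≢1 : ∀ k → suc (suc k) < q → ∃ λ g → g ≢ 0ᶠ × g ^ᶠ suc k ≢ 1ᶠ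
  nonzero-power≢1 k k<q with any? (λ g → ¬? (g ≟ 0ᶠ) ×-dec ¬? (g ^ᶠ suc k ≟ 1ᶠ))
  ... | yes found = found
  ... | no ¬found = contradiction k<q (<⇒≱ (s≤s q≤1+k))
    where
    D : Deg (suc k) (λ x → x ^ᶠ suc k -ᶠ 1ᶠ) 1ᶠ
    D = Deg-cong (suc k)
      (λ x → cong (λ z → z ^ᶠ suc k -ᶠ 1ᶠ) (trans (+ᶠ-identityˡ _) (*ᶠ-identityʳ x)))
      (trans (+ᶠ-identityʳ _) (1^ (suc k)))
      (Deg-+ (suc k) (Deg-^ (suc k) 0ᶠ 1ᶠ) (Deg-const k (-ᶠ 1ᶠ)))
    bound : ∀ x → nz x ≤ isz (x ^ᶠ suc k -ᶠ 1ᶠ)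
    bound x with x ≟ 0ᶠ
    ... | yes x≡0 = z≤n
    ... | no x≢0 with x ^ᶠ suc k ≟ 1ᶠ
    ...   | yes eq = ≤-reflexive (sym (isz-0 (x-x≡0 eq)))
    ...   | no neq = contradiction (x , x≢0 , neq) ¬found
    q≤1+k : q ≤ suc (suc k)
    q≤1+k = begin
      q                                              ≡⟨ sym (trans (∑-const q 1) (*-identityʳ q)) ⟩
      ∑ {q} (λ _ → 1)                                ≡⟨ ∑-cong (λ x → sym (nz+isz x)) ⟩
      ∑ (λ x → nz x + isz x)                         ≡⟨ ∑-+ nz isz ⟩
      ∑ nz + ∑ isz                                   ≤⟨ +-mono-≤ (≤-trans (∑-mono bound) (roots≤degree (suc k) D (λ e → 0≢1 (sym e)))) (≤-reflexive (∑-𝟙≡ 0ᶠ)) ⟩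
      suc k + 1                                      ≡⟨ +-comm (suc k) 1 ⟩
      suc (suc k)                                    ∎
      where open ≤-Reasoning

  -- Scaling the variable by `g` permutes the terms but multiplies the sum by a factor different
  -- from `1ᶠ`. At exponent zero `0ᶠ ^ᶠ 0` is `1ᶠ`, so the sum is `fromℕ q`.
  ∑ᶠ-power : ∀ k → suc k < q → ∑ᶠ (λ y → y ^ᶠ k) ≡ 0ᶠ
  ∑ᶠ-power zero    _ = trans (K∑.sum-replicate q) q·1≡0
  ∑ᶠ-power (suc k) k<q with nonzero-power≢1 k k<q
  ... | g , g≢0 , gᵏ≢1 = *-cancel-0 (λ eq → gᵏ≢1 (x-y≡0⇒x≡y eq)) (begin
    (g ^ᶠ suc k -ᶠ 1ᶠ) *ᶠ s                          ≡⟨ solve 3 (λ a e s → (a :- e) :* s := a :* s :- e :* s) refl (g ^ᶠ suc k) 1ᶠ s ⟩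
    g ^ᶠ suc k *ᶠ s -ᶠ 1ᶠ *ᶠ s                       ≡⟨ x-x≡0 (trans scaled (sym (*ᶠ-identityˡ s))) ⟩
    0ᶠ                                               ∎)
    where
    open ≡-Reasoning
    s = ∑ᶠ (λ y → y ^ᶠ suc k)
    scaled : g ^ᶠ suc k *ᶠ s ≡ s
    scaled = trans (sym (∑ᶠ-* _ _)) (trans (∑ᶠ-cong λ y → sym (*-^ g y (suc k))) (∑ᶠ-scale (λ y → y ^ᶠ suc k) g≢0))

  supp : (K → K) → ℕ
  supp g = ∑ (λ y → nz (g y))

  zeroAt : K → (K → K) → K → K
  zeroAt a g y with y ≟ a
  ... | yes _ = 0ᶠ
  ... | no _  = g y

  zeroAt-eq : ∀ a g → zeroAt a g a ≡ 0ᶠ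
  zeroAt-eq a g with a ≟ a
  ... | yes _  = refl
  ... | no a≢a = contradiction refl a≢a

  zeroAt-≢ : ∀ {a} g {y} → y ≢ a → zeroAt a g y ≡ g y
  zeroAt-≢ {a} g {y} y≢a with y ≟ a
  ... | yes y≡a = contradiction y≡a y≢a
  ... | no _    = refl

  only : K → (K → K) → K → K
  only a g y with y ≟ a
  ... | yes _ = g y
  ... | no _  = 0ᶠ

  only-eq : ∀ a g → only a g a ≡ g a
  only-eq a g with a ≟ a
  ... | yes _  = refl
  ... | no a≢a = contradiction refl a≢a

  only-≢ : ∀ {a} g {y} → y ≢ a → only a g y ≡ 0ᶠ
  only-≢ {a} g {y} y≢a with y ≟ a
  ... | yes y≡a = contradiction y≡a y≢a
  ... | no _    = refl

  ∑ᶠ-zeroAt : ∀ a f → ∑ᶠ f ≡ f a +ᶠ ∑ᶠ (zeroAt a f)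
  ∑ᶠ-zeroAt a f = begin
    ∑ᶠ f                                    ≡⟨ ∑ᶠ-cong split ⟩
    ∑ᶠ (λ y → only a f y +ᶠ zeroAt a f y)   ≡⟨ ∑ᶠ-+ (only a f) (zeroAt a f) ⟩
    ∑ᶠ (only a f) +ᶠ ∑ᶠ (zeroAt a f)        ≡⟨ cong (_+ᶠ ∑ᶠ (zeroAt a f)) (trans (∑ᶠ-single (only a f) a λ y → only-≢ f) (only-eq a f)) ⟩
    f a +ᶠ ∑ᶠ (zeroAt a f)                  ∎
    where
    open ≡-Reasoning
    split : ∀ y → f y ≡ only a f y +ᶠ zeroAt a f y
    split y with y ≟ a
    ... | yes _ = sym (+ᶠ-identityʳ _)
    ... | no _  = sym (+ᶠ-identityˡ _)

  ∑ᶠ-pair : ∀ f {a b} → b ≢ a → (∀ y → y ≢ a → y ≢ b → f y ≡ 0ᶠ) → ∑ᶠ f ≡ f a +ᶠ f b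
  ∑ᶠ-pair f {a} {b} b≢a vanish = trans (∑ᶠ-zeroAt a f) (cong (f a +ᶠ_)
    (trans (∑ᶠ-single (zeroAt a f) b λ y y≢b → vanish′ y y≢b) (zeroAt-≢ f b≢a)))
    where
    vanish′ : ∀ y → y ≢ b → zeroAt a f y ≡ 0ᶠ
    vanish′ y y≢b with y ≟ a
    ... | yes _  = refl
    ... | no y≢a = vanish y y≢a y≢b

  ∑ᶠ-triple : ∀ f {a b c} → b ≢ a → c ≢ a → c ≢ b → (∀ y → y ≢ a → y ≢ b → y ≢ c → f y ≡ 0ᶠ) →
              ∑ᶠ f ≡ f a +ᶠ (f b +ᶠ f c)
  ∑ᶠ-triple f {a} {b} {c} b≢a c≢a c≢b vanish = trans (∑ᶠ-zeroAt a f) (cong (f a +ᶠ_)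
    (trans (∑ᶠ-pair (zeroAt a f) c≢b vanish′) (cong₂ _+ᶠ_ (zeroAt-≢ f b≢a) (zeroAt-≢ f c≢a))))
    where
    vanish′ : ∀ y → y ≢ b → y ≢ c → zeroAt a f y ≡ 0ᶠ
    vanish′ y y≢b y≢c with y ≟ a
    ... | yes _  = refl
    ... | no y≢a = vanish y y≢a y≢b y≢c

  nonzero? : ∀ (g : K → K) → Dec (∃ λ y → g y ≢ 0ᶠ)
  nonzero? g = any? (λ y → ¬? (g y ≟ 0ᶠ))

  ¬nonzero⇒0 : ∀ {g : K → K} → ¬ (∃ λ y → g y ≢ 0ᶠ) → ∀ y → g y ≡ 0ᶠ
  ¬nonzero⇒0 {g} ¬∃ y with g y ≟ 0ᶠ
  ... | yes eq = eq
  ... | no neq = contradiction (y , neq) ¬∃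

  supp-0 : ∀ g → (∀ y → g y ≡ 0ᶠ) → supp g ≡ 0
  supp-0 g g≡0 = SumSupport.sum-zero +-0-commutativeMonoid _ λ y → nz-0 (g≡0 y)

  supp≥1 : ∀ g {y} → g y ≢ 0ᶠ → 1 ≤ supp g
  supp≥1 g {y} gy≢0 = ≤-trans (≤-reflexive (sym (nz-≢0 gy≢0))) (∑-member (λ y → nz (g y)) y)

  supp-zeroAt : ∀ g {a} → g a ≢ 0ᶠ → suc (supp (zeroAt a g)) ≤ supp g
  supp-zeroAt g {a} ga≢0 = begin
    1 + supp (zeroAt a g)                                    ≡⟨ cong (_+ supp (zeroAt a g)) (sym (∑-𝟙≡ a)) ⟩
    ∑ (λ y → 𝟙 (y ≟ a)) + supp (zeroAt a g)                  ≡⟨ sym (∑-+ (λ y → 𝟙 (y ≟ a)) (λ y → nz (zeroAt a g y))) ⟩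
    ∑ (λ y → 𝟙 (y ≟ a) + nz (zeroAt a g y))                  ≤⟨ ∑-mono bound ⟩
    supp g                                                   ∎
    where
    open ≤-Reasoning
    bound : ∀ y → 𝟙 (y ≟ a) + nz (zeroAt a g y) ≤ nz (g y)
    bound y with y ≟ a
    ... | yes refl = ≤-reflexive (trans (cong suc (nz-0 refl)) (sym (nz-≢0 ga≢0)))
    ... | no _     = ≤-refl

  -- With at most two support points the moments are explicit, and the Hankel determinants can be
  -- evaluated on them; from three points on only the number matters.
  data Small (g : K → K) : Set where
    none : (∀ y → g y ≡ 0ᶠ) → Small g
    one  : ∀ a → g a ≢ 0ᶠ → (∀ y → y ≢ a → g y ≡ 0ᶠ) → Small g
    two  : ∀ a b → b ≢ a → g a ≢ 0ᶠ → g b ≢ 0ᶠ → (∀ y → y ≢ a → y ≢ b → g y ≡ 0ᶠ) → Small g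

  small? : ∀ g → Small g ⊎ 3 ≤ supp g
  small? g with nonzero? g
  ... | no ¬∃ = inj₁ (none (¬nonzero⇒0 ¬∃))
  ... | yes (a , ga≢0) with nonzero? (zeroAt a g)
  ...   | no ¬∃ = inj₁ (one a ga≢0 λ y y≢a → trans (sym (zeroAt-≢ g y≢a)) (¬nonzero⇒0 ¬∃ y))
  ...   | yes (b , hb≢0) with nonzero? (zeroAt b (zeroAt a g))
  ...     | yes (c , kc≢0) = inj₂ (≤-trans (s≤s (≤-trans (s≤s (supp≥1 (zeroAt b (zeroAt a g)) {c} kc≢0)) (supp-zeroAt (zeroAt a g) hb≢0))) (supp-zeroAt g ga≢0))
  ...     | no ¬∃ = inj₁ (two a b b≢a ga≢0 (λ gb≡0 → hb≢0 (trans (zeroAt-≢ g b≢a) gb≡0))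
              λ y y≢a y≢b → trans (sym (zeroAt-≢ g y≢a)) (trans (sym (zeroAt-≢ (zeroAt a g) y≢b)) (¬nonzero⇒0 ¬∃ y)))
    where
    b≢a : b ≢ a
    b≢a refl = hb≢0 (zeroAt-eq a g)

  moment : (K → K) → ℕ → K
  moment g k = ∑ᶠ (λ y → g y *ᶠ y ^ᶠ k)

  moment-none : ∀ {g} → (∀ y → g y ≡ 0ᶠ) → ∀ k → moment g k ≡ 0ᶠ
  moment-none g≡0 k = ∑ᶠ-zero _ λ y → trans (cong (_*ᶠ _) (g≡0 y)) (zeroˡ _)

  moment-one : ∀ {g a} → (∀ y → y ≢ a → g y ≡ 0ᶠ) → ∀ k → moment g k ≡ g a *ᶠ a ^ᶠ k
  moment-one vanish k = ∑ᶠ-single _ _ λ y y≢a → trans (cong (_*ᶠ _) (vanish y y≢a)) (zeroˡ _)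

  moment-two : ∀ {g a b} → b ≢ a → (∀ y → y ≢ a → y ≢ b → g y ≡ 0ᶠ) →
               ∀ k → moment g k ≡ g a *ᶠ a ^ᶠ k +ᶠ g b *ᶠ b ^ᶠ k
  moment-two b≢a vanish k = ∑ᶠ-pair _ b≢a λ y y≢a y≢b → trans (cong (_*ᶠ _) (vanish y y≢a y≢b)) (zeroˡ _)

  -- A Vandermonde argument: each further vanishing moment forces one more support point.
  moments⇒supp : ∀ r g → (∀ k → k < r → moment g k ≡ 0ᶠ) → ∀ {y} → g y ≢ 0ᶠ → r < supp g
  moments⇒supp zero    g vanish gy≢0 = supp≥1 g gy≢0
  moments⇒supp (suc r) g vanish {y} gy≢0 with any? (λ a → ¬? (a ≟ y) ×-dec ¬? (g a ≟ 0ᶠ))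
  ... | no ¬∃ = contradiction
      (trans (sym (trans (moment-one only-y 0) (*ᶠ-identityʳ _))) (vanish 0 (s≤s z≤n))) gy≢0
    where
    only-y : ∀ a → a ≢ y → g a ≡ 0ᶠ
    only-y a a≢y with g a ≟ 0ᶠ
    ... | yes eq = eq
    ... | no neq = contradiction (a , a≢y , neq) ¬∃
  ... | yes (a , a≢y , ga≢0) = begin
    suc (suc r)                                ≤⟨ s≤s (moments⇒supp r h h-vanish hy≢0) ⟩
    1 + supp h                                 ≤⟨ s≤s (∑-mono bound) ⟩
    1 + supp (zeroAt a g)                      ≤⟨ supp-zeroAt g ga≢0 ⟩
    supp g                                     ∎
    where
    open ≤-Reasoning
    -- The factor `x -ᶠ a` removes the support point `a` and costs one moment: moment k of `h` is
    -- moment k+1 of `g` minus `a` times moment k.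
    h : K → K
    h x = (x -ᶠ a) *ᶠ g x
    hy≢0 : h y ≢ 0ᶠ
    hy≢0 = *-nonzero (λ eq → a≢y (sym (x-y≡0⇒x≡y eq))) gy≢0
    bound : ∀ x → nz (h x) ≤ nz (zeroAt a g x)
    bound x with x ≟ a
    ... | yes refl = ≤-trans (≤-reflexive (nz-0 (trans (cong (_*ᶠ _) (-‿inverseʳ a)) (zeroˡ _)))) z≤n
    ... | no _ with g x ≟ 0ᶠ
    ...   | yes gx≡0 = ≤-reflexive (nz-0 (trans (cong (_ *ᶠ_) gx≡0) (zeroʳ _)))
    ...   | no gx≢0 = nz≤1 (h x)
    h-vanish : ∀ k → k < r → moment h k ≡ 0ᶠ
    h-vanish k k<r = trans (∑ᶠ-cong expand) (trans (∑ᶠ-+ (λ x → g x *ᶠ x ^ᶠ suc k) (λ x → -ᶠ a *ᶠ (g x *ᶠ x ^ᶠ k)))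
      (trans (cong₂ _+ᶠ_ (vanish (suc k) (s≤s k<r))
                (trans (∑ᶠ-* (-ᶠ a) _) (trans (cong (-ᶠ a *ᶠ_) (vanish k (m<n⇒m<1+n k<r))) (zeroʳ _))))
             (+ᶠ-identityʳ _)))
      where
      expand : ∀ x → h x *ᶠ x ^ᶠ k ≡ g x *ᶠ x ^ᶠ suc k +ᶠ -ᶠ a *ᶠ (g x *ᶠ x ^ᶠ k)
      expand x = solve 4 (λ x a g p → (x :- a) :* g :* p := g :* (x :* p) :+ :- a :* (g :* p)) refl x a (g x) (x ^ᶠ k)

  -- The moments of a constant up to order `q ∸ 2` are multiples of vanishing power sums. So `g`
  -- minus its value at `y` has `q ∸ 1` vanishing moments, and if nonzero it would need all `q`
  -- elements as support, although it vanishes at `y`.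
  moments⇒constant : ∀ g → (∀ k → suc k < q → moment g k ≡ 0ᶠ) → ∀ x y → g x ≡ g y
  moments⇒constant g vanish x y with g x ≟ g y
  ... | yes eq = eq
  ... | no neq = contradiction (moments⇒supp′ q refl) (<⇒≱ supp≤)
    where
    h : K → K
    h z = g z -ᶠ g y
    supp≤ : suc (supp h) ≤ q
    supp≤ = begin
      1 + supp h                                     ≡⟨ cong (_+ supp h) (sym (∑-𝟙≡ y)) ⟩
      ∑ (λ z → 𝟙 (z ≟ y)) + supp h                   ≡⟨ sym (∑-+ (λ z → 𝟙 (z ≟ y)) (λ z → nz (h z))) ⟩
      ∑ (λ z → 𝟙 (z ≟ y) + nz (h z))                 ≤⟨ ∑-mono bound ⟩
      ∑ {q} (λ _ → 1)                                ≡⟨ trans (∑-const q 1) (*-identityʳ q) ⟩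
      q                                              ∎
      where
      open ≤-Reasoning
      bound : ∀ z → 𝟙 (z ≟ y) + nz (h z) ≤ 1
      bound z with z ≟ y
      ... | yes refl = ≤-reflexive (cong suc (nz-0 (-‿inverseʳ _)))
      ... | no _     = nz≤1 (h z)
    h-vanish : ∀ k → suc k < q → moment h k ≡ 0ᶠ
    h-vanish k k<q = trans (∑ᶠ-cong (λ z → solve 3 (λ g c p → (g :- c) :* p := g :* p :+ :- c :* p) refl (g z) (g y) (z ^ᶠ k)))
      (trans (∑ᶠ-+ (λ z → g z *ᶠ z ^ᶠ k) (λ z → -ᶠ g y *ᶠ z ^ᶠ k))
      (trans (cong₂ _+ᶠ_ (vanish k k<q) (trans (∑ᶠ-* (-ᶠ g y) _) (trans (cong (-ᶠ g y *ᶠ_) (∑ᶠ-power k k<q)) (zeroʳ _))))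
        (+ᶠ-identityʳ _)))
    moments⇒supp′ : ∀ m → m ≡ q → q ≤ supp h
    moments⇒supp′ zero    refl = z≤n
    moments⇒supp′ (suc m) refl =
      moments⇒supp m h (λ k k<m → h-vanish k (s≤s k<m)) {x} λ eq → neq (x-y≡0⇒x≡y eq)

  -- Below, ω x is a lower bound for the multiplicity of x as a root of a Hankel
  -- determinant: roots common to all entries count as often as the determinant has rows.

  clear : K → (K → ℕ) → K → ℕ
  clear a ω x with x ≟ a
  ... | yes _ = 0
  ... | no _  = ω x

  ∑-clear : ∀ m a (ω : K → ℕ) → (∀ x → ω x ≤ m) → ∑ ω ≤ m + ∑ (clear a ω)
  ∑-clear m a ω ω≤m = begin
    ∑ ω                                            ≤⟨ ∑-mono bound ⟩
    ∑ (λ x → m * 𝟙 (x ≟ a) + clear a ω x)          ≡⟨ ∑-+ (λ x → m * 𝟙 (x ≟ a)) (clear a ω) ⟩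
    ∑ (λ x → m * 𝟙 (x ≟ a)) + ∑ (clear a ω)        ≡⟨ cong (_+ ∑ (clear a ω)) (trans (∑-* m (λ x → 𝟙 (x ≟ a))) (trans (cong (m *_) (∑-𝟙≡ a)) (*-identityʳ m))) ⟩
    m + ∑ (clear a ω)                              ∎
    where
    open ≤-Reasoning
    bound : ∀ x → ω x ≤ m * 𝟙 (x ≟ a) + clear a ω x
    bound x with x ≟ a
    ... | yes _ = ≤-trans (ω≤m x) (≤-reflexive (sym (trans (+-identityʳ _) (*-identityʳ m))))
    ... | no _  = m≤n+m _ _

  clear-≤ : ∀ a ω {m} → (∀ x → ω x ≤ m) → ∀ x → clear a ω x ≤ m
  clear-≤ a ω ω≤m x with x ≟ a
  ... | yes _ = z≤n
  ... | no _  = ω≤m x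

  clear-≥ : ∀ a ω {m} x → suc m ≤ clear a ω x → x ≢ a × suc m ≤ ω x
  clear-≥ a ω x p with x ≟ a
  clear-≥ a ω x () | yes _
  ... | no x≢a = x≢a , p

  ω≤isz : ∀ (f : K → K) m (ω : K → ℕ) x → ω x ≤ m → (1 ≤ ω x → f x ≡ 0ᶠ) → ω x ≤ m * isz (f x)
  ω≤isz f m ω x ω≤m root with 1 ≤? ω x
  ... | yes 1≤ω = ≤-trans ω≤m (≤-reflexive (sym (trans (cong (m *_) (isz-0 (root 1≤ω))) (*-identityʳ m))))
  ... | no 1≰ω  = ≤-trans (≤-pred (≰⇒> 1≰ω)) z≤n

  ∑ω≤ : ∀ d {f ℓ} → Deg d f ℓ → ℓ ≢ 0ᶠ → ∀ m (ω : K → ℕ) → (∀ x → ω x ≤ m) → (∀ x → 1 ≤ ω x → f x ≡ 0ᶠ) → ∑ ω ≤ m * d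
  ∑ω≤ d {f} D ℓ≢0 m ω ω≤m root = begin
    ∑ ω                            ≤⟨ ∑-mono (λ x → ω≤isz f m ω x (ω≤m x) (root x)) ⟩
    ∑ (λ x → m * isz (f x))        ≡⟨ ∑-* m (λ x → isz (f x)) ⟩
    m * ∑ (λ x → isz (f x))        ≤⟨ *-monoʳ-≤ m (roots≤degree d D ℓ≢0) ⟩
    m * d                          ∎
    where open ≤-Reasoning

  -- Root multiplicities of Hankel determinants of order 2 and 3.

  square-root : ∀ {x} → x *ᶠ x ≡ 0ᶠ → x ≡ 0ᶠ
  square-root {x} xx≡0 with x ≟ 0ᶠ
  ... | yes eq = eq
  ... | no neq = *-cancel-0 neq xx≡0

  det₂ : K → K → K → K
  det₂ a b c = a *ᶠ c -ᶠ b *ᶠ b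

  det₂-cong : ∀ {a a′ b b′ c c′} → a ≡ a′ → b ≡ b′ → c ≡ c′ → det₂ a b c ≡ det₂ a′ b′ c′
  det₂-cong refl refl refl = refl

  det₂-a≡0 : ∀ {a b c} → a ≡ 0ᶠ → det₂ a b c ≡ 0ᶠ → b ≡ 0ᶠ
  det₂-a≡0 {a} {b} {c} a≡0 eq = square-root (sym (x-y≡0⇒x≡y (trans (cong (_-ᶠ b *ᶠ b) (sym (trans (cong (_*ᶠ c) a≡0) (zeroˡ c)))) eq)))

  Deg-det₂ : ∀ a e {A B C α β γ} → Deg a A α → Deg (a + e) B β → Deg (a + (e + e)) C γ →
             Deg (a + e + (a + e)) (λ x → det₂ (A x) (B x) (C x)) (det₂ α β γ)
  Deg-det₂ a e {A} {B} {C} {α} {β} {γ} DA DB DC = Deg-+ (a + e + (a + e))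
    (subst (λ d → Deg d (λ x → A x *ᶠ C x) (α *ᶠ γ)) eq (Deg-* a (a + (e + e)) DA DC))
    (Deg-neg (a + e + (a + e)) (Deg-* (a + e) (a + e) DB DB))
    where
    eq : a + (a + (e + e)) ≡ a + e + (a + e)
    eq = S.solve 2 (λ a e → a S.:+ (a S.:+ (e S.:+ e)) S.:= a S.:+ e S.:+ (a S.:+ e)) refl a e

  -- While `ω` stays below 2 this is the degree bound for the determinant. Otherwise some point is a
  -- common root of all entries; dividing it out of each keeps the leading coefficients and lowers
  -- the bound by 2, which is the most that the sum of `ω` can lose.
  det₂-multiplicity : ∀ a e {A B C α β γ} → Deg a A α → Deg (a + e) B β → Deg (a + (e + e)) C γ → det₂ α β γ ≢ 0ᶠ →
    (ω : K → ℕ) → (∀ x → ω x ≤ 2) → (∀ x → 1 ≤ ω x → det₂ (A x) (B x) (C x) ≡ 0ᶠ) →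
    (∀ x → 2 ≤ ω x → A x ≡ 0ᶠ × B x ≡ 0ᶠ × C x ≡ 0ᶠ) → ∑ ω ≤ 2 * (a + e)
  det₂-multiplicity a e {A} {B} {C} {α} {β} {γ} DA DB DC det≢0 ω ω≤2 det-root all-root with any? (λ x → 2 ≤? ω x)
  ... | no ¬∃ = ≤-trans
      (∑ω≤ (a + e + (a + e)) (Deg-det₂ a e DA DB DC) det≢0 1 ω (λ x → ≤-pred (≰⇒> λ 2≤ω → ¬∃ (x , 2≤ω))) det-root)
      (≤-reflexive (trans (*-identityˡ _) (cong (a + e +_) (sym (+-identityʳ (a + e))))))
  -- A constant `A` with a root is zero. The determinant is then minus the square of `B`, whose
  -- degree is `e`, and every root of `B` may carry weight 2.
  det₂-multiplicity zero e {A} {B} {C} {α} {β} {γ} (base DA) DB DC det≢0 ω ω≤2 det-root all-root | yes (x₀ , 2≤ω) =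
    ∑ω≤ e DB β≢0 2 ω ω≤2 (λ x 1≤ω → det₂-a≡0 (trans (DA x) α≡0) (det-root x 1≤ω))
    where
    α≡0 : α ≡ 0ᶠ
    α≡0 = trans (sym (DA x₀)) (proj₁ (all-root x₀ 2≤ω))
    β≢0 : β ≢ 0ᶠ
    β≢0 β≡0 = det≢0 (trans (cong₂ (λ u v → u *ᶠ γ -ᶠ v *ᶠ v) α≡0 β≡0)
      (solve 1 (λ c → con (pos 0) :* c :- con (pos 0) :* con (pos 0) := con (pos 0)) refl γ))
  det₂-multiplicity (suc a) e {A} {B} {C} {α} {β} {γ} DA DB DC det≢0 ω ω≤2 det-root all-root | yes (x₀ , 2≤ω)
    with all-root x₀ 2≤ω
  ... | A≡0 , B≡0 , C≡0 with Deg-divide a DA A≡0 | Deg-divide (a + e) DB B≡0 | Deg-divide (a + (e + e)) DC C≡0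
  ...   | A′ , DA′ , eA | B′ , DB′ , eB | C′ , DC′ , eC = begin
    ∑ ω                       ≤⟨ ∑-clear 2 x₀ ω ω≤2 ⟩
    2 + ∑ (clear x₀ ω)        ≤⟨ +-monoʳ-≤ 2 (det₂-multiplicity a e DA′ DB′ DC′ det≢0 (clear x₀ ω) (clear-≤ x₀ ω ω≤2) det-root′ all-root′) ⟩
    2 + 2 * (a + e)           ≡⟨ sym (*-suc 2 (a + e)) ⟩
    2 * (suc a + e)           ∎
    where
    open ≤-Reasoning
    det-root′ : ∀ x → 1 ≤ clear x₀ ω x → det₂ (A′ x) (B′ x) (C′ x) ≡ 0ᶠ
    det-root′ x p with clear-≥ x₀ ω x p
    ... | x≢x₀ , 1≤ω = quotient-root x≢x₀ (quotient-root x≢x₀ (trans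
      (solve 4 (λ t a b c → t :* (t :* (a :* c :- b :* b)) := (t :* a) :* (t :* c) :- (t :* b) :* (t :* b)) refl (x -ᶠ x₀) (A′ x) (B′ x) (C′ x))
      (trans (sym (cong₂ _-ᶠ_ (cong₂ _*ᶠ_ (eA x) (eC x)) (cong₂ _*ᶠ_ (eB x) (eB x)))) (det-root x 1≤ω))))
    all-root′ : ∀ x → 2 ≤ clear x₀ ω x → A′ x ≡ 0ᶠ × B′ x ≡ 0ᶠ × C′ x ≡ 0ᶠ
    all-root′ x p with clear-≥ x₀ ω x p
    ... | x≢x₀ , 2≤ω′ with all-root x 2≤ω′
    ...   | A0 , B0 , C0 = quotient-root x≢x₀ (trans (sym (eA x)) A0)
                         , quotient-root x≢x₀ (trans (sym (eB x)) B0)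
                         , quotient-root x≢x₀ (trans (sym (eC x)) C0)

  -- The Hankel determinant of order 3 of the moments 0, a, b, c, d.
  det₃ : K → K → K → K → K
  det₃ a b c d = a *ᶠ (b *ᶠ c) +ᶠ a *ᶠ (b *ᶠ c) -ᶠ (a *ᶠ a *ᶠ d +ᶠ b *ᶠ b *ᶠ b)

  det₃-cong : ∀ {a a′ b b′ c c′ d d′} → a ≡ a′ → b ≡ b′ → c ≡ c′ → d ≡ d′ → det₃ a b c d ≡ det₃ a′ b′ c′ d′
  det₃-cong refl refl refl refl = refl

  det₃-a≡0 : ∀ {a b c d} → a ≡ 0ᶠ → det₃ a b c d ≡ -ᶠ (b *ᶠ b *ᶠ b)
  det₃-a≡0 {b = b} {c} {d} refl = solve 3 (λ b c d → con (pos 0) :* (b :* c) :+ con (pos 0) :* (b :* c)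
    :- (con (pos 0) :* con (pos 0) :* d :+ b :* b :* b) := :- (b :* b :* b)) refl b c d

  cube-root : ∀ {x} → -ᶠ (x *ᶠ x *ᶠ x) ≡ 0ᶠ → x ≡ 0ᶠ
  cube-root {x} eq with x ≟ 0ᶠ
  ... | yes x≡0 = x≡0
  ... | no x≢0 = contradiction (trans (sym (-‿involutive _)) (trans (cong -ᶠ_ eq) -0#≈0#)) (*-nonzero (*-nonzero x≢0 x≢0) x≢0)

  Deg-det₃ : ∀ a {A B C D α β γ δ} → Deg a A α → Deg (1 + a) B β → Deg (2 + a) C γ → Deg (3 + a) D δ →
             Deg (3 * suc a) (λ x → det₃ (A x) (B x) (C x) (D x)) (det₃ α β γ δ)
  Deg-det₃ a {A} {B} {C} {D} {α} {β} {γ} {δ} DA DB DC DD = Deg-+ (3 * suc a) (Deg-+ (3 * suc a) ABC ABC) (Deg-neg (3 * suc a) (Deg-+ (3 * suc a) AAD BBB))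
    where
    ABC : Deg (3 * suc a) (λ x → A x *ᶠ (B x *ᶠ C x)) (α *ᶠ (β *ᶠ γ))
    ABC = subst (λ d → Deg d (λ x → A x *ᶠ (B x *ᶠ C x)) (α *ᶠ (β *ᶠ γ)))
      (S.solve 1 (λ a → a S.:+ (S.con 1 S.:+ a S.:+ (S.con 2 S.:+ a)) S.:= S.con 3 S.:* (S.con 1 S.:+ a)) refl a)
      (Deg-* a (1 + a + (2 + a)) DA (Deg-* (1 + a) (2 + a) DB DC))
    AAD : Deg (3 * suc a) (λ x → A x *ᶠ A x *ᶠ D x) (α *ᶠ α *ᶠ δ)
    AAD = subst (λ d → Deg d (λ x → A x *ᶠ A x *ᶠ D x) (α *ᶠ α *ᶠ δ))
      (S.solve 1 (λ a → a S.:+ a S.:+ (S.con 3 S.:+ a) S.:= S.con 3 S.:* (S.con 1 S.:+ a)) refl a)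
      (Deg-* (a + a) (3 + a) (Deg-* a a DA DA) DD)
    BBB : Deg (3 * suc a) (λ x → B x *ᶠ B x *ᶠ B x) (β *ᶠ β *ᶠ β)
    BBB = subst (λ d → Deg d (λ x → B x *ᶠ B x *ᶠ B x) (β *ᶠ β *ᶠ β))
      (S.solve 1 (λ a → S.con 1 S.:+ a S.:+ (S.con 1 S.:+ a) S.:+ (S.con 1 S.:+ a) S.:= S.con 3 S.:* (S.con 1 S.:+ a)) refl a)
      (Deg-* (1 + a + (1 + a)) (1 + a) (Deg-* (1 + a) (1 + a) DB DB) DB)

  det₃-homogeneous : ∀ t a b c d → t *ᶠ (t *ᶠ (t *ᶠ det₃ a b c d)) ≡ det₃ (t *ᶠ a) (t *ᶠ b) (t *ᶠ c) (t *ᶠ d)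
  det₃-homogeneous t a b c d = trans
    (solve 4 (λ t x y z → t :* (t :* (t :* (x :+ x :- (y :+ z))))
        := t :* (t :* (t :* x)) :+ t :* (t :* (t :* x)) :- (t :* (t :* (t :* y)) :+ t :* (t :* (t :* z))))
      refl t (a *ᶠ (b *ᶠ c)) (a *ᶠ a *ᶠ d) (b *ᶠ b *ᶠ b))
    (cong₂ (λ u v → u +ᶠ u -ᶠ v)
      (solve 4 (λ t a b c → t :* (t :* (t :* (a :* (b :* c)))) := (t :* a) :* ((t :* b) :* (t :* c))) refl t a b c)
      (cong₂ _+ᶠ_ (monomial a a d) (monomial b b b)))
    where
    monomial : ∀ a b c → t *ᶠ (t *ᶠ (t *ᶠ (a *ᶠ b *ᶠ c))) ≡ t *ᶠ a *ᶠ (t *ᶠ b) *ᶠ (t *ᶠ c)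
    monomial = solve 4 (λ t a b c → t :* (t :* (t :* (a :* b :* c))) := t :* a :* (t :* b) :* (t :* c)) refl t

  -- The descent of `det₂-multiplicity` with three rows: dividing out a common root lowers the
  -- degree of the determinant by 3, which pays for the largest possible `ω`.
  det₃-multiplicity : ∀ a {A B C D α β γ δ} → Deg a A α → Deg (1 + a) B β → Deg (2 + a) C γ → Deg (3 + a) D δ →
    det₃ α β γ δ ≢ 0ᶠ →
    (ω : K → ℕ) → (∀ x → ω x ≤ 3) → (∀ x → 1 ≤ ω x → det₃ (A x) (B x) (C x) (D x) ≡ 0ᶠ) →
    (∀ x → 2 ≤ ω x → A x ≡ 0ᶠ × B x ≡ 0ᶠ × C x ≡ 0ᶠ × D x ≡ 0ᶠ) → ∑ ω ≤ 3 * suc a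
  det₃-multiplicity a DA DB DC DD det≢0 ω ω≤3 det-root all-root with any? (λ x → 2 ≤? ω x)
  ... | no ¬∃ = ≤-trans
      (∑ω≤ (3 * suc a) (Deg-det₃ a DA DB DC DD) det≢0 1 ω (λ x → ≤-pred (≰⇒> λ 2≤ω → ¬∃ (x , 2≤ω))) det-root)
      (≤-reflexive (*-identityˡ _))
  -- Once `A` is zero the determinant is minus the cube of `B`, and `B` has degree 1.
  det₃-multiplicity zero {A} {B} {C} {D} {α} {β} {γ} {δ} (base DA) DB DC DD det≢0 ω ω≤3 det-root all-root | yes (x₀ , 2≤ω) =
    ∑ω≤ 1 DB β≢0 3 ω ω≤3 (λ x 1≤ω → cube-root (trans (sym (det₃-a≡0 (trans (DA x) α≡0))) (det-root x 1≤ω)))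
    where
    α≡0 : α ≡ 0ᶠ
    α≡0 = trans (sym (DA x₀)) (proj₁ (all-root x₀ 2≤ω))
    β≢0 : β ≢ 0ᶠ
    β≢0 β≡0 = det≢0 (trans (det₃-a≡0 α≡0) (trans (cong (λ b → -ᶠ (b *ᶠ b *ᶠ b)) β≡0) (trans (cong -ᶠ_ (zeroʳ _)) -0#≈0#)))
  det₃-multiplicity (suc a) {A} {B} {C} {D} DA DB DC DD det≢0 ω ω≤3 det-root all-root | yes (x₀ , 2≤ω)
    with all-root x₀ 2≤ω
  ... | A≡0 , B≡0 , C≡0 , D≡0 with Deg-divide a DA A≡0 | Deg-divide (1 + a) DB B≡0 | Deg-divide (2 + a) DC C≡0 | Deg-divide (3 + a) DD D≡0
  ...   | A′ , DA′ , eA | B′ , DB′ , eB | C′ , DC′ , eC | D′ , DD′ , eD = begin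
    ∑ ω                       ≤⟨ ∑-clear 3 x₀ ω ω≤3 ⟩
    3 + ∑ (clear x₀ ω)        ≤⟨ +-monoʳ-≤ 3 (det₃-multiplicity a DA′ DB′ DC′ DD′ det≢0 (clear x₀ ω) (clear-≤ x₀ ω ω≤3) det-root′ all-root′) ⟩
    3 + 3 * suc a             ≡⟨ sym (*-suc 3 (suc a)) ⟩
    3 * suc (suc a)           ∎
    where
    open ≤-Reasoning
    det-root′ : ∀ x → 1 ≤ clear x₀ ω x → det₃ (A′ x) (B′ x) (C′ x) (D′ x) ≡ 0ᶠ
    det-root′ x p with clear-≥ x₀ ω x p
    ... | x≢x₀ , 1≤ω = quotient-root x≢x₀ (quotient-root x≢x₀ (quotient-root x≢x₀ (trans
      (det₃-homogeneous (x -ᶠ x₀) (A′ x) (B′ x) (C′ x) (D′ x))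
      (trans (sym (det₃-cong (eA x) (eB x) (eC x) (eD x))) (det-root x 1≤ω)))))
    all-root′ : ∀ x → 2 ≤ clear x₀ ω x → A′ x ≡ 0ᶠ × B′ x ≡ 0ᶠ × C′ x ≡ 0ᶠ × D′ x ≡ 0ᶠ
    all-root′ x p with clear-≥ x₀ ω x p
    ... | x≢x₀ , 2≤ω′ with all-root x 2≤ω′
    ...   | A0 , B0 , C0 , D0 = quotient-root x≢x₀ (trans (sym (eA x)) A0)
                              , quotient-root x≢x₀ (trans (sym (eB x)) B0)
                              , quotient-root x≢x₀ (trans (sym (eC x)) C0)
                              , quotient-root x≢x₀ (trans (sym (eD x)) D0)

-- Codewords as functions on the vector space, and their moments along parallel lines.

module Codewords {q : ℕ} (F : FiniteField q) where
  open FieldTheory F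
  open FiniteFunctions F
  open PG F using (dot)
  open Solver using (solve; _:=_; _:+_; _:*_; :-_; _:-_; con)

  infixl 6 _⊕_
  infixr 7 _⊙_

  _⊕_ : ∀ {m} → Vec K m → Vec K m → Vec K m
  _⊕_ = zipWith _+ᶠ_

  _⊙_ : ∀ {m} → K → Vec K m → Vec K m
  s ⊙ v = map (s *ᶠ_) v

  𝟎 : ∀ {m} → Vec K m
  𝟎 = replicate _ 0ᶠ

  dot-⊕ʳ : ∀ {m} (a v w : Vec K m) → dot a (v ⊕ w) ≡ dot a v +ᶠ dot a w
  dot-⊕ʳ []      []      []      = sym (+ᶠ-identityʳ 0ᶠ)
  dot-⊕ʳ (a ∷ as) (v ∷ vs) (w ∷ ws) = trans (cong (a *ᶠ (v +ᶠ w) +ᶠ_) (dot-⊕ʳ as vs ws))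
    (solve 5 (λ a v w s t → a :* (v :+ w) :+ (s :+ t) := a :* v :+ s :+ (a :* w :+ t)) refl a v w (dot as vs) (dot as ws))

  dot-⊙ʳ : ∀ {m} (a : Vec K m) s v → dot a (s ⊙ v) ≡ s *ᶠ dot a v
  dot-⊙ʳ []       s []       = sym (zeroʳ s)
  dot-⊙ʳ (a ∷ as) s (v ∷ vs) = trans (cong (a *ᶠ (s *ᶠ v) +ᶠ_) (dot-⊙ʳ as s vs))
    (solve 4 (λ a s v t → a :* (s :* v) :+ s :* t := s :* (a :* v :+ t)) refl a s v (dot as vs))

  dot-comm : ∀ {m} (a v : Vec K m) → dot a v ≡ dot v a
  dot-comm []       []       = refl
  dot-comm (a ∷ as) (v ∷ vs) = cong₂ _+ᶠ_ (*ᶠ-comm a v) (dot-comm as vs)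

  dot-𝟎ʳ : ∀ {m} (a : Vec K m) → dot a 𝟎 ≡ 0ᶠ
  dot-𝟎ʳ []       = refl
  dot-𝟎ʳ (a ∷ as) = trans (cong₂ _+ᶠ_ (zeroʳ a) (dot-𝟎ʳ as)) (+ᶠ-identityˡ 0ᶠ)

  dot-⊕ˡ : ∀ {m} (a b v : Vec K m) → dot (a ⊕ b) v ≡ dot a v +ᶠ dot b v
  dot-⊕ˡ a b v = trans (dot-comm _ v) (trans (dot-⊕ʳ v a b) (cong₂ _+ᶠ_ (dot-comm v a) (dot-comm v b)))

  dot-⊙ˡ : ∀ {m} s (a v : Vec K m) → dot (s ⊙ a) v ≡ s *ᶠ dot a v
  dot-⊙ˡ s a v = trans (dot-comm _ v) (trans (dot-⊙ʳ v s a) (cong (s *ᶠ_) (dot-comm v a)))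

  dot-line : ∀ {m} (a v w : Vec K m) y → dot a (v ⊕ y ⊙ w) ≡ dot a v +ᶠ y *ᶠ dot a w
  dot-line a v w y = trans (dot-⊕ʳ a v (y ⊙ w)) (cong (dot a v +ᶠ_) (dot-⊙ʳ a y w))

  ind : K → K
  ind u with u ≟ 0ᶠ
  ... | yes _ = 1ᶠ
  ... | no _  = 0ᶠ

  ind-0 : ∀ {u} → u ≡ 0ᶠ → ind u ≡ 1ᶠ
  ind-0 {u} u≡0 with u ≟ 0ᶠ
  ... | yes _  = refl
  ... | no u≢0 = contradiction u≡0 u≢0

  ind-≢0 : ∀ {u} → u ≢ 0ᶠ → ind u ≡ 0ᶠ
  ind-≢0 {u} u≢0 with u ≟ 0ᶠ
  ... | yes u≡0 = contradiction u≡0 u≢0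
  ... | no _    = refl

  -- A codeword is given by hyperplanes with multiplicities; ev extends it from
  -- normalised points to all vectors, and takes the sum of the multiplicities at 𝟎.

  Code : ℕ → Set
  Code m = List (ℕ × Vec K m)

  ev : ∀ {m} → Code m → Vec K m → K
  ev []             v = 0ᶠ
  ev ((n , a) ∷ ls) v = fromℕ n *ᶠ ind (dot a v) +ᶠ ev ls v

  -- Vectors are compared through all linear forms, which turns vector identities into ring
  -- identities in `K`.
  ev-cong : ∀ {m} (ls : Code m) {v w} → (∀ a → dot a v ≡ dot a w) → ev ls v ≡ ev ls w
  ev-cong []             eq = refl
  ev-cong ((n , a) ∷ ls) eq = cong₂ (λ u e → fromℕ n *ᶠ ind u +ᶠ e) (eq a) (ev-cong ls eq)

  ind-scale : ∀ {s} → s ≢ 0ᶠ → ∀ u → ind (s *ᶠ u) ≡ ind u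
  ind-scale {s} s≢0 u with u ≟ 0ᶠ
  ... | yes u≡0 = ind-0 (trans (cong (s *ᶠ_) u≡0) (zeroʳ s))
  ... | no u≢0  = ind-≢0 (*-nonzero s≢0 u≢0)

  ev-scale : ∀ {m} (ls : Code m) {v w s} → s ≢ 0ᶠ → (∀ a → dot a v ≡ s *ᶠ dot a w) → ev ls v ≡ ev ls w
  ev-scale []             s≢0 eq = refl
  ev-scale ((n , a) ∷ ls) s≢0 eq =
    cong₂ (λ u e → fromℕ n *ᶠ u +ᶠ e) (trans (cong ind (eq a)) (ind-scale s≢0 _)) (ev-scale ls s≢0 eq)

  fromℕ-isz : ∀ u → fromℕ (isz u) ≡ ind u
  fromℕ-isz u with u ≟ 0ᶠ
  ... | yes _ = +ᶠ-identityʳ 1ᶠ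
  ... | no _  = refl

  -- A natural number representing the value of `ev`. It is needed because `σ` has to serve as a
  -- multiplicity in the code `residual`.
  evℕ : ∀ {m} → Code m → Vec K m → ℕ
  evℕ []             v = 0
  evℕ ((n , a) ∷ ls) v = n * isz (dot a v) + evℕ ls v

  fromℕ-evℕ : ∀ {m} (ls : Code m) v → fromℕ (evℕ ls v) ≡ ev ls v
  fromℕ-evℕ []             v = refl
  fromℕ-evℕ ((n , a) ∷ ls) v = trans (×-homo-+ 1ᶠ (n * isz (dot a v)) (evℕ ls v))
    (cong₂ _+ᶠ_ (trans (×1-homo-* n _) (cong (fromℕ n *ᶠ_) (fromℕ-isz (dot a v)))) (fromℕ-evℕ ls v))

  -- Columns are the lines through the point R, without R itself.

  col : ∀ {m} → Code m → Vec K m → Vec K m → K → K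
  col ls R v y = ev ls (v ⊕ y ⊙ R)

  mom : ∀ {m} → Code m → Vec K m → Vec K m → ℕ → K
  mom ls R v k = moment (col ls R v) k

  atom : ∀ {m} → Vec K m → Vec K m → Vec K m → K → K
  atom a R v y = ind (dot a (v ⊕ y ⊙ R))

  crossing : ∀ {m} → Vec K m → Vec K m → Vec K m → K
  crossing a R v = dot a v *ᶠ -ᶠ (dot a R ⁻¹)

  crossing-on : ∀ {m} (a R v : Vec K m) → dot a R ≢ 0ᶠ → dot a (v ⊕ crossing a R v ⊙ R) ≡ 0ᶠ
  crossing-on a R v aR≢0 = begin
    dot a (v ⊕ crossing a R v ⊙ R)                     ≡⟨ dot-line a v R _ ⟩
    dot a v +ᶠ dot a v *ᶠ -ᶠ (dot a R ⁻¹) *ᶠ dot a R   ≡⟨ solve 3 (λ u i r → u :+ u :* :- i :* r := u :- u :* (i :* r)) refl (dot a v) (dot a R ⁻¹) (dot a R) ⟩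
    dot a v -ᶠ dot a v *ᶠ (dot a R ⁻¹ *ᶠ dot a R)      ≡⟨ cong (λ z → dot a v -ᶠ dot a v *ᶠ z) (*-inverseˡ aR≢0) ⟩
    dot a v -ᶠ dot a v *ᶠ 1ᶠ                           ≡⟨ x-x≡0 (sym (*ᶠ-identityʳ _)) ⟩
    0ᶠ                                                 ∎
    where open ≡-Reasoning

  crossing-unique : ∀ {m} (a R v : Vec K m) → dot a R ≢ 0ᶠ → ∀ {y} → dot a (v ⊕ y ⊙ R) ≡ 0ᶠ → y ≡ crossing a R v
  crossing-unique a R v aR≢0 {y} on = x-y≡0⇒x≡y (*-cancel-0 aR≢0 (begin
    dot a R *ᶠ (y -ᶠ c)                                  ≡⟨ solve 4 (λ r y c u → r :* (y :- c) := u :+ y :* r :- (u :+ c :* r)) refl (dot a R) y c (dot a v) ⟩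
    dot a v +ᶠ y *ᶠ dot a R -ᶠ (dot a v +ᶠ c *ᶠ dot a R) ≡⟨ cong₂ _-ᶠ_ (sym (dot-line a v R y)) (sym (dot-line a v R c)) ⟩
    dot a (v ⊕ y ⊙ R) -ᶠ dot a (v ⊕ c ⊙ R)               ≡⟨ x-x≡0 (trans on (sym (crossing-on a R v aR≢0))) ⟩
    0ᶠ                                                   ∎))
    where
    open ≡-Reasoning
    c = crossing a R v

  atom-moment : ∀ {m} (a R v : Vec K m) → dot a R ≢ 0ᶠ → ∀ k → moment (atom a R v) k ≡ crossing a R v ^ᶠ k
  atom-moment a R v aR≢0 k =
    trans (moment-one (λ y y≢c → ind-≢0 λ on → y≢c (crossing-unique a R v aR≢0 on)) k)
          (trans (cong₂ _*ᶠ_ (ind-0 (crossing-on a R v aR≢0)) refl) (*ᶠ-identityˡ _))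

  atom-moment-0 : ∀ {m} (a R v : Vec K m) → dot a R ≡ 0ᶠ → ∀ k → suc k < q → moment (atom a R v) k ≡ 0ᶠ
  atom-moment-0 a R v aR≡0 k k<q = trans (∑ᶠ-cong λ y → cong (λ u → ind u *ᶠ _) (on y))
    (trans (∑ᶠ-* (ind (dot a v)) _) (trans (cong₂ _*ᶠ_ refl (∑ᶠ-power k k<q)) (zeroʳ _)))
    where
    on : ∀ y → dot a (v ⊕ y ⊙ R) ≡ dot a v
    on y = trans (dot-line a v R y) (trans (cong (λ r → dot a v +ᶠ y *ᶠ r) aR≡0) (trans (cong₂ _+ᶠ_ refl (zeroʳ y)) (+ᶠ-identityʳ _)))

  mom-∷ : ∀ {m} n a (ls : Code m) R v k → mom ((n , a) ∷ ls) R v k ≡ fromℕ n *ᶠ moment (atom a R v) k +ᶠ mom ls R v k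
  mom-∷ n a ls R v k = trans (∑ᶠ-cong λ y → solve 4 (λ c i e p → (c :* i :+ e) :* p := c :* (i :* p) :+ e :* p) refl
      (fromℕ n) (atom a R v y) (col ls R v y) (y ^ᶠ k))
    (trans (∑ᶠ-+ (λ y → fromℕ n *ᶠ (atom a R v y *ᶠ y ^ᶠ k)) (λ y → col ls R v y *ᶠ y ^ᶠ k)) (cong₂ _+ᶠ_ (∑ᶠ-* (fromℕ n) _) refl))

  Deg-0 : ∀ k → Deg k (λ _ → 0ᶠ) 0ᶠ
  Deg-0 zero    = base λ _ → refl
  Deg-0 (suc k) = Deg-const k 0ᶠ

  -- A hyperplane not containing R meets the column of v at a height linear in v;
  -- one containing R contributes a multiple of the power sum Σ yᵏ = 0.
  Deg-mom : ∀ {m} (ls : Code m) R z d k → suc k < q → Deg k (λ x → mom ls R (z ⊕ x ⊙ d) k) (mom ls R d k)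
  Deg-mom [] R z d k k<q = Deg-cong k (λ x → sym (moment-none {g = λ _ → 0ᶠ} (λ _ → refl) k))
                                      (sym (moment-none {g = λ _ → 0ᶠ} (λ _ → refl) k)) (Deg-0 k)
  Deg-mom ((n , a) ∷ ls) R z d k k<q = Deg-cong k (λ x → sym (mom-∷ n a ls R (z ⊕ x ⊙ d) k)) (sym (mom-∷ n a ls R d k))
    (Deg-+ k (Deg-scale k (fromℕ n) Deg-atom) (Deg-mom ls R z d k k<q))
    where
    Deg-atom : Deg k (λ x → moment (atom a R (z ⊕ x ⊙ d)) k) (moment (atom a R d) k)
    Deg-atom with dot a R ≟ 0ᶠ
    ... | yes aR≡0 = Deg-cong k (λ x → sym (atom-moment-0 a R (z ⊕ x ⊙ d) aR≡0 k k<q)) (sym (atom-moment-0 a R d aR≡0 k k<q)) (Deg-0 k)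
    ... | no aR≢0 = Deg-cong k
      (λ x → sym (trans (atom-moment a R (z ⊕ x ⊙ d) aR≢0 k) (cong (_^ᶠ k) (trans (cong (_*ᶠ i) (dot-line a z d x))
        (solve 4 (λ z x d i → (z :+ x :* d) :* i := z :* i :+ x :* (d :* i)) refl (dot a z) x (dot a d) i)))))
      (sym (atom-moment a R d aR≢0 k))
      (Deg-^ k (crossing a R z) (crossing a R d))
      where i = -ᶠ (dot a R ⁻¹)

  -- A line in direction `R` lies in a hyperplane through `R` or misses it, which contributes zero;
  -- any other hyperplane meets it once. What remains is the total multiplicity of the hyperplanes
  -- missing `R`.
  line-sum : ∀ {m} (ls : Code m) R v → 1 < q → mom ls R v 0 ≡ ev ls 𝟎 -ᶠ ev ls R
  line-sum [] R v 1<q = trans (moment-none {g = λ _ → 0ᶠ} (λ _ → refl) 0) (sym (-‿inverseʳ 0ᶠ))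
  line-sum ((n , a) ∷ ls) R v 1<q = trans (mom-∷ n a ls R v 0)
    (trans (cong₂ (λ u e → fromℕ n *ᶠ u +ᶠ e) atom-sum (line-sum ls R v 1<q))
      (solve 5 (λ c i j e f → c :* (i :- j) :+ (e :- f) := c :* i :+ e :- (c :* j :+ f)) refl
        (fromℕ n) (ind (dot a 𝟎)) (ind (dot a R)) (ev ls 𝟎) (ev ls R)))
    where
    atom-sum : moment (atom a R v) 0 ≡ ind (dot a 𝟎) -ᶠ ind (dot a R)
    atom-sum with dot a R ≟ 0ᶠ
    ... | yes aR≡0 = trans (atom-moment-0 a R v aR≡0 0 1<q) (sym (x-x≡0 (ind-0 (dot-𝟎ʳ a))))
    ... | no aR≢0  = trans (atom-moment a R v aR≢0 0) (sym (trans (cong (_-ᶠ 0ᶠ) (ind-0 (dot-𝟎ʳ a)))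
                       (trans (cong (1ᶠ +ᶠ_) -0#≈0#) (+ᶠ-identityʳ 1ᶠ))))

  -- Coordinates of the first moment as a linear form in the base point: hyperplanes through `R`
  -- drop out, the others contribute their `crossing`.
  linform : ∀ {m} → Code m → Vec K m → Vec K m
  linform []             R = 𝟎
  linform ((n , a) ∷ ls) R with dot a R ≟ 0ᶠ
  ... | yes _ = linform ls R
  ... | no _  = (fromℕ n *ᶠ -ᶠ (dot a R ⁻¹)) ⊙ a ⊕ linform ls R

  dot-linform : ∀ {m} (ls : Code m) R v → 2 < q → dot (linform ls R) v ≡ mom ls R v 1
  dot-linform [] R v 2<q = trans (dot-comm _ v) (trans (dot-𝟎ʳ v) (sym (moment-none {g = λ _ → 0ᶠ} (λ _ → refl) 1)))
  dot-linform ((n , a) ∷ ls) R v 2<q with dot a R ≟ 0ᶠ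
  ... | yes aR≡0 = trans (dot-linform ls R v 2<q) (sym (trans (mom-∷ n a ls R v 1)
    (trans (cong (λ u → fromℕ n *ᶠ u +ᶠ mom ls R v 1) (atom-moment-0 a R v aR≡0 1 2<q))
      (trans (cong₂ _+ᶠ_ (zeroʳ _) refl) (+ᶠ-identityˡ _)))))
  ... | no aR≢0 = trans (dot-⊕ˡ (c ⊙ a) (linform ls R) v) (trans (cong₂ _+ᶠ_ (dot-⊙ˡ c a v) (dot-linform ls R v 2<q))
    (sym (trans (mom-∷ n a ls R v 1) (cong (_+ᶠ mom ls R v 1)
      (trans (cong (fromℕ n *ᶠ_) (trans (atom-moment a R v aR≢0 1) (*ᶠ-identityʳ _)))
        (solve 3 (λ c u i → c :* (u :* i) := c :* i :* u) refl (fromℕ n) (dot a v) (-ᶠ (dot a R ⁻¹))))))))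
    where c = fromℕ n *ᶠ -ᶠ (dot a R ⁻¹)

  -- On the line `R ⊕ y ⊙ R` every hyperplane missing `R` is met at y = -1. Hence `R` lies off the
  -- hyperplane of `linform` as soon as `σ` is nonzero.
  dot-linform-R : ∀ {m} (ls : Code m) R → dot (linform ls R) R ≡ -ᶠ (ev ls 𝟎 -ᶠ ev ls R)
  dot-linform-R [] R = trans (dot-comm _ R) (trans (dot-𝟎ʳ R) (sym (trans (cong -ᶠ_ (-‿inverseʳ 0ᶠ)) -0#≈0#)))
  dot-linform-R ((n , a) ∷ ls) R with dot a R ≟ 0ᶠ
  ... | yes aR≡0 = trans (dot-linform-R ls R) (trans
      (solve 3 (λ c e f → :- (e :- f) := :- (c :+ e :- (c :+ f))) refl (fromℕ n *ᶠ 1ᶠ) (ev ls 𝟎) (ev ls R))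
      (cong (λ u → -ᶠ (fromℕ n *ᶠ u +ᶠ ev ls 𝟎 -ᶠ (fromℕ n *ᶠ 1ᶠ +ᶠ ev ls R))) (sym (ind-0 (dot-𝟎ʳ a)))))
  ... | no aR≢0 = trans (dot-⊕ˡ ((fromℕ n *ᶠ -ᶠ (dot a R ⁻¹)) ⊙ a) (linform ls R) R) (trans (cong₂ _+ᶠ_ (trans (dot-⊙ˡ (fromℕ n *ᶠ -ᶠ (dot a R ⁻¹)) a R) unit) (dot-linform-R ls R))
      (trans (solve 4 (λ c e f o → :- (c :* o) :+ :- (e :- f) := :- (c :* o :+ e :- (c :* con (pos 0) :+ f))) refl (fromℕ n) (ev ls 𝟎) (ev ls R) 1ᶠ)
        (cong (λ u → -ᶠ (fromℕ n *ᶠ u +ᶠ ev ls 𝟎 -ᶠ (fromℕ n *ᶠ 0ᶠ +ᶠ ev ls R))) (sym (ind-0 (dot-𝟎ʳ a))))))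
    where
    unit : fromℕ n *ᶠ -ᶠ (dot a R ⁻¹) *ᶠ dot a R ≡ -ᶠ (fromℕ n *ᶠ 1ᶠ)
    unit = trans (solve 3 (λ c i r → c :* :- i :* r := :- (c :* (i :* r))) refl (fromℕ n) (dot a R ⁻¹) (dot a R))
                 (cong (λ z → -ᶠ (fromℕ n *ᶠ z)) (*-inverseˡ aR≢0))

  height : ∀ {m} → Code m → Vec K m → Vec K m → ℕ
  height ls R v = supp (col ls R v)

  -- For nonzero s₀ this vanishes exactly when s₀, s₁, s₂ are the moments of a single point of mass
  -- s₀.
  disc : ∀ {m} → Code m → Vec K m → Vec K m → K
  disc ls R v = det₂ (mom ls R v 0) (mom ls R v 1) (mom ls R v 2)

  σ : ∀ {m} → Code m → Vec K m → K
  σ ls R = ev ls 𝟎 -ᶠ ev ls R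

  height≥1 : ∀ {m} (ls : Code m) R v → 1 < q → σ ls R ≢ 0ᶠ → 1 ≤ height ls R v
  height≥1 ls R v 1<q σ≢0 with nonzero? (col ls R v)
  ... | yes (y , ≢0) = supp≥1 (col ls R v) ≢0
  ... | no ¬∃ = contradiction (trans (sym (line-sum ls R v 1<q)) (moment-none (¬nonzero⇒0 ¬∃) 0)) σ≢0

  -- Subtracting the hyperplane s₁ = 0.

  module Residual (r : ℕ) (r≡-1 : fromℕ r ≡ -ᶠ 1ᶠ) (2<q : 2 < q) where

    1<q : 1 < q
    1<q = <-trans (s≤s (s≤s z≤n)) 2<q

    σℕ : ∀ {m} → Code m → Vec K m → ℕ
    σℕ ls R = evℕ ls 𝟎 + r * evℕ ls R

    fromℕ-r* : ∀ n → fromℕ (r * n) ≡ -ᶠ fromℕ n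
    fromℕ-r* n = trans (×1-homo-* r n) (trans (cong (_*ᶠ fromℕ n) r≡-1)
      (trans (sym (-‿distribˡ-* 1ᶠ _)) (cong -ᶠ_ (*ᶠ-identityˡ _))))

    fromℕ-σℕ : ∀ {m} (ls : Code m) R → fromℕ (σℕ ls R) ≡ σ ls R
    fromℕ-σℕ ls R = trans (×-homo-+ 1ᶠ (evℕ ls 𝟎) (r * evℕ ls R))
      (cong₂ _+ᶠ_ (fromℕ-evℕ ls 𝟎) (trans (fromℕ-r* _) (cong -ᶠ_ (fromℕ-evℕ ls R))))

    -- Multiplicities are natural numbers, so the subtraction is an addition with the factor `r`,
    -- which represents -1 in `K`.
    residual : ∀ {m} → Code m → Vec K m → Code m
    residual ls R = (r * σℕ ls R , linform ls R) ∷ ls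

    ev-residual : ∀ {m} (ls : Code m) R v → ev (residual ls R) v ≡ ev ls v -ᶠ σ ls R *ᶠ ind (dot (linform ls R) v)
    ev-residual ls R v = trans (cong (λ c → c *ᶠ ind (dot (linform ls R) v) +ᶠ ev ls v) (trans (fromℕ-r* _) (cong -ᶠ_ (fromℕ-σℕ ls R))))
      (solve 3 (λ s i e → :- s :* i :+ e := e :- s :* i) refl (σ ls R) (ind (dot (linform ls R) v)) (ev ls v))

    linform-R≢0 : ∀ {m} (ls : Code m) R → σ ls R ≢ 0ᶠ → dot (linform ls R) R ≢ 0ᶠ
    linform-R≢0 ls R σ≢0 eq = σ≢0 (trans (sym (-‿involutive _)) (trans (cong -ᶠ_ (trans (sym (dot-linform-R ls R)) eq)) -0#≈0#))

    -- By `σ*foot` this is s₁ divided by s₀, the centre of mass of the column.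
    foot : ∀ {m} → Code m → Vec K m → Vec K m → K
    foot ls R v = crossing (linform ls R) R v

    σ*foot : ∀ {m} (ls : Code m) R v → σ ls R ≢ 0ᶠ → σ ls R *ᶠ foot ls R v ≡ mom ls R v 1
    σ*foot ls R v σ≢0 = begin
      s *ᶠ (u *ᶠ -ᶠ (d ⁻¹))     ≡⟨ solve 3 (λ s u i → s :* (u :* :- i) := u :* (:- s :* i)) refl s u (d ⁻¹) ⟩
      u *ᶠ (-ᶠ s *ᶠ d ⁻¹)       ≡⟨ cong (λ z → u *ᶠ (z *ᶠ d ⁻¹)) (sym (dot-linform-R ls R)) ⟩
      u *ᶠ (d *ᶠ d ⁻¹)          ≡⟨ cong (u *ᶠ_) (*-inverseʳ (linform-R≢0 ls R σ≢0)) ⟩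
      u *ᶠ 1ᶠ                   ≡⟨ *ᶠ-identityʳ u ⟩
      u                         ≡⟨ dot-linform ls R v 2<q ⟩
      mom ls R v 1              ∎
      where
      open ≡-Reasoning
      s = σ ls R
      u = dot (linform ls R) v
      d = dot (linform ls R) R

    mom-residual : ∀ {m} (ls : Code m) R v → σ ls R ≢ 0ᶠ → ∀ k →
                   mom (residual ls R) R v k ≡ mom ls R v k -ᶠ σ ls R *ᶠ foot ls R v ^ᶠ k
    mom-residual ls R v σ≢0 k = trans (mom-∷ (r * σℕ ls R) (linform ls R) ls R v k)
      (trans (cong₂ (λ c p → c *ᶠ p +ᶠ mom ls R v k) (trans (fromℕ-r* _) (cong -ᶠ_ (fromℕ-σℕ ls R)))
                (atom-moment (linform ls R) R v (linform-R≢0 ls R σ≢0) k))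
        (solve 3 (λ s p e → :- s :* p :+ e := e :- s :* p) refl (σ ls R) (foot ls R v ^ᶠ k) (mom ls R v k)))

    mom-residual-vanishes : ∀ {m} (ls : Code m) R v → σ ls R ≢ 0ᶠ → ∀ k → k < 2 → mom (residual ls R) R v k ≡ 0ᶠ
    mom-residual-vanishes ls R v σ≢0 0 _ = trans (mom-residual ls R v σ≢0 0)
      (x-x≡0 (trans (line-sum ls R v 1<q) (sym (*ᶠ-identityʳ _))))
    mom-residual-vanishes ls R v σ≢0 1 _ = trans (mom-residual ls R v σ≢0 1)
      (x-x≡0 (sym (trans (cong (σ ls R *ᶠ_) (*ᶠ-identityʳ _)) (σ*foot ls R v σ≢0))))
    mom-residual-vanishes ls R v σ≢0 (suc (suc k)) (s≤s (s≤s ()))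

    -- Mass `σ` at `foot` has second moment s₁² / s₀, so `σ` times the second moment of the residual
    -- is `disc`.
    mom-residual-vanishes₃ : ∀ {m} (ls : Code m) R v → σ ls R ≢ 0ᶠ → disc ls R v ≡ 0ᶠ →
                             ∀ k → k < 3 → mom (residual ls R) R v k ≡ 0ᶠ
    mom-residual-vanishes₃ ls R v σ≢0 disc≡0 0 _ = mom-residual-vanishes ls R v σ≢0 0 (s≤s z≤n)
    mom-residual-vanishes₃ ls R v σ≢0 disc≡0 1 _ = mom-residual-vanishes ls R v σ≢0 1 (s≤s (s≤s z≤n))
    mom-residual-vanishes₃ ls R v σ≢0 disc≡0 2 _ = *-cancel-0 σ≢0 (begin
      s *ᶠ mom (residual ls R) R v 2                  ≡⟨ cong (s *ᶠ_) (mom-residual ls R v σ≢0 2) ⟩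
      s *ᶠ (m₂ -ᶠ s *ᶠ (f *ᶠ (f *ᶠ 1ᶠ)))              ≡⟨ cong (λ z → s *ᶠ (m₂ -ᶠ s *ᶠ (f *ᶠ z))) (*ᶠ-identityʳ f) ⟩
      s *ᶠ (m₂ -ᶠ s *ᶠ (f *ᶠ f))                      ≡⟨ solve 3 (λ s m f → s :* (m :- s :* (f :* f)) := s :* m :- (s :* f) :* (s :* f)) refl s m₂ f ⟩
      s *ᶠ m₂ -ᶠ (s *ᶠ f) *ᶠ (s *ᶠ f)                 ≡⟨ cong₂ (λ u w → u *ᶠ m₂ -ᶠ w *ᶠ w) (sym (line-sum ls R v 1<q)) (σ*foot ls R v σ≢0) ⟩
      disc ls R v                                     ≡⟨ disc≡0 ⟩
      0ᶠ                                              ∎)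
      where
      open ≡-Reasoning
      s = σ ls R
      f = foot ls R v
      m₂ = mom ls R v 2
    mom-residual-vanishes₃ ls R v σ≢0 disc≡0 (suc (suc (suc k))) (s≤s (s≤s (s≤s ())))

    -- The subtracted hyperplane misses `R`, hence meets each column only at `foot`.
    height-residual : ∀ {m} (ls : Code m) R v → σ ls R ≢ 0ᶠ → height (residual ls R) R v ≤ 1 + height ls R v
    height-residual ls R v σ≢0 = begin
      height (residual ls R) R v                                      ≤⟨ ∑-mono bound ⟩
      ∑ (λ y → 𝟙 (y ≟ foot ls R v) + nz (col ls R v y))               ≡⟨ ∑-+ (λ y → 𝟙 (y ≟ foot ls R v)) (λ y → nz (col ls R v y)) ⟩
      ∑ (λ y → 𝟙 (y ≟ foot ls R v)) + height ls R v                   ≡⟨ cong (_+ height ls R v) (∑-𝟙≡ (foot ls R v)) ⟩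
      1 + height ls R v                                               ∎
      where
      open ≤-Reasoning
      bound : ∀ y → nz (col (residual ls R) R v y) ≤ 𝟙 (y ≟ foot ls R v) + nz (col ls R v y)
      bound y with y ≟ foot ls R v
      ... | yes _ = ≤-trans (nz≤1 (col (residual ls R) R v y)) (s≤s z≤n)
      ... | no y≢foot = ≤-reflexive (cong nz (trans (ev-residual ls R _)
        (trans (cong (λ u → col ls R v y -ᶠ σ ls R *ᶠ u)
                 (ind-≢0 λ on → y≢foot (crossing-unique (linform ls R) R v (linform-R≢0 ls R σ≢0) on)))
          (trans (cong (λ u → col ls R v y -ᶠ u) (zeroʳ _)) (trans (cong₂ _+ᶠ_ refl -0#≈0#) (+ᶠ-identityʳ _))))))

-- Sums over all vectors and averaging over parallel planes.

module Counting {q : ℕ} (F : FiniteField q) where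
  open FieldTheory F
  open FiniteFunctions F
  open Codewords F

  ΣV : ∀ {m} → (Vec K m → ℕ) → ℕ
  ΣV {zero}  χ = χ []
  ΣV {suc m} χ = ∑ (λ x → ΣV (λ v → χ (x ∷ v)))

  ΣV-cong : ∀ {m} {χ ψ : Vec K m → ℕ} → (∀ v → χ v ≡ ψ v) → ΣV χ ≡ ΣV ψ
  ΣV-cong {zero}  eq = eq []
  ΣV-cong {suc m} eq = ∑-cong λ x → ΣV-cong λ v → eq (x ∷ v)

  ΣV-mono : ∀ {m} {χ ψ : Vec K m → ℕ} → (∀ v → χ v ≤ ψ v) → ΣV χ ≤ ΣV ψ
  ΣV-mono {zero}  le = le []
  ΣV-mono {suc m} le = ∑-mono λ x → ΣV-mono λ v → le (x ∷ v)

  ΣV-+ : ∀ {m} (χ ψ : Vec K m → ℕ) → ΣV (λ v → χ v + ψ v) ≡ ΣV χ + ΣV ψ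
  ΣV-+ {zero}  χ ψ = refl
  ΣV-+ {suc m} χ ψ = trans (∑-cong λ x → ΣV-+ (λ v → χ (x ∷ v)) (λ v → ψ (x ∷ v)))
                           (∑-+ (λ x → ΣV (λ v → χ (x ∷ v))) (λ x → ΣV (λ v → ψ (x ∷ v))))

  ΣV-* : ∀ {m} c (χ : Vec K m → ℕ) → ΣV (λ v → c * χ v) ≡ c * ΣV χ
  ΣV-* {zero}  c χ = refl
  ΣV-* {suc m} c χ = trans (∑-cong λ x → ΣV-* c (λ v → χ (x ∷ v))) (∑-* c (λ x → ΣV (λ v → χ (x ∷ v))))

  ΣV-const : ∀ m c → ΣV {m} (λ _ → c) ≡ q ^ m * c
  ΣV-const zero    c = sym (*-identityˡ c)
  ΣV-const (suc m) c = trans (∑-cong {f = λ _ → ΣV {m} (λ _ → c)} λ x → ΣV-const m c)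
                             (trans (∑-const q (q ^ m * c)) (sym (*-assoc q (q ^ m) c)))

  ∑-ΣV : ∀ {m} (χ : K → Vec K m → ℕ) → ∑ (λ x → ΣV (χ x)) ≡ ΣV (λ v → ∑ (λ x → χ x v))
  ∑-ΣV {zero}  χ = refl
  ∑-ΣV {suc m} χ = trans (ℕ∑.∑-comm (λ x y → ΣV (λ v → χ x (y ∷ v)))) (∑-cong λ y → ∑-ΣV (λ x v → χ x (y ∷ v)))

  ΣV-translate : ∀ {m} (χ : Vec K m → ℕ) w → ΣV (λ v → χ (v ⊕ w)) ≡ ΣV χ
  ΣV-translate {zero}  χ []      = refl
  ΣV-translate {suc m} χ (t ∷ w) = trans (∑-cong λ x → ΣV-translate (λ v → χ ((x +ᶠ t) ∷ v)) w)
                                         (∑-translate (λ x → ΣV (λ v → χ (x ∷ v))) t)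

  ΣV-scale : ∀ {m} (χ : Vec K m → ℕ) {s} → s ≢ 0ᶠ → ΣV (λ v → χ (s ⊙ v)) ≡ ΣV χ
  ΣV-scale {zero}  χ s≢0 = refl
  ΣV-scale {suc m} χ {s} s≢0 = trans (∑-cong λ x → ΣV-scale (λ v → χ ((s *ᶠ x) ∷ v)) s≢0)
                                     (∑-scale (λ x → ΣV (λ v → χ (x ∷ v))) s≢0)

  anyV? : ∀ {m} {P : Vec K m → Set} → (∀ v → Dec (P v)) → Dec (∃ P)
  anyV? {zero} P? with P? []
  ... | yes p = yes ([] , p)
  ... | no ¬p = no λ { ([] , p) → ¬p p }
  anyV? {suc m} P? with any? (λ x → anyV? (λ v → P? (x ∷ v)))
  ... | yes (x , v , p) = yes (x ∷ v , p)
  ... | no ¬∃ = no λ { (x ∷ v , p) → ¬∃ (x , v , p) }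

  column : ∀ {m} → (Vec K m → ℕ) → Vec K m → Vec K m → ℕ
  column χ R v = ∑ (λ y → χ (v ⊕ y ⊙ R))

  plane : ∀ {m} → (Vec K m → ℕ) → Vec K m → Vec K m → Vec K m → ℕ
  plane χ d R z = ∑ (λ x → column χ R (z ⊕ x ⊙ d))

  ΣV-column : ∀ {m} (χ : Vec K m → ℕ) R → ΣV (column χ R) ≡ q * ΣV χ
  ΣV-column χ R = begin
    ΣV (column χ R)                        ≡⟨ sym (∑-ΣV (λ y v → χ (v ⊕ y ⊙ R))) ⟩
    ∑ (λ y → ΣV (λ v → χ (v ⊕ y ⊙ R)))     ≡⟨ ∑-cong (λ y → ΣV-translate χ (y ⊙ R)) ⟩
    ∑ {q} (λ _ → ΣV χ)                     ≡⟨ ∑-const q (ΣV χ) ⟩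
    q * ΣV χ                               ∎
    where open ≡-Reasoning

  ΣV-plane : ∀ {m} (χ : Vec K m → ℕ) d R → ΣV (plane χ d R) ≡ q * (q * ΣV χ)
  ΣV-plane χ d R = trans (ΣV-column (column χ R) d) (cong (q *_) (ΣV-column χ R))

  -- The base point `z` runs over all vectors, so planes are repeated and every vector is counted
  -- exactly `q * q` times. This is true even for dependent `d` and `R`, so no independence has to
  -- be tracked.
  sparse-plane : ∀ {m} (χ : Vec K m → ℕ) d R M → q * (q * ΣV χ) < q ^ m * suc M → ∃ λ z → plane χ d R z ≤ M
  sparse-plane {m} χ d R M sparse with anyV? (λ z → plane χ d R z ≤? M)
  ... | yes found = found
  ... | no ¬∃ = contradiction sparse (≤⇒≯ (begin
    q ^ m * suc M                  ≡⟨ sym (ΣV-const m (suc M)) ⟩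
    ΣV {m} (λ _ → suc M)           ≤⟨ ΣV-mono (λ z → ≰⇒> λ le → ¬∃ (z , le)) ⟩
    ΣV (plane χ d R)               ≡⟨ ΣV-plane χ d R ⟩
    q * (q * ΣV χ)                 ∎))
    where open ≤-Reasoning

  nonzeros : ∀ {m} → Code m → ℕ
  nonzeros ls = ΣV (λ v → nz (ev ls v))

-- Words of small weight that are multiples of one hyperplane.

module OneHyperplane {q : ℕ} (F : FiniteField q) where
  open FieldTheory F
  open FiniteFunctions F
  open Codewords F
  open Counting F
  open PG F using (dot)
  open Solver using (solve; _:=_; _:+_; _:*_; :-_; _:-_; _:^_; con)

  col-0 : ∀ {m} (ls : Code m) R v → col ls R v 0ᶠ ≡ ev ls v
  col-0 ls R v = ev-cong ls λ a → trans (dot-line a v R 0ᶠ) (trans (cong₂ _+ᶠ_ refl (zeroˡ _)) (+ᶠ-identityʳ _))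

  deviating? : ∀ {m} (ls : Code m) → Dec (∃ λ R → ev ls R ≢ ev ls 𝟎)
  deviating? ls = anyV? (λ R → ¬? (ev ls R ≟ ev ls 𝟎))

  deviating⇒σ≢0 : ∀ {m} (ls : Code m) {R} → ev ls R ≢ ev ls 𝟎 → σ ls R ≢ 0ᶠ
  deviating⇒σ≢0 ls dev eq = dev (sym (x-y≡0⇒x≡y eq))

  constant⇒0 : ∀ {m} (ls : Code m) → nonzeros ls < q ^ m → ¬ (∃ λ R → ev ls R ≢ ev ls 𝟎) → ∀ v → ev ls v ≡ 0ᶠ
  constant⇒0 {m} ls few ¬dev with ev ls 𝟎 ≟ 0ᶠ
  ... | yes κ≡0 = λ v → trans (const v) κ≡0
    where
    const : ∀ v → ev ls v ≡ ev ls 𝟎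
    const v with ev ls v ≟ ev ls 𝟎
    ... | yes eq = eq
    ... | no neq = contradiction (v , neq) ¬dev
  ... | no κ≢0 = contradiction few (≤⇒≯ (begin
    q ^ m                            ≡⟨ sym (*-identityʳ _) ⟩
    q ^ m * 1                        ≡⟨ sym (ΣV-const m 1) ⟩
    ΣV {m} (λ _ → 1)                 ≤⟨ ΣV-mono (λ v → ≤-reflexive (sym (nz-≢0 (nonzero v)))) ⟩
    nonzeros ls                      ∎))
    where
    open ≤-Reasoning
    nonzero : ∀ v → ev ls v ≢ 0ᶠ
    nonzero v with ev ls v ≟ ev ls 𝟎
    ... | yes eq = λ ev≡0 → κ≢0 (trans (sym eq) ev≡0)
    ... | no neq = contradiction (v , neq) ¬dev

  ∑height : ∀ {m} (ls : Code m) R → ΣV (height ls R) ≡ q * nonzeros ls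
  ∑height ls R = ΣV-column (λ v → nz (ev ls v)) R

  -- If `σ` is nonzero at `R`, each of the `q ^ n` lines in direction `R` has a nonzero sum and so
  -- meets the support.
  minimum-weight : ∀ {n} (ls : Code (suc n)) → 1 < q → nonzeros ls < q ^ n → ∀ v → ev ls v ≡ 0ᶠ
  minimum-weight {n} ls 1<q few with deviating? ls
  ... | no ¬dev = constant⇒0 ls (<-≤-trans few (m≤n*m (q ^ n) q {{>-nonZero (<-trans (s≤s z≤n) 1<q)}})) ¬dev
  ... | yes (R , dev) = contradiction few (≤⇒≯ (*-cancelˡ-≤ q {{>-nonZero (<-trans (s≤s z≤n) 1<q)}} (begin
    q * q ^ n                        ≡⟨ sym (*-identityʳ _) ⟩
    q ^ suc n * 1                    ≡⟨ sym (ΣV-const (suc n) 1) ⟩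
    ΣV {suc n} (λ _ → 1)             ≤⟨ ΣV-mono (λ v → height≥1 ls R v 1<q (deviating⇒σ≢0 ls dev)) ⟩
    ΣV (height ls R)                 ≡⟨ ∑height ls R ⟩
    q * nonzeros ls                  ∎)))
    where open ≤-Reasoning

  Nonzero : ∀ {m} → Vec K m → Set
  Nonzero a = ∃ λ v → dot a v ≢ 0ᶠ

  -- Coefficients may vanish and the two forms may be proportional, so these mean at most one and at
  -- most two hyperplanes.
  Hyp₁ Hyp₂ : ∀ {m} → Code m → Set
  Hyp₁ ls = ∃ λ s → ∃ λ a → Nonzero a × (∀ v → ev ls v ≡ fromℕ s *ᶠ ind (dot a v))
  Hyp₂ ls = ∃ λ s → ∃ λ a → ∃ λ t → ∃ λ b → Nonzero a × Nonzero b ×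
            (∀ v → ev ls v ≡ fromℕ s *ᶠ ind (dot a v) +ᶠ fromℕ t *ᶠ ind (dot b v))

  nonzero-form : ∀ {n} → ∃ λ (a : Vec K (suc n)) → Nonzero a
  nonzero-form {n} = 1ᶠ ∷ 𝟎 , 1ᶠ ∷ 𝟎 , λ eq → 0≢1 (trans (sym eq)
    (trans (cong₂ _+ᶠ_ (*ᶠ-identityˡ 1ᶠ) (dot-𝟎ʳ {n} 𝟎)) (+ᶠ-identityʳ 1ᶠ)))

  zero⇒Hyp₁ : ∀ {n} (ls : Code (suc n)) → (∀ v → ev ls v ≡ 0ᶠ) → Hyp₁ ls
  zero⇒Hyp₁ ls ev≡0 = 0 , proj₁ nonzero-form , proj₂ nonzero-form , λ v → trans (ev≡0 v) (sym (zeroˡ _))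

  Hyp₁⇒Hyp₂ : ∀ {n} (ls : Code (suc n)) → Hyp₁ ls → Hyp₂ ls
  Hyp₁⇒Hyp₂ ls (s , a , a≢0 , eq) = s , a , 0 , proj₁ nonzero-form , a≢0 , proj₂ nonzero-form ,
    λ v → trans (eq v) (sym (trans (cong₂ _+ᶠ_ refl (zeroˡ _)) (+ᶠ-identityʳ _)))

  Bad : ∀ {m} → Code m → Vec K m → Vec K m → Set
  Bad g R v = ∃ λ y → col g R v y ≢ 0ᶠ

  bad? : ∀ {m} (g : Code m) R v → Dec (Bad g R v)
  bad? g R v = nonzero? (col g R v)

  #bad : ∀ {m} → Code m → Vec K m → Vec K m → Vec K m → ℕ
  #bad g R z d = ∑ (λ x → 𝟙 (bad? g R (z ⊕ x ⊙ d)))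

  -- Along the plane the moment is a polynomial of degree `k` with this leading coefficient, and it
  -- vanishes on every column free of `g`; there are more than `k` of those.
  few-bad⇒mom≡0 : ∀ {m} (g : Code m) R z d k → suc k < q → k + #bad g R z d < q → mom g R d k ≡ 0ᶠ
  few-bad⇒mom≡0 g R z d k k<q few with mom g R d k ≟ 0ᶠ
  ... | yes eq = eq
  ... | no neq = contradiction few (≤⇒≯ (begin
    q                                                    ≡⟨ sym (trans (∑-const q 1) (*-identityʳ q)) ⟩
    ∑ {q} (λ _ → 1)                                      ≤⟨ ∑-mono bound ⟩
    ∑ (λ x → isz (M x) + 𝟙 (bad? g R (z ⊕ x ⊙ d)))       ≡⟨ ∑-+ (λ x → isz (M x)) (λ x → 𝟙 (bad? g R (z ⊕ x ⊙ d))) ⟩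
    ∑ (λ x → isz (M x)) + #bad g R z d                   ≤⟨ +-monoˡ-≤ (#bad g R z d) (roots≤degree k (Deg-mom g R z d k k<q) neq) ⟩
    k + #bad g R z d                                     ∎))
    where
    open ≤-Reasoning
    M : K → K
    M x = mom g R (z ⊕ x ⊙ d) k
    bound : ∀ x → 1 ≤ isz (M x) + 𝟙 (bad? g R (z ⊕ x ⊙ d))
    bound x with bad? g R (z ⊕ x ⊙ d)
    ... | yes _  = m≤n+m 1 _
    ... | no ¬∃ = ≤-trans (≤-reflexive (sym (isz-0 (moment-none (¬nonzero⇒0 ¬∃) k)))) (m≤m+n _ 0)

  -- The plane only supplies roots: the height gained is that of the column over its direction `d`,
  -- which need not lie in the plane. Its moments below order `τ` are leading coefficients.
  few-bad⇒tall : ∀ {m} (g : Code m) R z d τ → τ < q → #bad g R z d + τ ≤ q → Bad g R d → τ < height g R d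
  few-bad⇒tall g R z d τ τ<q few (y , ≢0) = moments⇒supp τ (col g R d) (λ k k<τ →
    few-bad⇒mom≡0 g R z d k (<-≤-trans (s≤s k<τ) τ<q)
      (<-≤-trans (+-monoˡ-< (#bad g R z d) k<τ) (≤-trans (≤-reflexive (+-comm τ _)) few))) ≢0

  -- If every bad column has height ≥ e + u, sparse planes contain few bad columns,
  -- which forces more moments of a bad column to vanish, hence greater height.
  growth : ∀ {m} (g : Code m) R e B u₀ τ₁ → τ₁ ≤ q →
    (∀ d → Bad g R d → e + u₀ ≤ height g R d) →
    (∀ d → Bad g R d → ∃ λ z → ∀ u → (∀ d′ → Bad g R d′ → e + u ≤ height g R d′) → #bad g R z d * u < B) →
    (∀ u → u₀ ≤ u → e + u < τ₁ → B ≤ (suc q ∸ (e + u)) * u) →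
    ∀ d → Bad g R d → τ₁ ≤ height g R d
  growth g R e B u₀ τ₁ τ₁≤q start sparse bound d bad = climb (τ₁ ∸ (e + u₀)) u₀ ≤-refl start (m≤n+m∸n τ₁ (e + u₀)) d bad
    where
    -- `k` bounds the remaining steps. All bad columns must rise together, because the estimate for
    -- a plane weighs every bad column in it by the common height.
    climb : ∀ k u → u₀ ≤ u → (∀ d → Bad g R d → e + u ≤ height g R d) → τ₁ ≤ e + u + k →
            ∀ d → Bad g R d → τ₁ ≤ height g R d
    climb zero    u u₀≤u tall le d bad = ≤-trans (≤-trans le (≤-reflexive (+-identityʳ _))) (tall d bad)
    climb (suc k) u u₀≤u tall le with suc (e + u) ≤? τ₁
    ... | no e+u≮τ₁ = λ d bad → ≤-trans (≤-pred (≰⇒> e+u≮τ₁)) (tall d bad)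
    ... | yes e+u<τ₁ = climb k (suc u) (m≤n⇒m≤1+n u₀≤u) taller
        (≤-trans le (≤-reflexive (trans (+-suc (e + u) k) (cong (_+ k) (sym (+-suc e u))))))
      where
      taller : ∀ d → Bad g R d → e + suc u ≤ height g R d
      taller d bad with sparse d bad
      ... | z , few = ≤-trans (≤-reflexive (+-suc e u)) (few-bad⇒tall g R z d (e + u) (<-≤-trans e+u<τ₁ τ₁≤q) few′ bad)
        where
        j = #bad g R z d
        -- The `suc` appears because `few-bad⇒tall` still applies when `j + (e + u)` equals `q`.
        j< : j < suc q ∸ (e + u)
        j< = *-cancelʳ-< u j (suc q ∸ (e + u)) (<-≤-trans (few u tall) (bound u u₀≤u e+u<τ₁))
        few′ : j + (e + u) ≤ q
        few′ = ≤-pred (≤-trans (+-monoˡ-≤ (e + u) j<) (≤-reflexive (m∸n+n≡m (m≤n⇒m≤1+n (≤-trans (<⇒≤ e+u<τ₁) τ₁≤q)))))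

  #bad-weighted : ∀ {m} (g : Code m) R z d u (h : Vec K m → ℕ) e →
    (∀ v → e ≤ h v) → (∀ v → Bad g R v → e + u ≤ h v) → q * e + #bad g R z d * u ≤ ∑ (λ x → h (z ⊕ x ⊙ d))
  #bad-weighted g R z d u h e all bad = begin
    q * e + #bad g R z d * u                                       ≡⟨ cong₂ _+_ (sym (∑-const q e)) (trans (*-comm (#bad g R z d) u) (sym (∑-* u (λ x → 𝟙 (bad? g R (z ⊕ x ⊙ d)))))) ⟩
    ∑ {q} (λ _ → e) + ∑ (λ x → u * 𝟙 (bad? g R (z ⊕ x ⊙ d)))       ≡⟨ sym (∑-+ {q} (λ _ → e) (λ x → u * 𝟙 (bad? g R (z ⊕ x ⊙ d)))) ⟩
    ∑ (λ x → e + u * 𝟙 (bad? g R (z ⊕ x ⊙ d)))                     ≤⟨ ∑-mono bound ⟩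
    ∑ (λ x → h (z ⊕ x ⊙ d))                                        ∎
    where
    open ≤-Reasoning
    bound : ∀ x → e + u * 𝟙 (bad? g R (z ⊕ x ⊙ d)) ≤ h (z ⊕ x ⊙ d)
    bound x with bad? g R (z ⊕ x ⊙ d)
    ... | yes b = ≤-trans (≤-reflexive (cong (e +_) (*-identityʳ u))) (bad (z ⊕ x ⊙ d) b)
    ... | no _  = ≤-trans (≤-reflexive (trans (cong (e +_) (*-zeroʳ u)) (+-identityʳ e))) (all (z ⊕ x ⊙ d))

  planes : ∀ {m} → Code m → Vec K m → Vec K m → Vec K m → ℕ
  planes ls d R z = plane (λ v → nz (ev ls v)) d R z

  -- From the residual back to the word, using two moments only.

  module Reduction (r : ℕ) (r≡-1 : fromℕ r ≡ -ᶠ 1ᶠ) (2<q : 2 < q) where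
    open Residual r r≡-1 2<q

    residual-0⇒Hyp₁ : ∀ {m} (ls : Code m) {R} → ev ls R ≢ ev ls 𝟎 → (∀ v → ev (residual ls R) v ≡ 0ᶠ) → Hyp₁ ls
    residual-0⇒Hyp₁ ls {R} dev g≡0 = σℕ ls R , linform ls R , (R , linform-R≢0 ls R (deviating⇒σ≢0 ls dev)) ,
      λ v → trans (x-y≡0⇒x≡y (trans (sym (ev-residual ls R v)) (g≡0 v))) (cong (_*ᶠ ind (dot (linform ls R) v)) (sym (fromℕ-σℕ ls R)))

    residual-Hyp₁⇒Hyp₂ : ∀ {m} (ls : Code m) {R} → ev ls R ≢ ev ls 𝟎 → Hyp₁ (residual ls R) → Hyp₂ ls
    residual-Hyp₁⇒Hyp₂ ls {R} dev (t , b , b≢0 , eq) =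
      σℕ ls R , linform ls R , t , b , (R , linform-R≢0 ls R (deviating⇒σ≢0 ls dev)) , b≢0 , λ v → begin
        ev ls v                                                   ≡⟨ solve 2 (λ e u → e := u :+ (e :- u)) refl (ev ls v) (σ ls R *ᶠ ind (dot (linform ls R) v)) ⟩
        σ ls R *ᶠ ind (dot (linform ls R) v) +ᶠ (ev ls v -ᶠ σ ls R *ᶠ ind (dot (linform ls R) v))
                                                                  ≡⟨ cong₂ _+ᶠ_ (cong (_*ᶠ ind (dot (linform ls R) v)) (sym (fromℕ-σℕ ls R))) (trans (sym (ev-residual ls R v)) (eq v)) ⟩
        fromℕ (σℕ ls R) *ᶠ ind (dot (linform ls R) v) +ᶠ fromℕ t *ᶠ ind (dot b v) ∎
      where open ≡-Reasoning

    -- Moments of order 0 and 1 of the residual always vanish, so its nonempty columns have at least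
    -- three points and those of `ls` at least two. The total count then puts the residual below the
    -- minimum weight.
    one-hyperplane₃ : ∀ {k} (ls : Code (2 + k)) → nonzeros ls < q ^ suc k + q ^ k → Hyp₁ ls
    one-hyperplane₃ {k} ls few with deviating? ls
    ... | no ¬dev = zero⇒Hyp₁ ls (constant⇒0 ls (<-≤-trans few (begin
        q ^ suc k + q ^ k               ≤⟨ +-monoʳ-≤ (q ^ suc k) (m≤n*m (q ^ k) q {{>-nonZero (<-trans (s≤s z≤n) 2<q)}}) ⟩
        q ^ suc k + q ^ suc k           ≡⟨ cong (q ^ suc k +_) (sym (+-identityʳ _)) ⟩
        2 * q ^ suc k                   ≤⟨ *-monoˡ-≤ (q ^ suc k) (<⇒≤ 2<q) ⟩
        q * q ^ suc k                   ∎)) ¬dev)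
      where open ≤-Reasoning
    ... | yes (R , dev) = residual-0⇒Hyp₁ ls dev (minimum-weight g 1<q (+-cancelˡ-< (q ^ (2 + k)) _ _ (begin-strict
        q ^ (2 + k) + nonzeros g                                 ≡⟨ cong (_+ nonzeros g) (sym (trans (ΣV-const (2 + k) 1) (*-identityʳ _))) ⟩
        ΣV {2 + k} (λ _ → 1) + nonzeros g                        ≡⟨ sym (ΣV-+ {2 + k} (λ _ → 1) (λ v → nz (ev g v))) ⟩
        ΣV (λ v → 1 + nz (ev g v))                               ≤⟨ ΣV-mono bound ⟩
        ΣV (height ls R)                                         ≡⟨ ∑height ls R ⟩
        q * nonzeros ls                                          <⟨ *-monoʳ-< q {{>-nonZero (<-trans (s≤s z≤n) 2<q)}} few ⟩
        q * (q ^ suc k + q ^ k)                                  ≡⟨ *-distribˡ-+ q (q ^ suc k) (q ^ k) ⟩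
        q ^ (2 + k) + q ^ suc k                                  ∎)))
      where
      open ≤-Reasoning
      g = residual ls R
      σ≢0 = deviating⇒σ≢0 ls dev
      bound : ∀ v → 1 + nz (ev g v) ≤ height ls R v
      bound v with ev g v ≟ 0ᶠ
      ... | yes _ = height≥1 ls R v 1<q σ≢0
      ... | no ≢0 = ≤-pred (≤-trans
        (moments⇒supp 2 (col g R v) (mom-residual-vanishes ls R v σ≢0) {0ᶠ} (λ eq → ≢0 (trans (sym (col-0 g R v)) eq)))
        (height-residual ls R v σ≢0))

  -- Residuals that are constant on lines, and the 2 × 2 determinant.

  module Cones (r : ℕ) (r≡-1 : fromℕ r ≡ -ᶠ 1ᶠ) (4≤q : 4 ≤ q) where
    2<q : 2 < q
    2<q = ≤-trans (n≤1+n 3) 4≤q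

    open Residual r r≡-1 2<q
    open Reduction r r≡-1 2<q

    -- Every column meets the support of `ls`, so a plane with at most `3 * q ∸ 7` points has at
    -- most `2 * q ∸ 7` to spare for its bad columns. This drives `growth` up to height `q`; then at
    -- most one column of the plane is bad, and all moments up to order `q ∸ 2` vanish.
    cone : ∀ {m} (ls : Code m) R → σ ls R ≢ 0ᶠ → (∀ d → disc ls R d ≡ 0ᶠ) →
      (∀ d → 3 ≤ height ls R d → ∃ λ z → 7 + planes ls d R z ≤ 3 * q) →
      ∀ v x y → col (residual ls R) R v x ≡ col (residual ls R) R v y
    cone {m} ls R σ≢0 disc≡0 sparse v x y with bad? (residual ls R) R v
    ... | no ¬∃ = trans (¬nonzero⇒0 ¬∃ x) (sym (¬nonzero⇒0 ¬∃ y))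
    ... | yes bad = moments⇒constant (col g R v) vanish x y
      where
      g = residual ls R

      start : ∀ d → Bad g R d → 4 ≤ height g R d
      start d (y , ≢0) = moments⇒supp 3 (col g R d) (mom-residual-vanishes₃ ls R d σ≢0 (disc≡0 d)) ≢0

      sparse′ : ∀ d → Bad g R d → ∃ λ z → ∀ u → (∀ d′ → Bad g R d′ → 2 + u ≤ height g R d′) → 7 + #bad g R z d * u ≤ 2 * q
      sparse′ d bad with sparse d (≤-pred (≤-trans (start d bad) (height-residual ls R d σ≢0)))
      ... | z , light = z , λ u tall → +-cancelˡ-≤ q _ _ (begin
        q + (7 + #bad g R z d * u)       ≡⟨ S.solve 2 (λ q b → q S.:+ (S.con 7 S.:+ b) S.:= S.con 7 S.:+ (q S.:* S.con 1 S.:+ b)) refl q (#bad g R z d * u) ⟩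
        7 + (q * 1 + #bad g R z d * u)   ≤⟨ +-monoʳ-≤ 7 (#bad-weighted g R z d u (height ls R) 1 (λ v → height≥1 ls R v 1<q σ≢0)
                                              (λ v b → ≤-pred (≤-trans (tall v b) (height-residual ls R v σ≢0)))) ⟩
        7 + planes ls d R z              ≤⟨ light ⟩
        3 * q                            ≡⟨⟩
        q + 2 * q                        ∎)
        where open ≤-Reasoning

      -- Here e = 2: one point may be lost in `height-residual`, and one is present on every line
      -- anyway. The initial height 4 leaves u = 2, where `(q ∸ 1 ∸ u) * u` takes its least value
      -- `2 * (q ∸ 3)`.
      tall : ∀ d → Bad g R d → q ≤ height g R d
      tall = growth g R 2 (2 * (q ∸ 3)) 2 q ≤-refl start
        (λ d bad → proj₁ (sparse′ d bad) , λ u h → ≤-trans (m+n≤o⇒n≤o∸m 6 (proj₂ (sparse′ d bad) u h)) (≤-reflexive (sym (*-distribˡ-∸ 2 q 3))))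
        (λ u 2≤u 2+u<q → ≤-trans (≤-reflexive (cong (2 *_) (sym (∸-+-assoc q 1 2))))
          (≤-trans (product-bound (q ∸ 1) 2 u 2≤u (m+n≤o⇒n≤o∸m 1 2+u<q)) (≤-reflexive (cong (_* u) (∸-+-assoc q 1 u)))))

      #bad≤1 : ∀ z d → (∀ u → (∀ d′ → Bad g R d′ → 2 + u ≤ height g R d′) → 7 + #bad g R z d * u ≤ 2 * q) → #bad g R z d ≤ 1
      #bad≤1 z d few = ≤-pred (*-cancelʳ-< (q ∸ 2) (#bad g R z d) 2 (≤-trans
        (m+n≤o⇒n≤o∸m 4 (≤-trans (+-monoʳ-≤ 4 (m≤n+m (suc (#bad g R z d * (q ∸ 2))) 2))
          (few (q ∸ 2) (λ d′ b → ≤-trans (≤-reflexive (m+[n∸m]≡n (<⇒≤ 2<q))) (tall d′ b)))))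
        (≤-reflexive (sym (*-distribˡ-∸ 2 q 2)))))

      vanish : ∀ k → suc k < q → moment (col g R v) k ≡ 0ᶠ
      vanish k k<q = few-bad⇒mom≡0 g R (proj₁ (sparse′ v bad)) v k k<q
        (≤-<-trans (+-monoʳ-≤ k (#bad≤1 (proj₁ (sparse′ v bad)) v (proj₂ (sparse′ v bad)))) (≤-trans (≤-reflexive (cong suc (+-comm k 1))) k<q))

    -- A column on which the cone is nonzero is full for it, so it has at least `q ∸ 1` points of
    -- `ls`; every other column has at least one.
    cone-count : ∀ {m} (ls : Code m) R → σ ls R ≢ 0ᶠ →
      (∀ v x y → col (residual ls R) R v x ≡ col (residual ls R) R v y) →
      q ^ m + (q ∸ 2) * nonzeros (residual ls R) ≤ q * nonzeros ls
    cone-count {m} ls R σ≢0 const = begin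
      q ^ m + (q ∸ 2) * nonzeros g                        ≡⟨ cong₂ _+_ (sym (trans (ΣV-const m 1) (*-identityʳ _))) (sym (ΣV-* (q ∸ 2) (λ v → nz (ev g v)))) ⟩
      ΣV {m} (λ _ → 1) + ΣV (λ v → (q ∸ 2) * nz (ev g v)) ≡⟨ sym (ΣV-+ {m} (λ _ → 1) (λ v → (q ∸ 2) * nz (ev g v))) ⟩
      ΣV (λ v → 1 + (q ∸ 2) * nz (ev g v))                ≤⟨ ΣV-mono bound ⟩
      ΣV (height ls R)                                    ≡⟨ ∑height ls R ⟩
      q * nonzeros ls                                     ∎
      where
      open ≤-Reasoning
      g = residual ls R
      bound : ∀ v → 1 + (q ∸ 2) * nz (ev g v) ≤ height ls R v
      bound v with ev g v ≟ 0ᶠ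
      ... | yes _ = ≤-trans (≤-reflexive (cong suc (*-zeroʳ (q ∸ 2)))) (height≥1 ls R v 1<q σ≢0)
      ... | no ≢0 = ≤-pred (begin
        2 + (q ∸ 2) * 1            ≡⟨ cong (2 +_) (*-identityʳ _) ⟩
        2 + (q ∸ 2)                ≡⟨ m+[n∸m]≡n (<⇒≤ 2<q) ⟩
        q                          ≡⟨ sym (trans (∑-const q 1) (*-identityʳ q)) ⟩
        ∑ {q} (λ _ → 1)            ≡⟨ ∑-cong (λ y → sym (nz-≢0 λ eq → ≢0 (trans (sym (trans (const v y 0ᶠ) (col-0 g R v))) eq))) ⟩
        height g R v               ≤⟨ height-residual ls R v σ≢0 ⟩
        1 + height ls R v          ∎)

    disc-one : ∀ c a → det₂ (c *ᶠ a ^ᶠ 0) (c *ᶠ a ^ᶠ 1) (c *ᶠ a ^ᶠ 2) ≡ 0ᶠ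
    disc-one = solve 2 (λ c a → c :* a :^ 0 :* (c :* a :^ 2) :- (c :* a :^ 1) :* (c :* a :^ 1) := con (pos 0)) refl

    supp-two : ∀ g {a b} → b ≢ a → g a ≢ 0ᶠ → g b ≢ 0ᶠ → 2 ≤ supp g
    supp-two g {a} {b} b≢a ga≢0 gb≢0 = ≤-trans
      (s≤s (supp≥1 (zeroAt a g) {b} (λ eq → gb≢0 (trans (sym (zeroAt-≢ g b≢a)) eq)))) (supp-zeroAt g ga≢0)

    3<q : 3 < q
    3<q = 4≤q

    Deg-disc : ∀ {m} (ls : Code m) R z d → Deg 2 (λ x → disc ls R (z ⊕ x ⊙ d)) (disc ls R d)
    Deg-disc ls R z d = Deg-det₂ 0 1 (Deg-mom ls R z d 0 1<q) (Deg-mom ls R z d 1 2<q) (Deg-mom ls R z d 2 3<q)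

    mom₀≡σ : ∀ {m} (ls : Code m) R v → mom ls R v 0 ≡ σ ls R
    mom₀≡σ ls R v = line-sum ls R v 1<q

    disc≡0-one : ∀ {m} (ls : Code m) R v {a} → (∀ y → y ≢ a → col ls R v y ≡ 0ᶠ) → disc ls R v ≡ 0ᶠ
    disc≡0-one ls R v {a} vanish =
      trans (det₂-cong (moment-one vanish 0) (moment-one vanish 1) (moment-one vanish 2)) (disc-one (col ls R v a) a)

    -- Each column is owed two points. If `σ` is nonzero, none is empty and the one-point columns
    -- are among the two roots of `disc`. If `σ` is zero, `disc` is minus the square of s₁;
    -- one-point columns do not occur, and empty ones are roots of a linear polynomial.
    disc≢0⇒dense : ∀ {m} (ls : Code m) R d → disc ls R d ≢ 0ᶠ → ∀ z → 2 * q ≤ 2 + planes ls d R z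
    disc≢0⇒dense ls R d disc≢0 z with σ ls R ≟ 0ᶠ
    ... | no σ≢0 = begin
      2 * q                                                            ≡⟨ *-comm 2 q ⟩
      q * 2                                                            ≡⟨ sym (∑-const q 2) ⟩
      ∑ {q} (λ _ → 2)                                                  ≤⟨ ∑-mono (λ x → bound (z ⊕ x ⊙ d)) ⟩
      ∑ (λ x → isz (disc ls R (z ⊕ x ⊙ d)) + height ls R (z ⊕ x ⊙ d))  ≡⟨ ∑-+ (λ x → isz (disc ls R (z ⊕ x ⊙ d))) (λ x → height ls R (z ⊕ x ⊙ d)) ⟩
      ∑ (λ x → isz (disc ls R (z ⊕ x ⊙ d))) + planes ls d R z          ≤⟨ +-monoˡ-≤ (planes ls d R z) (roots≤degree 2 (Deg-disc ls R z d) disc≢0) ⟩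
      2 + planes ls d R z                                              ∎
      where
      open ≤-Reasoning
      bound : ∀ v → 2 ≤ isz (disc ls R v) + height ls R v
      bound v with small? (col ls R v)
      ... | inj₂ 3≤h = ≤-trans (≤-trans (n≤1+n 2) 3≤h) (m≤n+m _ _)
      ... | inj₁ (none ≡0) = contradiction (trans (sym (mom₀≡σ ls R v)) (moment-none ≡0 0)) σ≢0
      ... | inj₁ (one a a≢0 vanish) = +-mono-≤ (≤-reflexive (sym (isz-0 (disc≡0-one ls R v vanish)))) (supp≥1 (col ls R v) a≢0)
      ... | inj₁ (two a b b≢a a≢0 b≢0 _) = ≤-trans (supp-two (col ls R v) b≢a a≢0 b≢0) (m≤n+m _ _)
    ... | yes σ≡0 = begin
      2 * q                                                                ≡⟨ *-comm 2 q ⟩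
      q * 2                                                                ≡⟨ sym (∑-const q 2) ⟩
      ∑ {q} (λ _ → 2)                                                      ≤⟨ ∑-mono (λ x → bound (z ⊕ x ⊙ d)) ⟩
      ∑ (λ x → 2 * isz (M x) + height ls R (z ⊕ x ⊙ d))                    ≡⟨ ∑-+ (λ x → 2 * isz (M x)) (λ x → height ls R (z ⊕ x ⊙ d)) ⟩
      ∑ (λ x → 2 * isz (M x)) + planes ls d R z                            ≡⟨ cong (_+ planes ls d R z) (∑-* 2 (λ x → isz (M x))) ⟩
      2 * ∑ (λ x → isz (M x)) + planes ls d R z                            ≤⟨ +-monoˡ-≤ (planes ls d R z) (*-monoʳ-≤ 2 (roots≤degree 1 (Deg-mom ls R z d 1 2<q) mom₁≢0)) ⟩
      2 + planes ls d R z                                                  ∎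
      where
      open ≤-Reasoning
      M : K → K
      M x = mom ls R (z ⊕ x ⊙ d) 1
      mom₁≢0 : mom ls R d 1 ≢ 0ᶠ
      mom₁≢0 eq = disc≢0 (trans (cong₂ (λ u w → u *ᶠ mom ls R d 2 -ᶠ w *ᶠ w) (trans (mom₀≡σ ls R d) σ≡0) eq)
        (solve 1 (λ c → con (pos 0) :* c :- con (pos 0) :* con (pos 0) := con (pos 0)) refl (mom ls R d 2)))
      bound : ∀ v → 2 ≤ 2 * isz (mom ls R v 1) + height ls R v
      bound v with small? (col ls R v)
      ... | inj₂ 3≤h = ≤-trans (≤-trans (n≤1+n 2) 3≤h) (m≤n+m _ _)
      ... | inj₁ (none ≡0) = ≤-trans (≤-reflexive (cong (2 *_) (sym (isz-0 (moment-none ≡0 1))))) (m≤m+n _ _)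
      ... | inj₁ (one a a≢0 vanish) = contradiction
              (trans (sym (trans (moment-one vanish 0) (*ᶠ-identityʳ _))) (trans (mom₀≡σ ls R v) σ≡0)) a≢0
      ... | inj₁ (two a b b≢a a≢0 b≢0 _) = ≤-trans (supp-two (col ls R v) b≢a a≢0 b≢0) (m≤n+m _ _)

    2q-2≤q² : 2 * q ∸ 2 ≤ q * q
    2q-2≤q² = ≤-trans (m∸n≤m (2 * q) 2) (*-monoˡ-≤ q (<⇒≤ 2<q))

    instance
      q-nonZero : NonZero q
      q-nonZero = >-nonZero (<-trans (s≤s z≤n) 2<q)

    -- The factor `2 * q ∸ 2` is the number of points forced by `disc≢0⇒dense`. Below this average
    -- every `disc` vanishes, the residual is a cone, and `cone-count` leaves it below the minimum
    -- weight.
    one-hyperplane : ∀ {k} (ls : Code (2 + k)) → nonzeros ls < (2 * q ∸ 2) * q ^ k → Hyp₁ ls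
    one-hyperplane {k} ls few with deviating? ls
    ... | no ¬dev = zero⇒Hyp₁ ls (constant⇒0 ls (<-≤-trans few
            (≤-trans (*-monoˡ-≤ (q ^ k) 2q-2≤q²) (≤-reflexive (*-assoc q q (q ^ k))))) ¬dev)
    ... | yes (R , dev) = residual-0⇒Hyp₁ ls dev (minimum-weight g 1<q small)
      where
      open ≤-Reasoning
      g = residual ls R
      σ≢0 = deviating⇒σ≢0 ls dev

      2q-2 : suc (2 * q ∸ 3) ≡ 2 * q ∸ 2
      2q-2 = sym (+-∸-assoc 1 {2 * q} {3} (≤-trans (<⇒≤ 3<q) (m≤m+n q _)))

      light : ∀ d → ∃ λ z → planes ls d R z ≤ 2 * q ∸ 3
      light d = sparse-plane (λ v → nz (ev ls v)) d R (2 * q ∸ 3) (begin-strict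
        q * (q * nonzeros ls)                   <⟨ *-monoʳ-< q (*-monoʳ-< q few) ⟩
        q * (q * ((2 * q ∸ 2) * q ^ k))         ≡⟨ S.solve 3 (λ q c t → q S.:* (q S.:* (c S.:* t)) S.:= q S.:* (q S.:* t) S.:* c) refl q (2 * q ∸ 2) (q ^ k) ⟩
        q ^ (2 + k) * (2 * q ∸ 2)               ≡⟨ cong (q ^ (2 + k) *_) (sym 2q-2) ⟩
        q ^ (2 + k) * suc (2 * q ∸ 3)           ∎)

      disc≡0 : ∀ d → disc ls R d ≡ 0ᶠ
      disc≡0 d with disc ls R d ≟ 0ᶠ
      ... | yes eq = eq
      ... | no neq with light d
      ...   | z , le = contradiction (≤-trans (disc≢0⇒dense ls R d neq z) (+-monoʳ-≤ 2 le))
                (<⇒≱ (≤-trans (≤-reflexive (cong (2 +_) 2q-2)) (≤-reflexive (m+[n∸m]≡n (≤-trans (<⇒≤ 2<q) (m≤m+n q _))))))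

      -- The passage from `2 * q ∸ 3` to `3 * q ∸ 7` is where `4 ≤ q` enters.
      light₃ : ∀ d → 3 ≤ height ls R d → ∃ λ z → 7 + planes ls d R z ≤ 3 * q
      light₃ d _ with light d
      ... | z , le = z , (begin
        7 + planes ls d R z         ≤⟨ +-monoʳ-≤ 7 le ⟩
        4 + (3 + (2 * q ∸ 3))       ≡⟨ cong (4 +_) (m+[n∸m]≡n (≤-trans (<⇒≤ 3<q) (m≤m+n q _))) ⟩
        4 + 2 * q                   ≤⟨ +-monoˡ-≤ (2 * q) 4≤q ⟩
        q + 2 * q                   ∎)

      small : nonzeros g < q ^ suc k
      small = *-cancelˡ-< (q ∸ 2) _ _ (+-cancelˡ-< (q ^ (2 + k)) _ _ (begin-strict
        q ^ (2 + k) + (q ∸ 2) * nonzeros g       ≤⟨ cone-count ls R σ≢0 (cone ls R σ≢0 disc≡0 light₃) ⟩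
        q * nonzeros ls                          <⟨ *-monoʳ-< q few ⟩
        q * ((2 * q ∸ 2) * q ^ k)                ≡⟨ cong (λ c → q * (c * q ^ k)) 2q-2≡q+[q-2] ⟩
        q * ((q + (q ∸ 2)) * q ^ k)              ≡⟨ S.solve 3 (λ q c t → q S.:* ((q S.:+ c) S.:* t) S.:= q S.:* (q S.:* t) S.:+ c S.:* (q S.:* t)) refl q (q ∸ 2) (q ^ k) ⟩
        q ^ (2 + k) + (q ∸ 2) * q ^ suc k        ∎))
        where
        2q-2≡q+[q-2] : 2 * q ∸ 2 ≡ q + (q ∸ 2)
        2q-2≡q+[q-2] = trans (cong (λ z → q + z ∸ 2) (+-identityʳ q)) (+-∸-assoc q (<⇒≤ 2<q))

-- The common argument for two hyperplanes.

module TwoHyperplanes {q : ℕ} (F : FiniteField q) (r : ℕ)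
  (r≡-1 : FieldTheory.fromℕ F r ≡ FieldTheory.-ᶠ_ F (FieldTheory.1ᶠ F)) (4≤q : 4 ≤ q) where
  open FieldTheory F
  open FiniteFunctions F
  open Codewords F
  open Counting F
  open OneHyperplane F
  open Cones r r≡-1 4≤q
  open Residual r r≡-1 2<q
  open Reduction r r≡-1 2<q
  open PG F using (dot)
  open Solver using (solve; _:=_; _:+_; _:*_; :-_; _:-_; con)

  supp≤1 : ∀ (g : K → K) → (∀ {x y} → g x ≢ 0ᶠ → g y ≢ 0ᶠ → x ≡ y) → supp g ≤ 1
  supp≤1 g unique with nonzero? g
  ... | no ¬∃ = ≤-trans (≤-reflexive (supp-0 g (¬nonzero⇒0 ¬∃))) z≤n
  ... | yes (a , ga≢0) = ≤-trans (∑-mono bound) (≤-reflexive (∑-𝟙≡ a))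
    where
    bound : ∀ y → nz (g y) ≤ 𝟙 (y ≟ a)
    bound y with g y ≟ 0ᶠ
    ... | yes _ = z≤n
    ... | no gy≢0 = ≤-reflexive (sym (𝟙-yes (y ≟ a) (unique gy≢0 ga≢0)))

  -- What the common argument asks of a word. Both conditions are confined to nonzero support
  -- points, and `sparse` to columns with three points, because for q = 4 and q = 5 sparse planes
  -- are found under such restrictions.
  record Tame {m} (ls : Code m) : Set where
    field
      disc≡0 : ∀ R → R ≢ 𝟎 → ev ls R ≢ 0ᶠ → ∀ d → disc ls R d ≡ 0ᶠ
      sparse : ∀ R → R ≢ 𝟎 → ev ls R ≢ 0ᶠ → ∀ d → 3 ≤ height ls R d → ∃ λ z → 7 + planes ls d R z ≤ 3 * q

  -- Equivalently, `σ` vanishes at every support point.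
  TwoValued : ∀ {m} → Code m → Set
  TwoValued ls = ∀ v → ev ls v ≢ 0ᶠ → ev ls v ≡ ev ls 𝟎

  -- Since s₀ = 0, a vanishing `disc` gives s₁ = 0, and `growth` applies to `ls` itself: a nonempty
  -- column misses at most one point. Its nonzero values are all κ and its sum is zero, so it cannot
  -- miss exactly one.
  translation-invariant : ∀ {m} (ls : Code m) → Tame ls → TwoValued ls →
    ∀ R → ev ls R ≢ 0ᶠ → ∀ v t → col ls R v t ≡ ev ls v
  translation-invariant {m} ls tame two-valued R R∈S v t with ≡-dec _≟_ R 𝟎
  ... | yes refl = ev-cong ls λ a → trans (dot-line a v 𝟎 t)
          (trans (cong (λ u → dot a v +ᶠ t *ᶠ u) (dot-𝟎ʳ a)) (trans (cong₂ _+ᶠ_ refl (zeroʳ t)) (+ᶠ-identityʳ _)))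
  ... | no R≢𝟎 with bad? ls R v
  ...   | no ¬∃ = trans (¬nonzero⇒0 ¬∃ t) (trans (sym (¬nonzero⇒0 ¬∃ 0ᶠ)) (col-0 ls R v))
  ...   | yes bad = trans (full t) (trans (sym (full 0ᶠ)) (col-0 ls R v))
    where
    open Tame tame
    κ = ev ls 𝟎

    mom₀≡0 : ∀ d → mom ls R d 0 ≡ 0ᶠ
    mom₀≡0 d = trans (mom₀≡σ ls R d) (x-x≡0 (sym (two-valued R R∈S)))

    vanish : ∀ d k → k < 2 → mom ls R d k ≡ 0ᶠ
    vanish d 0 _ = mom₀≡0 d
    vanish d 1 _ = det₂-a≡0 (mom₀≡0 d) (disc≡0 R R≢𝟎 R∈S d)
    vanish d (suc (suc k)) (s≤s (s≤s ()))

    tall₀ : ∀ d → Bad ls R d → 3 ≤ height ls R d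
    tall₀ d (y , ≢0) = moments⇒supp 2 (col ls R d) (vanish d) ≢0

    light : ∀ d → Bad ls R d → ∃ λ z → ∀ u → (∀ d′ → Bad ls R d′ → u ≤ height ls R d′) → #bad ls R z d * u < 3 * (q ∸ 2)
    light d bad with sparse R R≢𝟎 R∈S d (tall₀ d bad)
    ... | z , le = z , λ u tall → ≤-trans (m+n≤o⇒n≤o∸m 6 (≤-trans
        (+-monoʳ-≤ 7 (≤-trans (≤-reflexive (cong (_+ #bad ls R z d * u) (sym (*-zeroʳ q))))
          (#bad-weighted ls R z d u (height ls R) 0 (λ _ → z≤n) tall))) le))
      (≤-reflexive (sym (*-distribˡ-∸ 3 q 2)))

    -- Columns may be empty now, so e = 0. By symmetry `(suc q ∸ u) * u` stays at least its value at
    -- u = 3 up to u = q - 2, which is why the growth stops at `q ∸ 1`.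
    tall : ∀ d → Bad ls R d → q ∸ 1 ≤ height ls R d
    tall = growth ls R 0 (3 * (q ∸ 2)) 3 (q ∸ 1) (m∸n≤m q 1) tall₀ light
      (λ u 3≤u u<q-1 → product-bound (suc q) 3 u 3≤u (s≤s (begin
        2 + u                  ≡⟨ +-comm 1 (suc u) ⟩
        suc u + 1              ≤⟨ +-monoˡ-≤ 1 u<q-1 ⟩
        q ∸ 1 + 1              ≡⟨ m∸n+n≡m (<⇒≤ 1<q) ⟩
        q                      ∎)))
      where open ≤-Reasoning

    h : K → K
    h y = κ -ᶠ col ls R v y

    supp-h≤1 : supp h ≤ 1
    supp-h≤1 = +-cancelʳ-≤ (q ∸ 1) (supp h) 1 (begin
      supp h + (q ∸ 1)                                ≤⟨ +-monoʳ-≤ (supp h) (tall v bad) ⟩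
      supp h + height ls R v                          ≡⟨ sym (∑-+ (λ y → nz (h y)) (λ y → nz (col ls R v y))) ⟩
      ∑ (λ y → nz (h y) + nz (col ls R v y))          ≤⟨ ∑-mono bound ⟩
      ∑ {q} (λ _ → 1)                                 ≡⟨ trans (∑-const q 1) (*-identityʳ q) ⟩
      q                                               ≡⟨ sym (m+[n∸m]≡n (<⇒≤ 1<q)) ⟩
      1 + (q ∸ 1)                                     ∎)
      where
      open ≤-Reasoning
      bound : ∀ y → nz (h y) + nz (col ls R v y) ≤ 1
      bound y with col ls R v y ≟ 0ᶠ
      ... | yes _ = ≤-trans (≤-reflexive (+-identityʳ _)) (nz≤1 (h y))
      ... | no ≢0 = ≤-reflexive (cong (_+ 1) (nz-0 (x-x≡0 (sym (two-valued _ ≢0)))))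

    h-sum : moment h 0 ≡ 0ᶠ
    h-sum = trans (∑ᶠ-cong λ y → solve 3 (λ k c p → (k :- c) :* p := k :* p :+ (:- (c :* p))) refl κ (col ls R v y) (y ^ᶠ 0))
      (trans (∑ᶠ-+ (λ y → κ *ᶠ y ^ᶠ 0) (λ y → -ᶠ (col ls R v y *ᶠ y ^ᶠ 0)))
      (trans (cong₂ _+ᶠ_ (trans (∑ᶠ-* κ (λ y → y ^ᶠ 0)) (trans (cong (κ *ᶠ_) (∑ᶠ-power 0 1<q)) (zeroʳ κ)))
                (trans (∑ᶠ-cong (λ y → solve 1 (λ c → :- c := con (-[1+ 0 ]) :* c) refl (col ls R v y *ᶠ y ^ᶠ 0)))
                  (trans (∑ᶠ-* (fromℤ -[1+ 0 ]) (λ y → col ls R v y *ᶠ y ^ᶠ 0)) (trans (cong (fromℤ -[1+ 0 ] *ᶠ_) (mom₀≡0 v)) (zeroʳ _)))))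
        (+ᶠ-identityʳ 0ᶠ)))

    full : ∀ y → col ls R v y ≡ κ
    full y with h y ≟ 0ᶠ
    ... | yes eq = sym (x-y≡0⇒x≡y eq)
    ... | no neq = contradiction (moments⇒supp 1 h (λ { 0 _ → h-sum ; (suc k) (s≤s ()) }) neq) (≤⇒≯ supp-h≤1)

  -- The hypothesis is what `cone-count` needs to bring the residual under the bound of
  -- `one-hyperplane`.
  two-hyperplanes : ∀ {k} (ls : Code (2 + k)) → Tame ls →
    q * nonzeros ls < q ^ (2 + k) + (q ∸ 2) * ((2 * q ∸ 2) * q ^ k) → Hyp₂ ls
  two-hyperplanes {k} ls tame few with anyV? (λ R → ¬? (ev ls R ≟ 0ᶠ) ×-dec ¬? (ev ls R ≟ ev ls 𝟎))
  ... | yes (R , R∈S , dev) = residual-Hyp₁⇒Hyp₂ ls dev (one-hyperplane (residual ls R)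
        (*-cancelˡ-< (q ∸ 2) _ _ (+-cancelˡ-< (q ^ (2 + k)) _ _ (≤-<-trans (cone-count ls R σ≢0
          (cone ls R σ≢0 (Tame.disc≡0 tame R R≢𝟎 R∈S) (Tame.sparse tame R R≢𝟎 R∈S))) few))))
    where
    σ≢0 = deviating⇒σ≢0 ls dev
    R≢𝟎 : R ≢ 𝟎
    R≢𝟎 refl = dev refl
  ... | no ¬∃ with deviating? ls
  ...   | no ¬dev = Hyp₁⇒Hyp₂ ls (zero⇒Hyp₁ ls (constant⇒0 ls (*-cancelˡ-< q _ _ (<-≤-trans few bound)) ¬dev))
    where
    open ≤-Reasoning
    bound : q ^ (2 + k) + (q ∸ 2) * ((2 * q ∸ 2) * q ^ k) ≤ q * q ^ (2 + k)
    bound = begin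
      q ^ (2 + k) + (q ∸ 2) * ((2 * q ∸ 2) * q ^ k)    ≤⟨ +-monoʳ-≤ (q ^ (2 + k)) (*-mono-≤ (∸-monoʳ-≤ q (s≤s z≤n)) (*-monoˡ-≤ (q ^ k) 2q-2≤q²)) ⟩
      q ^ (2 + k) + (q ∸ 1) * (q * q * q ^ k)          ≡⟨ cong (λ t → q ^ (2 + k) + (q ∸ 1) * t) (*-assoc q q (q ^ k)) ⟩
      q ^ (2 + k) + (q ∸ 1) * q ^ (2 + k)              ≡⟨⟩
      suc (q ∸ 1) * q ^ (2 + k)                        ≡⟨ cong (_* q ^ (2 + k)) (m+[n∸m]≡n (<⇒≤ 1<q)) ⟩
      q * q ^ (2 + k)                                  ∎
  ...   | yes (Q , dev) = Hyp₁⇒Hyp₂ ls (one-hyperplane₃ ls (begin-strict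
      nonzeros ls                 ≤⟨ *-cancelˡ-≤ q (begin
          q * nonzeros ls           ≡⟨ sym (∑height ls Q) ⟩
          ΣV (height ls Q)          ≤⟨ ΣV-mono (λ v → supp≤1 (col ls Q v) (λ {x} {y} → unique v {x} {y})) ⟩
          ΣV {2 + k} (λ _ → 1)      ≡⟨ trans (ΣV-const (2 + k) 1) (*-identityʳ _) ⟩
          q ^ (2 + k)               ∎) ⟩
      q ^ suc k                   <⟨ m<m+n (q ^ suc k) (m^n>0 q k) ⟩
      q ^ suc k + q ^ k           ∎))
    where
    open ≤-Reasoning
    two-valued : TwoValued ls
    two-valued v v∈S with ev ls v ≟ ev ls 𝟎
    ... | yes eq = eq
    ... | no neq = contradiction (v , v∈S , neq) ¬∃
    Q∉S : ev ls Q ≡ 0ᶠ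
    Q∉S with ev ls Q ≟ 0ᶠ
    ... | yes eq = eq
    ... | no neq = contradiction (two-valued Q neq) dev
    -- Two support points on a line in direction `Q` would put their difference, a nonzero multiple
    -- of `Q`, into the support. So each such line has at most one, and the word has at most
    -- `q ^ suc k` nonzeros.
    unique : ∀ v {x y} → col ls Q v x ≢ 0ᶠ → col ls Q v y ≢ 0ᶠ → x ≡ y
    unique v {x} {y} x∈S y∈S with x ≟ y
    ... | yes eq = eq
    ... | no neq = contradiction (trans (sym (translation-invariant ls tame two-valued (v ⊕ x ⊙ Q) x∈S (v ⊕ y ⊙ Q) (-ᶠ 1ᶠ)))
        (trans (ev-scale ls {w = Q} {s = y -ᶠ x} (λ eq → neq (sym (x-y≡0⇒x≡y eq))) difference) Q∉S)) y∈S
      where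
      difference : ∀ a → dot a (v ⊕ y ⊙ Q ⊕ -ᶠ 1ᶠ ⊙ (v ⊕ x ⊙ Q)) ≡ (y -ᶠ x) *ᶠ dot a Q
      difference a = trans (dot-line a (v ⊕ y ⊙ Q) (v ⊕ x ⊙ Q) (-ᶠ 1ᶠ))
        (trans (cong₂ (λ u w → u +ᶠ -ᶠ 1ᶠ *ᶠ w) (dot-line a v Q y) (dot-line a v Q x))
        (trans (cong₂ _+ᶠ_ refl (trans (sym (-‿distribˡ-* 1ᶠ _)) (cong -ᶠ_ (*ᶠ-identityˡ _))))
          (solve 4 (λ v x y q → v :+ y :* q :- (v :+ x :* q) := (y :- x) :* q) refl (dot a v) x y (dot a Q))))

-- q ≥ 6: the 3 × 3 determinant and three-secants.

module LargeField {q : ℕ} (F : FiniteField q) (r : ℕ)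
  (r≡-1 : FieldTheory.fromℕ F r ≡ FieldTheory.-ᶠ_ F (FieldTheory.1ᶠ F)) (6≤q : 6 ≤ q) where
  open FieldTheory F
  open FiniteFunctions F
  open Codewords F
  open Counting F
  open OneHyperplane F
  private
    4≤q : 4 ≤ q
    4≤q = ≤-trans (m≤m+n 4 2) 6≤q
  open Cones r r≡-1 4≤q
  open Residual r r≡-1 2<q using (1<q)
  open TwoHyperplanes F r r≡-1 4≤q
  open PG F using (dot)
  open Solver using (solve; _:=_; _:+_; _:*_; :-_; _:-_; _:^_; con; Polynomial)

  private
    :det₂ : ∀ {n} → (a b c : Polynomial n) → Polynomial n
    :det₂ a b c = a :* c :- b :* b

    :det₃ : ∀ {n} → (a b c d : Polynomial n) → Polynomial n
    :det₃ a b c d = a :* (b :* c) :+ a :* (b :* c) :- (a :* a :* d :+ b :* b :* b)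

  -- The 3 × 3 Hankel determinant of s₀, ..., s₄ with the terms in s₀ collected, so that `det₃`
  -- remains when s₀ vanishes.
  hankel : (ℕ → K) → K
  hankel s = s 0 *ᶠ det₂ (s 2) (s 3) (s 4) +ᶠ det₃ (s 1) (s 2) (s 3) (s 4)

  hankel-cong : ∀ {s s′ : ℕ → K} → (∀ k → s k ≡ s′ k) → hankel s ≡ hankel s′
  hankel-cong eq = cong₂ _+ᶠ_ (cong₂ _*ᶠ_ (eq 0) (det₂-cong (eq 2) (eq 3) (eq 4))) (det₃-cong (eq 1) (eq 2) (eq 3) (eq 4))

  -- The Hankel matrix of two point masses is a sum of two matrices of rank one.
  hankel-two : ∀ f g a b → hankel (λ k → f *ᶠ a ^ᶠ k +ᶠ g *ᶠ b ^ᶠ k) ≡ 0ᶠ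
  hankel-two = solve 4 (λ f g a b → let s = λ k → f :* a :^ k :+ g :* b :^ k in
    s 0 :* :det₂ (s 2) (s 3) (s 4) :+ :det₃ (s 1) (s 2) (s 3) (s 4) := con (pos 0)) refl

  -- The Hankel matrix factors through the Vandermonde matrix of the nodes 0, a, b: the determinant
  -- is the product of the masses times the square of the Vandermonde determinant.
  hankel-three : ∀ e f g a b → hankel (λ k → e *ᶠ 0ᶠ ^ᶠ k +ᶠ (f *ᶠ a ^ᶠ k +ᶠ g *ᶠ b ^ᶠ k)) ≡
    e *ᶠ (f *ᶠ g *ᶠ ((a *ᶠ b *ᶠ (a -ᶠ b)) *ᶠ (a *ᶠ b *ᶠ (a -ᶠ b))))
  hankel-three = solve 5 (λ e f g a b → let s = λ k → e :* con (pos 0) :^ k :+ (f :* a :^ k :+ g :* b :^ k) in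
    s 0 :* :det₂ (s 2) (s 3) (s 4) :+ :det₃ (s 1) (s 2) (s 3) (s 4)
      := e :* (f :* g :* ((a :* b :* (a :- b)) :* (a :* b :* (a :- b))))) refl

  -- Eliminating with the (nonzero, constant) moment of order 0 reduces the 3 × 3 to a 2 × 2 determinant.
  minor : K → K → K → K → K
  minor s x y z = s *ᶠ z -ᶠ x *ᶠ y

  -- Chio condensation with pivot `s`.
  hankel-minors : ∀ s m₁ m₂ m₃ m₄ → det₂ (minor s m₁ m₁ m₂) (minor s m₁ m₂ m₃) (minor s m₂ m₂ m₄)
    ≡ s *ᶠ (s *ᶠ det₂ m₂ m₃ m₄ +ᶠ det₃ m₁ m₂ m₃ m₄)
  hankel-minors = solve 5 (λ s m₁ m₂ m₃ m₄ → :det₂ (s :* m₂ :- m₁ :* m₁) (s :* m₃ :- m₁ :* m₂) (s :* m₄ :- m₂ :* m₂)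
    := s :* (s :* :det₂ m₂ m₃ m₄ :+ :det₃ m₁ m₂ m₃ m₄)) refl

  Deg-minor : ∀ i j {s f g h φ γ χ} → Deg i f φ → Deg j g γ → Deg (i + j) h χ →
    Deg (i + j) (λ x → minor s (f x) (g x) (h x)) (minor s φ γ χ)
  Deg-minor i j {s} Df Dg Dh = Deg-+ (i + j) (Deg-scale (i + j) s Dh) (Deg-neg (i + j) (Deg-* i j Df Dg))

  module _ {m} (ls : Code m) (P d : Vec K m) (hankel≢0 : hankel (mom ls P d) ≢ 0ᶠ) (z : Vec K m) where
    private
      v : K → Vec K m
      v x = z ⊕ x ⊙ d
      s : ℕ → K → K
      s k x = mom ls P (v x) k
      -- The number of points by which the column falls short of three.
      ω : K → ℕ
      ω x = 3 ∸ height ls P (v x)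
      -- The moment of order 4 is covered by `Deg-mom` because `6 ≤ q`.
      D : ∀ k → k ≤ 4 → Deg k (s k) (mom ls P d k)
      D k k≤4 = Deg-mom ls P z d k (≤-trans (s≤s (s≤s k≤4)) 6≤q)
      D₁ = D 1 (m≤m+n 1 3)
      D₂ = D 2 (m≤m+n 2 2)
      D₃ = D 3 (m≤m+n 3 1)
      D₄ = D 4 ≤-refl

      ω≥⇒height≤ : ∀ j x → suc j ≤ ω x → j + height ls P (v x) < 3
      ω≥⇒height≤ j x le = ≤-trans (≤-reflexive (cong suc (+-comm j _)))
        (≤-trans (≤-reflexive (sym (+-suc (height ls P (v x)) j))) (m<n∸o⇒o+m<n le))
        where
        m<n∸o⇒o+m<n : suc j ≤ 3 ∸ height ls P (v x) → height ls P (v x) + suc j ≤ 3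
        m<n∸o⇒o+m<n le with height ls P (v x) ≤? 3
        ... | yes h≤3 = ≤-trans (+-monoʳ-≤ _ le) (≤-reflexive (m+[n∸m]≡n h≤3))
        ... | no h≰3 = contradiction (≤-trans le (≤-reflexive (m≤n⇒m∸n≡0 (<⇒≤ (≰⇒> h≰3))))) λ ()

    dense-if : ∑ ω ≤ 6 → 3 * q ≤ 6 + planes ls d P z
    dense-if ∑ω≤6 = begin
      3 * q                                            ≡⟨ *-comm 3 q ⟩
      q * 3                                            ≡⟨ sym (∑-const q 3) ⟩
      ∑ {q} (λ _ → 3)                                  ≤⟨ ∑-mono (λ x → ≤-trans (m≤n+m∸n 3 (height ls P (v x))) (≤-reflexive (+-comm _ (ω x)))) ⟩
      ∑ (λ x → ω x + height ls P (v x))                ≡⟨ ∑-+ ω (λ x → height ls P (v x)) ⟩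
      ∑ ω + planes ls d P z                            ≤⟨ +-monoˡ-≤ (planes ls d P z) ∑ω≤6 ⟩
      6 + planes ls d P z                              ∎
      where open ≤-Reasoning

    -- A column of sum zero never has exactly one point. An empty one owes three and is a common
    -- root of s₁, ..., s₄; a two-point one owes one and is a root of the determinant.
    dense-σ≡0 : σ ls P ≡ 0ᶠ → ∑ ω ≤ 6
    dense-σ≡0 σ≡0 = det₃-multiplicity 1 D₁ D₂ D₃ D₄ leading ω (λ x → m∸n≤m 3 (height ls P (v x))) det-root all-root
      where
      s₀≡0 : ∀ u → mom ls P u 0 ≡ 0ᶠ
      s₀≡0 u = trans (mom₀≡σ ls P u) σ≡0
      drop : ∀ u → hankel (mom ls P u) ≡ det₃ (mom ls P u 1) (mom ls P u 2) (mom ls P u 3) (mom ls P u 4)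
      drop u = trans (cong₂ _+ᶠ_ (trans (cong₂ _*ᶠ_ (s₀≡0 u) refl) (zeroˡ _)) refl) (+ᶠ-identityˡ _)
      leading : det₃ (mom ls P d 1) (mom ls P d 2) (mom ls P d 3) (mom ls P d 4) ≢ 0ᶠ
      leading eq = hankel≢0 (trans (drop d) eq)
      ¬one : ∀ {x a} → col ls P (v x) a ≢ 0ᶠ → ¬ (∀ y → y ≢ a → col ls P (v x) y ≡ 0ᶠ)
      ¬one {x} a≢0 vanish = a≢0 (trans (sym (trans (moment-one vanish 0) (*ᶠ-identityʳ _))) (s₀≡0 (v x)))
      det-root : ∀ x → 1 ≤ ω x → det₃ (s 1 x) (s 2 x) (s 3 x) (s 4 x) ≡ 0ᶠ
      det-root x 1≤ω with small? (col ls P (v x))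
      ... | inj₂ 3≤h = contradiction 3≤h (<⇒≱ (ω≥⇒height≤ 0 x 1≤ω))
      ... | inj₁ (none ≡0) = trans (det₃-cong (moment-none ≡0 1) (moment-none ≡0 2) (moment-none ≡0 3) (moment-none ≡0 4))
              (solve 0 (:det₃ (con (pos 0)) (con (pos 0)) (con (pos 0)) (con (pos 0)) := con (pos 0)) refl)
      ... | inj₁ (one a a≢0 vanish) = contradiction vanish (¬one a≢0)
      ... | inj₁ (two a b b≢a _ _ vanish) = trans (sym (drop (v x))) (trans (hankel-cong (moment-two b≢a vanish)) (hankel-two _ _ a b))
      all-root : ∀ x → 2 ≤ ω x → s 1 x ≡ 0ᶠ × s 2 x ≡ 0ᶠ × s 3 x ≡ 0ᶠ × s 4 x ≡ 0ᶠ
      all-root x 2≤ω with small? (col ls P (v x))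
      ... | inj₂ 3≤h = contradiction (≤-trans 3≤h (n≤1+n _)) (<⇒≱ (ω≥⇒height≤ 1 x 2≤ω))
      ... | inj₁ (none ≡0) = moment-none ≡0 1 , moment-none ≡0 2 , moment-none ≡0 3 , moment-none ≡0 4
      ... | inj₁ (one a a≢0 vanish) = contradiction vanish (¬one a≢0)
      ... | inj₁ (two a b b≢a a≢0 b≢0 _) = contradiction (s≤s (supp-two (col ls P (v x)) b≢a a≢0 b≢0)) (<⇒≱ (ω≥⇒height≤ 1 x 2≤ω))

    -- No column is empty. A one-point column owes two and kills all the minors, its Hankel matrix
    -- having rank one; a two-point column owes one. The minors have degrees 2, 3 and 4, so the
    -- bound is again 6.
    dense-σ≢0 : σ ls P ≢ 0ᶠ → ∑ ω ≤ 6
    dense-σ≢0 σ≢0 = det₂-multiplicity 2 1 (Deg-minor 1 1 D₁ D₁ D₂) (Deg-minor 1 2 D₁ D₂ D₃) (Deg-minor 2 2 D₂ D₂ D₄) leading ω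
        (λ x → ∸-monoʳ-≤ 3 (height≥1 ls P (v x) 1<q σ≢0)) det-root all-root
      where
      c = σ ls P
      minors : ∀ u → det₂ (minor c (mom ls P u 1) (mom ls P u 1) (mom ls P u 2)) (minor c (mom ls P u 1) (mom ls P u 2) (mom ls P u 3))
                          (minor c (mom ls P u 2) (mom ls P u 2) (mom ls P u 4)) ≡ c *ᶠ hankel (mom ls P u)
      minors u = trans (hankel-minors c (mom ls P u 1) (mom ls P u 2) (mom ls P u 3) (mom ls P u 4))
        (cong (λ w → c *ᶠ (w *ᶠ det₂ (mom ls P u 2) (mom ls P u 3) (mom ls P u 4) +ᶠ det₃ (mom ls P u 1) (mom ls P u 2) (mom ls P u 3) (mom ls P u 4)))
          (sym (mom₀≡σ ls P u)))
      leading : det₂ (minor c (mom ls P d 1) (mom ls P d 1) (mom ls P d 2)) (minor c (mom ls P d 1) (mom ls P d 2) (mom ls P d 3))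
                     (minor c (mom ls P d 2) (mom ls P d 2) (mom ls P d 4)) ≢ 0ᶠ
      leading eq = *-nonzero σ≢0 hankel≢0 (trans (sym (minors d)) eq)
      ¬none : ∀ {x} → ¬ (∀ y → col ls P (v x) y ≡ 0ᶠ)
      ¬none {x} ≡0 = σ≢0 (trans (sym (mom₀≡σ ls P (v x))) (moment-none ≡0 0))
      minor-one : ∀ {x a} → (∀ y → y ≢ a → col ls P (v x) y ≡ 0ᶠ) → ∀ i j → minor c (s i x) (s j x) (s (i + j) x) ≡ 0ᶠ
      minor-one {x} {a} vanish i j = trans
        (cong₂ (λ c u → c *ᶠ s (i + j) x -ᶠ u *ᶠ s j x) (trans (sym (mom₀≡σ ls P (v x))) (moment-one vanish 0)) (moment-one vanish i))
        (trans (cong₂ (λ u w → e *ᶠ 1ᶠ *ᶠ u -ᶠ e *ᶠ a ^ᶠ i *ᶠ w) (trans (moment-one vanish (i + j)) (cong (e *ᶠ_) (^-+ a i j))) (moment-one vanish j))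
          (solve 4 (λ e a x y → e :* a :^ 0 :* (e :* (x :* y)) :- e :* x :* (e :* y) := con (pos 0)) refl e a (a ^ᶠ i) (a ^ᶠ j)))
        where
        e = col ls P (v x) a
        ^-+ : ∀ a i j → a ^ᶠ (i + j) ≡ a ^ᶠ i *ᶠ a ^ᶠ j
        ^-+ a zero    j = sym (*ᶠ-identityˡ _)
        ^-+ a (suc i) j = trans (cong (a *ᶠ_) (^-+ a i j)) (sym (*ᶠ-assoc a _ _))
      det-root : ∀ x → 1 ≤ ω x → det₂ (minor c (s 1 x) (s 1 x) (s 2 x)) (minor c (s 1 x) (s 2 x) (s 3 x)) (minor c (s 2 x) (s 2 x) (s 4 x)) ≡ 0ᶠ
      det-root x 1≤ω with small? (col ls P (v x))
      ... | inj₂ 3≤h = contradiction 3≤h (<⇒≱ (ω≥⇒height≤ 0 x 1≤ω))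
      ... | inj₁ (none ≡0) = contradiction ≡0 ¬none
      ... | inj₁ (one a a≢0 vanish) = trans (det₂-cong (minor-one vanish 1 1) (minor-one vanish 1 2) (minor-one vanish 2 2))
              (solve 0 (:det₂ (con (pos 0)) (con (pos 0)) (con (pos 0)) := con (pos 0)) refl)
      ... | inj₁ (two a b b≢a _ _ vanish) = trans (minors (v x))
              (trans (cong (c *ᶠ_) (trans (hankel-cong (moment-two b≢a vanish)) (hankel-two _ _ a b))) (zeroʳ c))
      all-root : ∀ x → 2 ≤ ω x → minor c (s 1 x) (s 1 x) (s 2 x) ≡ 0ᶠ × minor c (s 1 x) (s 2 x) (s 3 x) ≡ 0ᶠ × minor c (s 2 x) (s 2 x) (s 4 x) ≡ 0ᶠ
      all-root x 2≤ω with small? (col ls P (v x))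
      ... | inj₂ 3≤h = contradiction (≤-trans 3≤h (n≤1+n _)) (<⇒≱ (ω≥⇒height≤ 1 x 2≤ω))
      ... | inj₁ (none ≡0) = contradiction ≡0 ¬none
      ... | inj₁ (one a a≢0 vanish) = minor-one vanish 1 1 , minor-one vanish 1 2 , minor-one vanish 2 2
      ... | inj₁ (two a b b≢a a≢0 b≢0 _) = contradiction (s≤s (supp-two (col ls P (v x)) b≢a a≢0 b≢0)) (<⇒≱ (ω≥⇒height≤ 1 x 2≤ω))

    hankel≢0⇒dense : 3 * q ≤ 6 + planes ls d P z
    hankel≢0⇒dense with σ ls P ≟ 0ᶠ
    ... | yes σ≡0 = dense-if (dense-σ≡0 σ≡0)
    ... | no σ≢0  = dense-if (dense-σ≢0 σ≢0)

  ⁻¹-involutive : ∀ {x} → x ≢ 0ᶠ → (x ⁻¹) ⁻¹ ≡ x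
  ⁻¹-involutive {x} x≢0 = x-y≡0⇒x≡y (*-cancel-0 (⁻¹-nonzero x≢0) (begin
    x ⁻¹ *ᶠ ((x ⁻¹) ⁻¹ -ᶠ x)                ≡⟨ solve 3 (λ i j x → i :* (j :- x) := i :* j :- i :* x) refl (x ⁻¹) ((x ⁻¹) ⁻¹) x ⟩
    x ⁻¹ *ᶠ (x ⁻¹) ⁻¹ -ᶠ x ⁻¹ *ᶠ x          ≡⟨ x-x≡0 (trans (*-inverseʳ (⁻¹-nonzero x≢0)) (sym (*-inverseˡ x≢0))) ⟩
    0ᶠ                                      ∎))
    where open ≡-Reasoning

  third-element : ∀ (a b : K) → ∃ λ c → c ≢ a × c ≢ b
  third-element a b with any? (λ c → ¬? (c ≟ a) ×-dec ¬? (c ≟ b))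
  ... | yes found = found
  ... | no ¬∃ = contradiction 2<q (≤⇒≯ (begin
    q                                                     ≡⟨ sym (trans (∑-const q 1) (*-identityʳ q)) ⟩
    ∑ {q} (λ _ → 1)                                       ≤⟨ ∑-mono bound ⟩
    ∑ (λ c → 𝟙 (c ≟ a) + 𝟙 (c ≟ b))                       ≡⟨ ∑-+ (λ c → 𝟙 (c ≟ a)) (λ c → 𝟙 (c ≟ b)) ⟩
    ∑ (λ c → 𝟙 (c ≟ a)) + ∑ (λ c → 𝟙 (c ≟ b))             ≡⟨ cong₂ _+_ (∑-𝟙≡ a) (∑-𝟙≡ b) ⟩
    2                                                     ∎))
    where
    open ≤-Reasoning
    bound : ∀ c → 1 ≤ 𝟙 (c ≟ a) + 𝟙 (c ≟ b)
    bound c with c ≟ a | c ≟ b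
    ... | yes _ | _      = s≤s z≤n
    ... | no _  | yes _  = s≤s z≤n
    ... | no c≢a | no c≢b = contradiction (c , c≢a , c≢b) ¬∃

  -- A line meeting the support in exactly three points is inspected from a fourth point P of the line.
  no-three-secant : ∀ {m} (ls : Code m) → (∀ P d → ∃ λ z → 7 + planes ls d P z ≤ 3 * q) →
    ∀ R v → ev ls R ≢ 0ᶠ → ∀ {a b} → b ≢ a → col ls R v a ≢ 0ᶠ → col ls R v b ≢ 0ᶠ →
    ¬ (∀ y → y ≢ a → y ≢ b → col ls R v y ≡ 0ᶠ)
  no-three-secant {m} ls light R v R∈S {a} {b} b≢a a∈S b∈S vanish with third-element a b
  ... | c , c≢a , c≢b = <⇒≱ (proj₂ (light P R)) (hankel≢0⇒dense ls P R hankel≢0 (proj₁ (light P R)))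
    where
    P : Vec K m
    P = v ⊕ c ⊙ R
    a-c≢0 : a -ᶠ c ≢ 0ᶠ
    a-c≢0 eq = c≢a (sym (x-y≡0⇒x≡y eq))
    b-c≢0 : b -ᶠ c ≢ 0ᶠ
    b-c≢0 eq = c≢b (sym (x-y≡0⇒x≡y eq))
    -- Projective change of parameter with `P` at infinity: seen from `P`, the point `v ⊕ x ⊙ R` has
    -- parameter `(x -ᶠ c) ⁻¹`, and `R` has parameter 0.
    α = (a -ᶠ c) ⁻¹
    β = (b -ᶠ c) ⁻¹

    col-P : ∀ {t} → t ≢ 0ᶠ → col ls P R t ≡ col ls R v (c +ᶠ t ⁻¹)
    col-P {t} t≢0 = ev-scale ls t≢0 λ e → begin
      dot e (R ⊕ t ⊙ (v ⊕ c ⊙ R))                              ≡⟨ trans (dot-line e R P t) (cong (λ u → dot e R +ᶠ t *ᶠ u) (dot-line e v R c)) ⟩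
      dot e R +ᶠ t *ᶠ (dot e v +ᶠ c *ᶠ dot e R)                ≡⟨ cong (_+ᶠ t *ᶠ (dot e v +ᶠ c *ᶠ dot e R)) (sym (trans (cong (_*ᶠ dot e R) (*-inverseʳ t≢0)) (*ᶠ-identityˡ _))) ⟩
      t *ᶠ t ⁻¹ *ᶠ dot e R +ᶠ t *ᶠ (dot e v +ᶠ c *ᶠ dot e R)   ≡⟨ solve 5 (λ t i r v c → t :* i :* r :+ t :* (v :+ c :* r) := t :* (v :+ (c :+ i) :* r)) refl t (t ⁻¹) (dot e R) (dot e v) c ⟩
      t *ᶠ (dot e v +ᶠ (c +ᶠ t ⁻¹) *ᶠ dot e R)                 ≡⟨ cong (t *ᶠ_) (sym (dot-line e v R (c +ᶠ t ⁻¹))) ⟩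
      t *ᶠ dot e (v ⊕ (c +ᶠ t ⁻¹) ⊙ R)                         ∎
      where open ≡-Reasoning

    parameter-of : ∀ {x} → x -ᶠ c ≢ 0ᶠ → c +ᶠ ((x -ᶠ c) ⁻¹) ⁻¹ ≡ x
    parameter-of {x} ≢0 = trans (cong (c +ᶠ_) (⁻¹-involutive ≢0)) (solve 2 (λ c x → c :+ (x :- c) := x) refl c x)

    of-parameter : ∀ {t x} → t ≢ 0ᶠ → c +ᶠ t ⁻¹ ≡ x → t ≡ (x -ᶠ c) ⁻¹
    of-parameter {t} t≢0 refl = trans (sym (⁻¹-involutive t≢0)) (cong _⁻¹ (solve 2 (λ c i → i := c :+ i :- c) refl c (t ⁻¹)))

    α∈S : col ls P R α ≢ 0ᶠ
    α∈S eq = a∈S (trans (sym (trans (col-P (⁻¹-nonzero a-c≢0)) (cong (col ls R v) (parameter-of a-c≢0)))) eq)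
    β∈S : col ls P R β ≢ 0ᶠ
    β∈S eq = b∈S (trans (sym (trans (col-P (⁻¹-nonzero b-c≢0)) (cong (col ls R v) (parameter-of b-c≢0)))) eq)
    0∈S : col ls P R 0ᶠ ≢ 0ᶠ
    0∈S eq = R∈S (trans (sym (col-0 ls P R)) eq)

    β≢α : β ≢ α
    β≢α eq = b≢a (trans (sym (parameter-of b-c≢0)) (trans (cong (λ u → c +ᶠ u ⁻¹) eq) (parameter-of a-c≢0)))

    vanish-P : ∀ t → t ≢ 0ᶠ → t ≢ α → t ≢ β → col ls P R t ≡ 0ᶠ
    vanish-P t t≢0 t≢α t≢β = trans (col-P t≢0) (vanish _ (λ eq → t≢α (of-parameter t≢0 eq)) (λ eq → t≢β (of-parameter t≢0 eq)))

    moments : ∀ k → mom ls P R k ≡ col ls P R 0ᶠ *ᶠ 0ᶠ ^ᶠ k +ᶠ (col ls P R α *ᶠ α ^ᶠ k +ᶠ col ls P R β *ᶠ β ^ᶠ k)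
    moments k = ∑ᶠ-triple (λ t → col ls P R t *ᶠ t ^ᶠ k) (⁻¹-nonzero a-c≢0) (⁻¹-nonzero b-c≢0) β≢α
      λ t t≢0 t≢α t≢β → trans (cong (_*ᶠ t ^ᶠ k) (vanish-P t t≢0 t≢α t≢β)) (zeroˡ _)

    hankel≢0 : hankel (mom ls P R) ≢ 0ᶠ
    hankel≢0 eq = *-nonzero 0∈S (*-nonzero (*-nonzero α∈S β∈S) (*-nonzero αβ≢0 αβ≢0))
      (trans (sym (trans (hankel-cong moments) (hankel-three (col ls P R 0ᶠ) (col ls P R α) (col ls P R β) α β))) eq)
      where
      αβ≢0 : α *ᶠ β *ᶠ (α -ᶠ β) ≢ 0ᶠ
      αβ≢0 = *-nonzero (*-nonzero (⁻¹-nonzero a-c≢0) (⁻¹-nonzero b-c≢0)) (λ eq → β≢α (sym (x-y≡0⇒x≡y eq)))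

  -- A column over a support point `R` with exactly two points is a three-secant together with `R`.
  -- So all columns with fewer than three points are among the two roots of `disc`, and a nonzero
  -- `disc` would force `3 * q ∸ 6` points into the plane.
  tame : ∀ {m} (ls : Code m) → (∀ P d → ∃ λ z → 7 + planes ls d P z ≤ 3 * q) → Tame ls
  tame ls light = record { disc≡0 = λ R _ → disc-vanishes R ; sparse = λ R _ _ d _ → light R d }
    where
    disc-vanishes : ∀ R → ev ls R ≢ 0ᶠ → ∀ d → disc ls R d ≡ 0ᶠ
    disc-vanishes R R∈S d with disc ls R d ≟ 0ᶠ
    ... | yes eq = eq
    ... | no neq with light R d
    ...   | z , le = contradiction (begin
      3 * q                                                                ≡⟨ *-comm 3 q ⟩
      q * 3                                                                ≡⟨ sym (∑-const q 3) ⟩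
      ∑ {q} (λ _ → 3)                                                      ≤⟨ ∑-mono (λ x → bound (z ⊕ x ⊙ d)) ⟩
      ∑ (λ x → 3 * isz (disc ls R (z ⊕ x ⊙ d)) + height ls R (z ⊕ x ⊙ d))  ≡⟨ ∑-+ (λ x → 3 * isz (disc ls R (z ⊕ x ⊙ d))) (λ x → height ls R (z ⊕ x ⊙ d)) ⟩
      ∑ (λ x → 3 * isz (disc ls R (z ⊕ x ⊙ d))) + planes ls d R z          ≡⟨ cong (_+ planes ls d R z) (∑-* 3 (λ x → isz (disc ls R (z ⊕ x ⊙ d)))) ⟩
      3 * ∑ (λ x → isz (disc ls R (z ⊕ x ⊙ d))) + planes ls d R z          ≤⟨ +-monoˡ-≤ (planes ls d R z) (*-monoʳ-≤ 3 (roots≤degree 2 (Deg-disc ls R z d) neq)) ⟩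
      6 + planes ls d R z                                                  ∎) (<⇒≱ le)
      where
      open ≤-Reasoning
      bound : ∀ v → 3 ≤ 3 * isz (disc ls R v) + height ls R v
      bound v with small? (col ls R v)
      ... | inj₂ 3≤h = ≤-trans 3≤h (m≤n+m _ _)
      ... | inj₁ (none ≡0) = ≤-trans (≤-reflexive (cong (3 *_) (sym (isz-0 (disc≡0-one ls R v {0ᶠ} λ y _ → ≡0 y))))) (m≤m+n _ _)
      ... | inj₁ (one a _ vanish) = ≤-trans (≤-reflexive (cong (3 *_) (sym (isz-0 (disc≡0-one ls R v vanish))))) (m≤m+n _ _)
      ... | inj₁ (two a b b≢a a∈S b∈S vanish) = contradiction vanish (no-three-secant ls light R v R∈S b≢a a∈S b∈S)

  two-hyperplanes-large : ∀ {k} (ls : Code (2 + k)) → nonzeros ls < (3 * q ∸ 6) * q ^ k → Hyp₂ ls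
  two-hyperplanes-large {k} ls few = two-hyperplanes ls (tame ls light) (<-≤-trans (*-monoʳ-< q few) bound)
    where
    open ≤-Reasoning
    7≤3q : 7 ≤ 3 * q
    7≤3q = ≤-trans (m≤m+n 7 11) (*-monoʳ-≤ 3 6≤q)
    light : ∀ P d → ∃ λ z → 7 + planes ls d P z ≤ 3 * q
    light P d with sparse-plane (λ v → nz (ev ls v)) d P (3 * q ∸ 7) (begin-strict
        q * (q * nonzeros ls)                   <⟨ *-monoʳ-< q (*-monoʳ-< q few) ⟩
        q * (q * ((3 * q ∸ 6) * q ^ k))         ≡⟨ S.solve 3 (λ q c t → q S.:* (q S.:* (c S.:* t)) S.:= q S.:* (q S.:* t) S.:* c) refl q (3 * q ∸ 6) (q ^ k) ⟩
        q ^ (2 + k) * (3 * q ∸ 6)               ≡⟨ cong (q ^ (2 + k) *_) (+-∸-assoc 1 7≤3q) ⟩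
        q ^ (2 + k) * suc (3 * q ∸ 7)           ∎)
    ... | z , le = z , ≤-trans (+-monoʳ-≤ 7 le) (≤-reflexive (m+[n∸m]≡n 7≤3q))
    -- In units of `q ^ k` the sides differ by 4: q² + (q - 2)(2q - 2) = q(3q - 6) + 4. Writing q =
    -- 2 + t removes the truncated subtractions.
    bound : q * ((3 * q ∸ 6) * q ^ k) ≤ q ^ (2 + k) + (q ∸ 2) * ((2 * q ∸ 2) * q ^ k)
    bound with m≤n⇒∃[o]m+o≡n (<⇒≤ 2<q)
    ... | t , 2+t≡q = arith t 2+t≡q
      where
      arith : ∀ t → 2 + t ≡ q → q * ((3 * q ∸ 6) * q ^ k) ≤ q ^ (2 + k) + (q ∸ 2) * ((2 * q ∸ 2) * q ^ k)
      arith t eq = begin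
        q * ((3 * q ∸ 6) * q ^ k)                                  ≡⟨ cong (λ c → q * (c * q ^ k)) (sym (*-distribˡ-∸ 3 q 2)) ⟩
        q * (3 * (q ∸ 2) * q ^ k)                                  ≡⟨ cong (λ c → c * (3 * (c ∸ 2) * q ^ k)) (sym eq) ⟩
        (2 + t) * (3 * t * Q)                                      ≤⟨ m≤m+n _ (4 * Q) ⟩
        (2 + t) * (3 * t * Q) + 4 * Q                              ≡⟨ S.solve 2 (λ t Q → (S.con 2 S.:+ t) S.:* (S.con 3 S.:* t S.:* Q) S.:+ S.con 4 S.:* Q
                                                                        S.:= (S.con 2 S.:+ t) S.:* ((S.con 2 S.:+ t) S.:* Q) S.:+ t S.:* (S.con 2 S.:* (S.con 1 S.:+ t) S.:* Q)) refl t Q ⟩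
        (2 + t) * ((2 + t) * Q) + t * (2 * (1 + t) * Q)            ≡⟨ cong (λ c → c * (c * Q) + (c ∸ 2) * (2 * (c ∸ 1) * Q)) eq ⟩
        q ^ (2 + k) + (q ∸ 2) * (2 * (q ∸ 1) * Q)                  ≡⟨ cong (λ c → q ^ (2 + k) + (q ∸ 2) * (c * Q)) (*-distribˡ-∸ 2 q 1) ⟩
        q ^ (2 + k) + (q ∸ 2) * ((2 * q ∸ 2) * q ^ k)              ∎
        where Q = q ^ k

-- Separating the zero vector from the points.

module ProjectiveCounting {q : ℕ} (F : FiniteField q) where
  open FieldTheory F
  open FiniteFunctions F
  open Codewords F
  open Counting F
  open OneHyperplane F
  open PG F using (dot)

  dot-injective : ∀ {m} {v w : Vec K m} → (∀ a → dot a v ≡ dot a w) → v ≡ w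
  dot-injective {v = []}    {[]}    eq = refl
  dot-injective {v = x ∷ v} {y ∷ w} eq = cong₂ _∷_ (trans (sym (head x v)) (trans (eq (1ᶠ ∷ 𝟎)) (head y w)))
    (dot-injective λ a → trans (sym (tail a x v)) (trans (eq (0ᶠ ∷ a)) (tail a y w)))
    where
    head : ∀ x {m} (v : Vec K m) → dot (1ᶠ ∷ 𝟎) (x ∷ v) ≡ x
    head x v = trans (cong₂ _+ᶠ_ (*ᶠ-identityˡ x) (trans (dot-comm 𝟎 v) (dot-𝟎ʳ v))) (+ᶠ-identityʳ x)
    tail : ∀ {m} (a : Vec K m) x v → dot (0ᶠ ∷ a) (x ∷ v) ≡ dot a v
    tail a x v = trans (cong (_+ᶠ dot a v) (zeroˡ x)) (+ᶠ-identityˡ _)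

  δ : ∀ {m} → Vec K m → ℕ
  δ []      = 1
  δ (x ∷ v) = isz x * δ v

  δ-𝟎 : ∀ m → δ (𝟎 {m}) ≡ 1
  δ-𝟎 zero    = refl
  δ-𝟎 (suc m) = cong₂ _*_ (isz-0 {0ᶠ} refl) (δ-𝟎 m)

  δ-≢𝟎 : ∀ {m} {v : Vec K m} → v ≢ 𝟎 → δ v ≡ 0
  δ-≢𝟎 {v = []}    v≢𝟎 = contradiction refl v≢𝟎
  δ-≢𝟎 {v = x ∷ v} v≢𝟎 with x ≟ 0ᶠ
  ... | no _     = refl
  ... | yes refl = trans (+-identityʳ (δ v)) (δ-≢𝟎 {v = v} λ { refl → v≢𝟎 refl })

  ΣV-δ : ∀ m → ΣV {m} δ ≡ 1
  ΣV-δ zero    = refl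
  ΣV-δ (suc m) = trans (∑-cong λ x → trans (ΣV-* (isz x) (δ {m})) (trans (cong (isz x *_) (ΣV-δ m)) (*-identityʳ (isz x)))) (∑-𝟙≡ 0ᶠ)

  -- At `𝟎` a code takes the sum of its multiplicities, which the weight does not see. For q = 4 and
  -- q = 5 the averages are tight, so `𝟎` is masked instead of being absorbed in an estimate.
  off𝟎 : ∀ {m} → (Vec K m → ℕ) → Vec K m → ℕ
  off𝟎 χ v = (1 ∸ δ v) * χ v

  off𝟎-≢𝟎 : ∀ {m} (χ : Vec K m → ℕ) {v} → v ≢ 𝟎 → off𝟎 χ v ≡ χ v
  off𝟎-≢𝟎 χ {v} v≢𝟎 = trans (cong (λ d → (1 ∸ d) * χ v) (δ-≢𝟎 v≢𝟎)) (+-identityʳ (χ v))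

  ScaleInvariant : ∀ {m} → (Vec K m → ℕ) → Set
  ScaleInvariant χ = ∀ {s} → s ≢ 0ᶠ → ∀ v → χ (s ⊙ v) ≡ χ v

  ⊙-𝟎 : ∀ {m} s → s ⊙ 𝟎 {m} ≡ 𝟎
  ⊙-𝟎 s = dot-injective λ a → trans (dot-⊙ʳ a s 𝟎) (trans (cong (s *ᶠ_) (dot-𝟎ʳ a)) (trans (zeroʳ s) (sym (dot-𝟎ʳ a))))

  ⊙-≢𝟎 : ∀ {m s} {v : Vec K m} → s ≢ 0ᶠ → v ≢ 𝟎 → s ⊙ v ≢ 𝟎
  ⊙-≢𝟎 {s = s} {v} s≢0 v≢𝟎 eq = v≢𝟎 (dot-injective λ a →
    trans (*-cancel-0 s≢0 (trans (sym (dot-⊙ʳ a s v)) (trans (cong (dot a) eq) (dot-𝟎ʳ a)))) (sym (dot-𝟎ʳ a)))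

  off𝟎-scale : ∀ {m} (χ : Vec K m → ℕ) → ScaleInvariant χ → ScaleInvariant (off𝟎 χ)
  off𝟎-scale χ inv {s} s≢0 v with ≡-dec _≟_ v 𝟎
  ... | yes refl = cong (off𝟎 χ) (⊙-𝟎 s)
  ... | no v≢𝟎 = trans (off𝟎-≢𝟎 χ (⊙-≢𝟎 s≢0 v≢𝟎)) (trans (inv s≢0 v) (sym (off𝟎-≢𝟎 χ v≢𝟎)))

  nz-ev-scale : ∀ {m} (ls : Code m) → ScaleInvariant (λ v → nz (ev ls v))
  nz-ev-scale ls {s} s≢0 v = cong nz (ev-scale ls s≢0 λ a → dot-⊙ʳ a s v)

  nonzeros≤ : ∀ {m} (ls : Code m) → nonzeros ls ≤ suc (ΣV (off𝟎 (λ v → nz (ev ls v))))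
  nonzeros≤ {m} ls = begin
    nonzeros ls                                 ≤⟨ ΣV-mono bound ⟩
    ΣV (λ v → δ v + off𝟎 χ v)                   ≡⟨ ΣV-+ δ (off𝟎 χ) ⟩
    ΣV {m} δ + ΣV (off𝟎 χ)                      ≡⟨ cong (_+ ΣV (off𝟎 χ)) (ΣV-δ m) ⟩
    suc (ΣV (off𝟎 χ))                           ∎
    where
    open ≤-Reasoning
    χ : Vec K m → ℕ
    χ v = nz (ev ls v)
    bound : ∀ v → χ v ≤ δ v + off𝟎 χ v
    bound v with ≡-dec _≟_ v 𝟎
    ... | yes refl = ≤-trans (nz≤1 (ev ls 𝟎)) (≤-trans (≤-reflexive (sym (δ-𝟎 m))) (m≤m+n (δ (𝟎 {m})) _))
    ... | no v≢𝟎 = ≤-trans (≤-reflexive (sym (off𝟎-≢𝟎 χ v≢𝟎))) (m≤n+m (off𝟎 χ v) (δ v))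

  suc-∑nz : suc (∑ nz) ≡ q
  suc-∑nz = begin
    suc (∑ nz)                      ≡⟨ cong (_+ ∑ nz) (sym (∑-𝟙≡ 0ᶠ)) ⟩
    ∑ isz + ∑ nz                    ≡⟨ +-comm (∑ isz) (∑ nz) ⟩
    ∑ nz + ∑ isz                    ≡⟨ sym (∑-+ nz isz) ⟩
    ∑ (λ x → nz x + isz x)          ≡⟨ ∑-cong nz+isz ⟩
    ∑ {q} (λ _ → 1)                 ≡⟨ trans (∑-const q 1) (*-identityʳ q) ⟩
    q                               ∎
    where open ≡-Reasoning

  ∑nz : ∑ nz ≡ q ∸ 1
  ∑nz = cong (_∸ 1) suc-∑nz

-- q = 4 and q = 5: averages with equality.

module SmallField {q : ℕ} (F : FiniteField q) (r : ℕ)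
  (r≡-1 : FieldTheory.fromℕ F r ≡ FieldTheory.-ᶠ_ F (FieldTheory.1ᶠ F)) (4≤q : 4 ≤ q) where
  open FieldTheory F
  open FiniteFunctions F
  open Codewords F
  open Counting F
  open OneHyperplane F
  open Cones r r≡-1 4≤q
  open Residual r r≡-1 2<q using (1<q)
  open TwoHyperplanes F r r≡-1 4≤q
  open ProjectiveCounting F
  open PG F using (dot)
  open Solver using (solve; _:=_; _:+_; _:*_; :-_; _:-_; con)

  module _ {k} (ls : Code (2 + k)) (few : ΣV (off𝟎 (λ v → nz (ev ls v))) ≤ (2 * q ∸ 2) * q ^ k) where
    private
      χ χ* : Vec K (2 + k) → ℕ
      χ v = nz (ev ls v)
      χ* = off𝟎 χ

      2≤q-1 : 2 ≤ q ∸ 1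
      2≤q-1 = m+n≤o⇒n≤o∸m 1 2<q

    module _ (R : Vec K (2 + k)) (R≢𝟎 : R ≢ 𝟎) (R∈S : ev ls R ≢ 0ᶠ) (d : Vec K (2 + k)) (2≤height : 2 ≤ height ls R d) where
      private
        χ*-multiple : ∀ {s} → s ≢ 0ᶠ → ∀ {v} → (∀ a → dot a v ≡ s *ᶠ dot a R) → χ* v ≡ 1
        χ*-multiple {s} s≢0 {v} eq = trans
          (off𝟎-≢𝟎 χ λ { refl → R≢𝟎 (dot-injective λ a → trans (*-cancel-0 s≢0 (trans (sym (eq a)) (dot-𝟎ʳ a))) (sym (dot-𝟎ʳ a))) })
          (nz-≢0 λ ev≡0 → R∈S (trans (sym (ev-scale ls s≢0 eq)) ev≡0))

        -- A column through `𝟎` consists of the multiples of `R`, and all `q ∸ 1` nonzero ones lie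
        -- in the support.
        column-d : 2 ≤ column χ* R d
        column-d with any? (λ y → ≡-dec _≟_ (d ⊕ y ⊙ R) 𝟎)
        ... | no ¬∃ = ≤-trans 2≤height (≤-reflexive (∑-cong λ y → sym (off𝟎-≢𝟎 χ λ eq → ¬∃ (y , eq))))
        ... | yes (y₀ , eq) = begin
          2                                   ≤⟨ 2≤q-1 ⟩
          q ∸ 1                               ≡⟨ sym ∑nz ⟩
          ∑ nz                                ≡⟨ sym (∑-translate nz (-ᶠ y₀)) ⟩
          ∑ (λ y → nz (y -ᶠ y₀))              ≤⟨ ∑-mono bound ⟩
          column χ* R d                       ∎
          where
          open ≤-Reasoning
          on-R : ∀ y a → dot a (d ⊕ y ⊙ R) ≡ (y -ᶠ y₀) *ᶠ dot a R
          on-R y a = trans (dot-line a d R y) (trans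
            (solve 4 (λ d y y₀ r → d :+ y :* r := d :+ y₀ :* r :+ (y :- y₀) :* r) refl (dot a d) y y₀ (dot a R))
            (trans (cong (_+ᶠ (y -ᶠ y₀) *ᶠ dot a R) (trans (sym (dot-line a d R y₀)) (trans (cong (dot a) eq) (dot-𝟎ʳ a)))) (+ᶠ-identityˡ _)))
          bound : ∀ y → nz (y -ᶠ y₀) ≤ χ* (d ⊕ y ⊙ R)
          bound y with (y -ᶠ y₀) ≟ 0ᶠ
          ... | yes _ = z≤n
          ... | no ≢0 = ≤-reflexive (sym (χ*-multiple ≢0 (on-R y)))

        -- Scaling by a nonzero `x` carries the column of `d` to this one; for x = 0 it is the line
        -- spanned by `R`.
        column-x : ∀ x → 2 * nz x + (q ∸ 1) * isz x ≤ column χ* R (𝟎 ⊕ x ⊙ d)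
        column-x x with x ≟ 0ᶠ
        ... | no x≢0 = begin
          2 + (q ∸ 1) * 0                                        ≡⟨ cong (2 +_) (*-zeroʳ (q ∸ 1)) ⟩
          2                                                      ≤⟨ column-d ⟩
          ∑ (λ y → χ* (d ⊕ y ⊙ R))                               ≡⟨ ∑-cong (λ y → sym (trans (cong χ* (factor y)) (off𝟎-scale χ (nz-ev-scale ls) x≢0 (d ⊕ y ⊙ R)))) ⟩
          ∑ (λ y → χ* (𝟎 ⊕ x ⊙ d ⊕ (x *ᶠ y) ⊙ R))                ≡⟨ ∑-scale (λ y → χ* (𝟎 ⊕ x ⊙ d ⊕ y ⊙ R)) x≢0 ⟩
          column χ* R (𝟎 ⊕ x ⊙ d)                                ∎
          where
          open ≤-Reasoning
          factor : ∀ y → 𝟎 ⊕ x ⊙ d ⊕ (x *ᶠ y) ⊙ R ≡ x ⊙ (d ⊕ y ⊙ R)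
          factor y = dot-injective λ a → trans (dot-line a _ R (x *ᶠ y)) (trans (cong₂ _+ᶠ_ (trans (dot-line a 𝟎 d x) (cong (_+ᶠ x *ᶠ dot a d) (dot-𝟎ʳ a))) refl)
            (trans (solve 4 (λ x y d r → con (pos 0) :+ x :* d :+ x :* y :* r := x :* (d :+ y :* r)) refl x y (dot a d) (dot a R))
              (sym (trans (dot-⊙ʳ a x _) (cong (x *ᶠ_) (dot-line a d R y))))))
        ... | yes refl = begin
          (q ∸ 1) * 1                                            ≡⟨ *-identityʳ (q ∸ 1) ⟩
          q ∸ 1                                                  ≡⟨ sym ∑nz ⟩
          ∑ nz                                                   ≤⟨ ∑-mono bound ⟩
          column χ* R (𝟎 ⊕ 0ᶠ ⊙ d)                               ∎
          where
          open ≤-Reasoning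
          bound : ∀ y → nz y ≤ χ* (𝟎 ⊕ 0ᶠ ⊙ d ⊕ y ⊙ R)
          bound y with y ≟ 0ᶠ
          ... | yes _ = z≤n
          ... | no y≢0 = ≤-reflexive (sym (χ*-multiple y≢0 λ a → trans (dot-line a _ R y)
            (trans (cong₂ _+ᶠ_ (trans (dot-line a 𝟎 d 0ᶠ) (trans (cong₂ _+ᶠ_ (dot-𝟎ʳ a) (zeroˡ _)) (+ᶠ-identityʳ _))) refl) (+ᶠ-identityˡ _))))

        plane-𝟎 : 3 * (q ∸ 1) ≤ plane χ* d R 𝟎
        plane-𝟎 = begin
          3 * (q ∸ 1)                                            ≡⟨ S.solve 1 (λ c → S.con 3 S.:* c S.:= S.con 2 S.:* c S.:+ c S.:* S.con 1) refl (q ∸ 1) ⟩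
          2 * (q ∸ 1) + (q ∸ 1) * 1                              ≡⟨ cong₂ (λ a b → 2 * a + (q ∸ 1) * b) (sym ∑nz) (sym (∑-𝟙≡ 0ᶠ)) ⟩
          2 * ∑ nz + (q ∸ 1) * ∑ isz                             ≡⟨ cong₂ _+_ (sym (∑-* 2 nz)) (sym (∑-* (q ∸ 1) isz)) ⟩
          ∑ (λ x → 2 * nz x) + ∑ (λ x → (q ∸ 1) * isz x)         ≡⟨ sym (∑-+ (λ x → 2 * nz x) (λ x → (q ∸ 1) * isz x)) ⟩
          ∑ (λ x → 2 * nz x + (q ∸ 1) * isz x)                   ≤⟨ ∑-mono column-x ⟩
          plane χ* d R 𝟎                                         ∎
          where open ≤-Reasoning

        plane-through-𝟎 : ∀ z x₀ y₀ → z ⊕ x₀ ⊙ d ⊕ y₀ ⊙ R ≡ 𝟎 → plane χ* d R z ≡ plane χ* d R 𝟎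
        plane-through-𝟎 z x₀ y₀ eq = begin
          ∑ (λ x → ∑ (λ y → χ* (z ⊕ x ⊙ d ⊕ y ⊙ R)))                                 ≡⟨ ∑-cong (λ x → ∑-cong λ y → cong χ* (shift x y)) ⟩
          ∑ (λ x → ∑ (λ y → χ* (𝟎 ⊕ (x -ᶠ x₀) ⊙ d ⊕ (y -ᶠ y₀) ⊙ R)))                 ≡⟨ ∑-cong (λ x → ∑-translate (λ y → χ* (𝟎 ⊕ (x -ᶠ x₀) ⊙ d ⊕ y ⊙ R)) (-ᶠ y₀)) ⟩
          ∑ (λ x → column χ* R (𝟎 ⊕ (x -ᶠ x₀) ⊙ d))                                  ≡⟨ ∑-translate (λ x → column χ* R (𝟎 ⊕ x ⊙ d)) (-ᶠ x₀) ⟩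
          plane χ* d R 𝟎                                                             ∎
          where
          open ≡-Reasoning
          expand : ∀ a z x y → dot a (z ⊕ x ⊙ d ⊕ y ⊙ R) ≡ dot a z +ᶠ x *ᶠ dot a d +ᶠ y *ᶠ dot a R
          expand a z x y = trans (dot-line a (z ⊕ x ⊙ d) R y) (cong (_+ᶠ y *ᶠ dot a R) (dot-line a z d x))
          shift : ∀ x y → z ⊕ x ⊙ d ⊕ y ⊙ R ≡ 𝟎 ⊕ (x -ᶠ x₀) ⊙ d ⊕ (y -ᶠ y₀) ⊙ R
          shift x y = dot-injective λ a → trans (expand a z x y) (trans
            (solve 7 (λ z x x₀ y y₀ d r → z :+ x :* d :+ y :* r := z :+ x₀ :* d :+ y₀ :* r :+ (x :- x₀) :* d :+ (y :- y₀) :* r) refl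
              (dot a z) x x₀ y y₀ (dot a d) (dot a R))
            (trans (cong (λ u → u +ᶠ (x -ᶠ x₀) *ᶠ dot a d +ᶠ (y -ᶠ y₀) *ᶠ dot a R) (trans (sym (expand a z x₀ y₀)) (cong (dot a) eq)))
              (sym (expand a 𝟎 (x -ᶠ x₀) (y -ᶠ y₀)))))

        3[q-1]>2q-3 : 2 * q ∸ 3 < 3 * (q ∸ 1)
        3[q-1]>2q-3 = begin-strict
          2 * q ∸ 3         <⟨ ∸-monoʳ-< (s≤s (s≤s (s≤s z≤n))) (≤-trans (<⇒≤ 3<q) (m≤m+n q _)) ⟩
          2 * q ∸ 2         ≡⟨ sym (*-distribˡ-∸ 2 q 1) ⟩
          2 * (q ∸ 1)       ≤⟨ *-monoˡ-≤ (q ∸ 1) (n≤1+n 2) ⟩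
          3 * (q ∸ 1)       ∎
          where open ≤-Reasoning

        2q-2 : suc (2 * q ∸ 3) ≡ 2 * q ∸ 2
        2q-2 = sym (+-∸-assoc 1 {2 * q} {3} (≤-trans (<⇒≤ 3<q) (m≤m+n q _)))

        -- The summand `δ z` records the excess of the plane based at `𝟎`; it makes the lower bound
        -- for the sum over all `z` strictly larger than the total allowed by `few`.
        light* : (∀ z → ¬ (plane χ* d R z ≤ 2 * q ∸ 3)) → ⊥
        light* heavy = <⇒≱ (begin-strict
          q * (q * ΣV χ*)                                        ≤⟨ *-monoʳ-≤ q (*-monoʳ-≤ q few) ⟩
          q * (q * ((2 * q ∸ 2) * q ^ k))                        ≡⟨ S.solve 3 (λ q c t → q S.:* (q S.:* (c S.:* t)) S.:= q S.:* (q S.:* t) S.:* c) refl q (2 * q ∸ 2) (q ^ k) ⟩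
          q ^ (2 + k) * (2 * q ∸ 2)                              <⟨ m<m+n _ (s≤s z≤n) ⟩
          q ^ (2 + k) * (2 * q ∸ 2) + 1                          ≡⟨ cong₂ _+_ (sym (ΣV-const (2 + k) (2 * q ∸ 2))) (sym (ΣV-δ (2 + k))) ⟩
          ΣV {2 + k} (λ _ → 2 * q ∸ 2) + ΣV {2 + k} δ            ≡⟨ sym (ΣV-+ {2 + k} (λ _ → 2 * q ∸ 2) δ) ⟩
          ΣV {2 + k} (λ z → 2 * q ∸ 2 + δ z)                             ∎)
          (begin
          ΣV {2 + k} (λ z → 2 * q ∸ 2 + δ z)                             ≤⟨ ΣV-mono bound ⟩
          ΣV (plane χ* d R)                                      ≡⟨ ΣV-plane χ* d R ⟩
          q * (q * ΣV χ*)                                        ∎)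
          where
          open ≤-Reasoning
          bound : ∀ z → 2 * q ∸ 2 + δ z ≤ plane χ* d R z
          bound z with ≡-dec _≟_ z 𝟎
          ... | no z≢𝟎 = ≤-trans (≤-reflexive (trans (cong (2 * q ∸ 2 +_) (δ-≢𝟎 z≢𝟎)) (trans (+-identityʳ _) (sym 2q-2)))) (≰⇒> (heavy z))
          ... | yes refl = ≤-trans (begin
            2 * q ∸ 2 + δ (𝟎 {2 + k})         ≡⟨ cong₂ _+_ (sym (*-distribˡ-∸ 2 q 1)) (δ-𝟎 (2 + k)) ⟩
            2 * (q ∸ 1) + 1                   ≤⟨ +-monoʳ-≤ (2 * (q ∸ 1)) (≤-trans (s≤s z≤n) 2≤q-1) ⟩
            2 * (q ∸ 1) + (q ∸ 1)             ≡⟨ +-comm (2 * (q ∸ 1)) (q ∸ 1) ⟩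
            3 * (q ∸ 1)                       ∎) plane-𝟎

      -- The average is at most `2 * q ∸ 2`, one too many to contradict `disc≢0⇒dense`. The plane
      -- through `𝟎` has at least `3 * (q ∸ 1)` points, so some plane lies strictly below the bound;
      -- it avoids `𝟎`, and there the masked count is the full one.
      light : ∃ λ z → planes ls d R z ≤ 2 * q ∸ 3
      light with anyV? (λ z → plane χ* d R z ≤? 2 * q ∸ 3)
      ... | no ¬∃ = ⊥-elim (light* λ z le → ¬∃ (z , le))
      ... | yes (z , le) with any? (λ x → any? (λ y → ≡-dec _≟_ (z ⊕ x ⊙ d ⊕ y ⊙ R) 𝟎))
      ...   | yes (x₀ , y₀ , eq) = contradiction (≤-trans plane-𝟎 (≤-trans (≤-reflexive (sym (plane-through-𝟎 z x₀ y₀ eq))) le)) (<⇒≱ 3[q-1]>2q-3)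
      ...   | no ¬∃ = z , ≤-trans (≤-reflexive (∑-cong λ x → ∑-cong λ y → sym (off𝟎-≢𝟎 χ λ eq → ¬∃ (x , y , eq)))) le

    tame : Tame ls
    tame = record { disc≡0 = disc-vanishes ; sparse = λ R R≢𝟎 R∈S d 3≤h → sparse R R≢𝟎 R∈S d (≤-trans (n≤1+n 2) 3≤h) }
      where
      open ≤-Reasoning
      2q-3 : 3 + (2 * q ∸ 3) ≡ 2 * q
      2q-3 = m+[n∸m]≡n (≤-trans (<⇒≤ 3<q) (m≤m+n q _))
      sparse : ∀ R → R ≢ 𝟎 → ev ls R ≢ 0ᶠ → ∀ d → 2 ≤ height ls R d → ∃ λ z → 7 + planes ls d R z ≤ 3 * q
      sparse R R≢𝟎 R∈S d 2≤h with light R R≢𝟎 R∈S d 2≤h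
      ... | z , le = z , (begin
        7 + planes ls d R z         ≤⟨ +-monoʳ-≤ 7 le ⟩
        4 + (3 + (2 * q ∸ 3))       ≡⟨ cong (4 +_) 2q-3 ⟩
        4 + 2 * q                   ≤⟨ +-monoˡ-≤ (2 * q) 4≤q ⟩
        q + 2 * q                   ∎)
      disc-vanishes : ∀ R → R ≢ 𝟎 → ev ls R ≢ 0ᶠ → ∀ d → disc ls R d ≡ 0ᶠ
      disc-vanishes R R≢𝟎 R∈S d with disc ls R d ≟ 0ᶠ
      ... | yes eq = eq
      ... | no neq with light R R≢𝟎 R∈S d 2≤h
        -- With fewer than two points in the column of `d`, `disc` would vanish already, so `light`
        -- applies.
        where
        2≤h : 2 ≤ height ls R d
        2≤h with small? (col ls R d)
        ... | inj₂ 3≤h = ≤-trans (n≤1+n 2) 3≤h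
        ... | inj₁ (none ≡0) = contradiction (disc≡0-one ls R d {0ᶠ} λ y _ → ≡0 y) neq
        ... | inj₁ (one a _ vanish) = contradiction (disc≡0-one ls R d vanish) neq
        ... | inj₁ (two a b b≢a a∈S b∈S _) = supp-two (col ls R d) b≢a a∈S b∈S
      ...   | z , le = contradiction (≤-trans (disc≢0⇒dense ls R d neq z) (+-monoʳ-≤ 2 le)) (<⇒≱ (≤-reflexive 2q-3))

  -- The vector `𝟎` may add one to `nonzeros`. In dimension at least 3 the factor `Q` is at least
  -- `q`, and the slack `t * t * Q` absorbs this.
  two-hyperplanes-small : ∀ {k} (ls : Code (3 + k)) → ΣV (off𝟎 (λ v → nz (ev ls v))) ≤ (2 * q ∸ 2) * q ^ suc k → Hyp₂ ls
  two-hyperplanes-small {k} ls few = two-hyperplanes ls (tame ls few) (begin-strict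
    q * nonzeros ls                                                  ≤⟨ *-monoʳ-≤ q (≤-trans (nonzeros≤ ls) (s≤s few)) ⟩
    q * suc ((2 * q ∸ 2) * Q)                                        <⟨ bound (q ∸ 2) (m+[n∸m]≡n (<⇒≤ 2<q)) (m+n≤o⇒n≤o∸m 2 4≤q) ⟩
    q ^ (3 + k) + (q ∸ 2) * ((2 * q ∸ 2) * Q)                        ∎)
    where
    open ≤-Reasoning
    Q = q ^ suc k
    bound : ∀ t → 2 + t ≡ q → 2 ≤ t → q * suc ((2 * q ∸ 2) * Q) < q ^ (3 + k) + t * ((2 * q ∸ 2) * Q)
    bound t eq 2≤t = begin-strict
      q * suc ((2 * q ∸ 2) * Q)                                      ≡⟨ cong₂ (λ c e → c * suc (e * Q)) (sym eq) 2q-2≡ ⟩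
      (2 + t) * suc (2 * (1 + t) * Q)                                ≡⟨ S.solve 2 (λ t Q → (S.con 2 S.:+ t) S.:* (S.con 1 S.:+ S.con 2 S.:* (S.con 1 S.:+ t) S.:* Q)
                                                                          S.:= (S.con 2 S.:+ t) S.:+ (S.con 4 S.:+ S.con 4 S.:* t) S.:* Q S.:+ t S.:* (S.con 2 S.:* (S.con 1 S.:+ t) S.:* Q)) refl t Q ⟩
      (2 + t) + (4 + 4 * t) * Q + t * (2 * (1 + t) * Q)              <⟨ +-monoˡ-< (t * (2 * (1 + t) * Q)) (+-monoˡ-< ((4 + 4 * t) * Q) small) ⟩
      t * t * Q + (4 + 4 * t) * Q + t * (2 * (1 + t) * Q)            ≡⟨ S.solve 2 (λ t Q → t S.:* t S.:* Q S.:+ (S.con 4 S.:+ S.con 4 S.:* t) S.:* Q S.:+ t S.:* (S.con 2 S.:* (S.con 1 S.:+ t) S.:* Q)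
                                                                          S.:= (S.con 2 S.:+ t) S.:* ((S.con 2 S.:+ t) S.:* Q) S.:+ t S.:* (S.con 2 S.:* (S.con 1 S.:+ t) S.:* Q)) refl t Q ⟩
      (2 + t) * ((2 + t) * Q) + t * (2 * (1 + t) * Q)                ≡⟨ cong₂ (λ c e → c * (c * Q) + t * (e * Q)) eq (sym 2q-2≡) ⟩
      q ^ (3 + k) + t * ((2 * q ∸ 2) * Q)                            ∎
      where
      2q-2≡ : 2 * q ∸ 2 ≡ 2 * (1 + t)
      2q-2≡ = trans (sym (*-distribˡ-∸ 2 q 1)) (cong (λ c → 2 * (c ∸ 1)) (sym eq))
      small : 2 + t < t * t * Q
      small = begin-strict
        2 + t                  <⟨ m<m+n (2 + t) (<-trans (s≤s z≤n) 1<q) ⟩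
        2 + t + q              ≡⟨ cong (_+ q) eq ⟩
        q + q                  ≡⟨ cong (q +_) (sym (+-identityʳ q)) ⟩
        2 * q                  ≤⟨ *-mono-≤ (≤-trans (n≤1+n 2) (≤-trans (n≤1+n 3) (*-mono-≤ 2≤t 2≤t))) (m≤m*n q (q ^ k) {{m^n≢0 q k}}) ⟩
        t * t * Q              ∎

-- List counts and Boolean tests.

toBit : Bool → ℕ
toBit b = if b then 1 else 0

count : ∀ {A : Set} → (A → Bool) → List A → ℕ
count P xs = length (filterᵇ P xs)

count-∷ : ∀ {A : Set} (P : A → Bool) x xs → count P (x ∷ xs) ≡ toBit (P x) + count P xs
count-∷ P x xs with P x
... | true  = refl
... | false = refl

count-++ : ∀ {A : Set} (P : A → Bool) xs ys → count P (xs ++ ys) ≡ count P xs + count P ys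
count-++ P []       ys = refl
count-++ P (x ∷ xs) ys = trans (count-∷ P x (xs ++ ys)) (trans (cong (toBit (P x) +_) (count-++ P xs ys))
  (trans (sym (+-assoc (toBit (P x)) (count P xs) (count P ys))) (cong (_+ count P ys) (sym (count-∷ P x xs)))))

count-map : ∀ {A B : Set} (P : B → Bool) (f : A → B) xs → count P (mapᴸ f xs) ≡ count (P ∘ f) xs
count-map P f []       = refl
count-map P f (x ∷ xs) = trans (count-∷ P (f x) (mapᴸ f xs)) (trans (cong (toBit (P (f x)) +_) (count-map P f xs)) (sym (count-∷ (P ∘ f) x xs)))

count-allFinL : ∀ {A : Set} (P : A → Bool) n (g : Fin n → List A) → count P (concatMap g (allFinL n)) ≡ ∑ (λ i → count P (g i))
count-allFinL P zero    g = refl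
count-allFinL P (suc n) g = trans (count-++ P (g zero) (concatMap g (mapᴸ suc (allFinL n))))
  (cong (count P (g zero) +_) (trans (cong (count P ∘ concat) (sym (mapᴸ-∘ (allFinL n)))) (count-allFinL P n (g ∘ suc))))

T⇒≡true : ∀ {b} → T b → b ≡ true
T⇒≡true {true} _ = refl

≡true⇒T : ∀ {b} → b ≡ true → T b
≡true⇒T refl = tt

≡ᵇ-false : ∀ {m n} → m ≢ n → (m ≡ᵇ n) ≡ false
≡ᵇ-false {m} {n} m≢n with m ≡ᵇ n in eq
... | false = refl
... | true  = contradiction (≡ᵇ⇒≡ m n (≡true⇒T eq)) m≢n

==F-true : ∀ {q} {a b : Fin q} → a ≡ b → (a ==F b) ≡ true
==F-true {a = a} refl = T⇒≡true (≡⇒≡ᵇ (toℕ a) (toℕ a) refl)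

==F-false : ∀ {q} {a b : Fin q} → a ≢ b → (a ==F b) ≡ false
==F-false a≢b = ≡ᵇ-false λ eq → a≢b (toℕ-injective eq)

==F⇒≡ : ∀ {q} {a b : Fin q} → (a ==F b) ≡ true → a ≡ b
==F⇒≡ {a = a} {b} eq = toℕ-injective (≡ᵇ⇒≡ (toℕ a) (toℕ b) (≡true⇒T eq))

∧-true : ∀ {a b} → a ∧ b ≡ true → a ≡ true × b ≡ true
∧-true {true} {true} refl = refl , refl

-- From weights of words to nonzeros, and from the prime field into `K`.

module Weights {q : ℕ} (F : FiniteField q) where
  open FieldTheory F
  open FiniteFunctions F
  open Codewords F
  open Counting F
  open OneHyperplane F
  open ProjectiveCounting F
  open PG F

  count-allVecs : ∀ m (P : Vec K m → Bool) → count P (allVecs q m) ≡ ΣV (toBit ∘ P)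
  count-allVecs zero    P = trans (count-∷ P [] []) (+-identityʳ _)
  count-allVecs (suc m) P = trans (count-allFinL P q (λ x → mapᴸ (x ∷_) (allVecs q m)))
    (∑-cong λ x → trans (count-map P (x ∷_) (allVecs q m)) (count-allVecs m (λ v → P (x ∷ v))))

  onPoints : ∀ {m} → (Vec K m → ℕ) → Vec K m → ℕ
  onPoints χ v = toBit (isPoint v) * χ v

  -- Every nonzero vector is a unique nonzero multiple of a normalised one.
  ΣV-points : ∀ m (χ : Vec K m → ℕ) → ScaleInvariant χ → ΣV (off𝟎 χ) ≡ (q ∸ 1) * ΣV (onPoints χ)
  ΣV-points zero    χ inv = sym (*-zeroʳ (q ∸ 1))
  ΣV-points (suc m) χ inv = begin
    ∑ (λ x → ΣV (λ v → off𝟎 χ (x ∷ v)))                          ≡⟨ ∑-cong left ⟩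
    ∑ (λ x → T₁ * nz x + (q ∸ 1) * T₀ * isz x)                   ≡⟨ ∑-+ (λ x → T₁ * nz x) (λ x → (q ∸ 1) * T₀ * isz x) ⟩
    ∑ (λ x → T₁ * nz x) + ∑ (λ x → (q ∸ 1) * T₀ * isz x)         ≡⟨ cong₂ _+_ (trans (∑-* T₁ nz) (cong (T₁ *_) ∑nz)) (trans (∑-* ((q ∸ 1) * T₀) isz) (cong ((q ∸ 1) * T₀ *_) (∑-𝟙≡ 0ᶠ))) ⟩
    T₁ * (q ∸ 1) + (q ∸ 1) * T₀ * 1                              ≡⟨ S.solve 3 (λ t c s → t S.:* c S.:+ c S.:* s S.:* S.con 1 S.:= c S.:* (t S.:* S.con 1 S.:+ s S.:* S.con 1)) refl T₁ (q ∸ 1) T₀ ⟩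
    (q ∸ 1) * (T₁ * 1 + T₀ * 1)                                  ≡⟨ cong ((q ∸ 1) *_) (sym (cong₂ _+_ (trans (∑-* T₁ (λ x → 𝟙 (x ≟ 1ᶠ))) (cong (T₁ *_) (∑-𝟙≡ 1ᶠ))) (trans (∑-* T₀ isz) (cong (T₀ *_) (∑-𝟙≡ 0ᶠ))))) ⟩
    (q ∸ 1) * (∑ (λ x → T₁ * 𝟙 (x ≟ 1ᶠ)) + ∑ (λ x → T₀ * isz x)) ≡⟨ cong ((q ∸ 1) *_) (sym (∑-+ (λ x → T₁ * 𝟙 (x ≟ 1ᶠ)) (λ x → T₀ * isz x))) ⟩
    (q ∸ 1) * ∑ (λ x → T₁ * 𝟙 (x ≟ 1ᶠ) + T₀ * isz x)             ≡⟨ cong ((q ∸ 1) *_) (∑-cong (λ x → sym (right x))) ⟩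
    (q ∸ 1) * ∑ (λ x → ΣV (λ v → onPoints χ (x ∷ v)))            ∎
    where
    open ≡-Reasoning
    χ₀ : Vec K m → ℕ
    χ₀ v = χ (0ᶠ ∷ v)
    -- By scaling, each of the `q ∸ 1` nonzero first coordinates contributes as much as the
    -- normalised one; the first coordinate 0 is left to the induction.
    T₁ = ΣV (λ v → χ (1ᶠ ∷ v))
    T₀ = ΣV (onPoints χ₀)
    inv₀ : ScaleInvariant χ₀
    inv₀ {s} s≢0 v = trans (cong (λ z → χ (z ∷ s ⊙ v)) (sym (zeroʳ s))) (inv s≢0 (0ᶠ ∷ v))
    left : ∀ x → ΣV (λ v → off𝟎 χ (x ∷ v)) ≡ T₁ * nz x + (q ∸ 1) * T₀ * isz x
    left x with x ≟ 0ᶠ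
    ... | yes refl = begin
      ΣV (λ v → (1 ∸ (δ v + 0)) * χ₀ v)                  ≡⟨ ΣV-cong (λ v → cong (λ d → (1 ∸ d) * χ₀ v) (+-identityʳ (δ v))) ⟩
      ΣV (off𝟎 χ₀)                                       ≡⟨ ΣV-points m χ₀ inv₀ ⟩
      (q ∸ 1) * T₀                                       ≡⟨ sym (trans (cong₂ _+_ (*-zeroʳ T₁) (*-identityʳ _)) refl) ⟩
      T₁ * 0 + (q ∸ 1) * T₀ * 1                          ∎
    ... | no x≢0 = begin
      ΣV (λ v → χ (x ∷ v) + 0)                           ≡⟨ ΣV-cong (λ v → +-identityʳ (χ (x ∷ v))) ⟩
      ΣV (λ v → χ (x ∷ v))                               ≡⟨ sym (ΣV-scale (λ v → χ (x ∷ v)) x≢0) ⟩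
      ΣV (λ v → χ (x ∷ x ⊙ v))                           ≡⟨ ΣV-cong (λ v → trans (cong (λ z → χ (z ∷ x ⊙ v)) (sym (*ᶠ-identityʳ x))) (inv x≢0 (1ᶠ ∷ v))) ⟩
      T₁                                                 ≡⟨ sym (trans (cong₂ _+_ (*-identityʳ T₁) (*-zeroʳ ((q ∸ 1) * T₀))) (+-identityʳ T₁)) ⟩
      T₁ * 1 + (q ∸ 1) * T₀ * 0                          ∎
    ΣV-0 : ΣV {m} (λ _ → 0) ≡ 0
    ΣV-0 = trans (ΣV-const m 0) (*-zeroʳ (q ^ m))
    right : ∀ x → ΣV (λ v → onPoints χ (x ∷ v)) ≡ T₁ * 𝟙 (x ≟ 1ᶠ) + T₀ * isz x
    right x with x ≟ 1ᶠ
    ... | yes refl = trans (ΣV-cong λ v → trans (cong (λ b → toBit (b ∨ ((1ᶠ ==F 0ᶠ) ∧ isPoint v)) * χ (1ᶠ ∷ v)) (==F-true {a = 1ᶠ} refl)) (+-identityʳ _))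
          (sym (trans (cong₂ _+_ (*-identityʳ T₁) (trans (cong (T₀ *_) (𝟙-no (1ᶠ ≟ 0ᶠ) (λ eq → 0≢1 (sym eq)))) (*-zeroʳ T₀))) (+-identityʳ T₁)))
    ... | no x≢1 with x ≟ 0ᶠ
    ...   | yes refl = trans (ΣV-cong λ v → cong₂ (λ b c → toBit (b ∨ (c ∧ isPoint v)) * χ₀ v) (==F-false x≢1) (==F-true {a = 0ᶠ} refl))
            (sym (cong₂ _+_ (*-zeroʳ T₁) (*-identityʳ T₀)))
    ...   | no x≢0 = trans (ΣV-cong λ v → cong₂ (λ b c → toBit (b ∨ (c ∧ isPoint v)) * χ (x ∷ v)) (==F-false x≢1) (==F-false x≢0))
            (trans ΣV-0 (sym (cong₂ _+_ (*-zeroʳ T₁) (*-zeroʳ T₀))))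

  isZeroVec⇒dot≡0 : ∀ {m} (a v : Vec K m) → isZeroVec a ≡ true → dot a v ≡ 0ᶠ
  isZeroVec⇒dot≡0 []      []      _  = refl
  isZeroVec⇒dot≡0 (a ∷ as) (v ∷ vs) eq with ∧-true {a ==F 0ᶠ} eq
  ... | a≡0 , as≡0 = trans (cong₂ _+ᶠ_ (trans (cong (_*ᶠ v) (==F⇒≡ a≡0)) (zeroˡ v)) (isZeroVec⇒dot≡0 as vs as≡0)) (+ᶠ-identityˡ 0ᶠ)

  Nonzero⇒¬isZeroVec : ∀ {m} (a : Vec K m) → Nonzero a → isZeroVec a ≡ false
  Nonzero⇒¬isZeroVec a (v , av≢0) with isZeroVec a in eq
  ... | false = refl
  ... | true  = contradiction (isZeroVec⇒dot≡0 a v eq) av≢0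

  module Characteristic (p : ℕ) .{{p≢0 : NonZero p}} (p-prime : Prime p) (p·1≡0 : fromℕ p ≡ 0ᶠ) where

    fromℕ-mod : ∀ n → fromℕ (toℕ (n mod p)) ≡ fromℕ n
    fromℕ-mod n = begin
      fromℕ (toℕ (n mod p))                            ≡⟨ cong fromℕ (toℕ-fromℕ< (m%n<n n p)) ⟩
      fromℕ (n % p)                                    ≡⟨ sym (trans (cong (fromℕ (n % p) +ᶠ_) (trans (cong (fromℕ (n / p) *ᶠ_) p·1≡0) (zeroʳ _))) (+ᶠ-identityʳ _)) ⟩
      fromℕ (n % p) +ᶠ fromℕ (n / p) *ᶠ fromℕ p        ≡⟨ cong (fromℕ (n % p) +ᶠ_) (sym (×1-homo-* (n / p) p)) ⟩
      fromℕ (n % p) +ᶠ fromℕ (n / p * p)               ≡⟨ sym (×-homo-+ 1ᶠ (n % p) (n / p * p)) ⟩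
      fromℕ (n % p + n / p * p)                        ≡⟨ cong fromℕ (sym (m≡m%n+[m/n]*n n p)) ⟩
      fromℕ n                                          ∎
      where open ≡-Reasoning

    fromℕ-multiple : ∀ x {n} → fromℕ n ≡ 0ᶠ → fromℕ (x * n) ≡ 0ᶠ
    fromℕ-multiple x {n} eq = trans (×1-homo-* x n) (trans (cong (fromℕ x *ᶠ_) eq) (zeroʳ _))

    1+multiple≢multiple : ∀ x y {m n} → fromℕ m ≡ 0ᶠ → fromℕ n ≡ 0ᶠ → 1 + y * n ≢ x * m
    1+multiple≢multiple x y m·1≡0 n·1≡0 eq = 0≢1 (trans (sym (fromℕ-multiple x m·1≡0))
      (trans (cong fromℕ (sym eq)) (trans (cong (1ᶠ +ᶠ_) (fromℕ-multiple y n·1≡0)) (+ᶠ-identityʳ 1ᶠ))))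

    -- By Bézout, 1 is a difference of multiples of the coprime `n` and `p`; if both were zero in
    -- `K`, so would `1ᶠ` be.
    fromℕ≢0 : ∀ n → 0 < n → n < p → fromℕ n ≢ 0ᶠ
    fromℕ≢0 n 0<n n<p n·1≡0 with coprime-Bézout (prime⇒coprime p-prime {{>-nonZero 0<n}} n<p)
    ... | Bézout.+- x y eq = 1+multiple≢multiple x y p·1≡0 n·1≡0 eq
    ... | Bézout.-+ x y eq = 1+multiple≢multiple y x n·1≡0 p·1≡0 eq

    fromℕ-<-≢ : ∀ {m n} → m < n → n < p → fromℕ m ≢ fromℕ n
    fromℕ-<-≢ {m} {n} m<n n<p eq = fromℕ≢0 (n ∸ m) (m<n⇒0<n∸m m<n) (≤-<-trans (m∸n≤m n m) n<p) (begin
      fromℕ (n ∸ m)                             ≡⟨ solve 2 (λ a b → b := a :+ b :- a) refl (fromℕ m) (fromℕ (n ∸ m)) ⟩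
      fromℕ m +ᶠ fromℕ (n ∸ m) -ᶠ fromℕ m       ≡⟨ cong (_-ᶠ fromℕ m) (trans (sym (×-homo-+ 1ᶠ m (n ∸ m))) (cong fromℕ (m+[n∸m]≡n (<⇒≤ m<n)))) ⟩
      fromℕ n -ᶠ fromℕ m                        ≡⟨ x-x≡0 (sym eq) ⟩
      0ᶠ                                        ∎)
      where
      open ≡-Reasoning
      open Solver using (solve; _:=_; _:+_; _:-_)

    -- The prime field embeds in `K`, so identities between words can be verified in `K`.
    fromℕ-injective : ∀ {x y : Fin p} → fromℕ (toℕ x) ≡ fromℕ (toℕ y) → x ≡ y
    fromℕ-injective {x} {y} eq = toℕ-injective (≤-antisym
      (≮⇒≥ λ lt → fromℕ-<-≢ lt (toℕ<n x) (sym eq)) (≮⇒≥ λ lt → fromℕ-<-≢ lt (toℕ<n y) eq))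

    fromℕ-incHyp : ∀ {m} (a x : Vec K m) → fromℕ (toℕ (incHyp p a x)) ≡ ind (dot a x)
    fromℕ-incHyp a x with dot a x ≟ 0ᶠ
    ... | yes eq = trans (cong (λ b → fromℕ (toℕ (if b then 1 mod p else 0 mod p))) (==F-true eq)) (trans (fromℕ-mod 1) (+ᶠ-identityʳ 1ᶠ))
    ... | no neq = trans (cong (λ b → fromℕ (toℕ (if b then 1 mod p else 0 mod p))) (==F-false neq)) (fromℕ-mod 0)

    code : ∀ {m} → List (Fin p × Vec K m) → Code m
    code = mapᴸ λ { (α , a) → toℕ α , a }

    ev-code : ∀ {m} (ls : List (Fin p × Vec K m)) x → ev (code ls) x ≡ fromℕ (toℕ (evalComb p ls x))
    ev-code []             x = sym (fromℕ-mod 0)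
    ev-code ((α , a) ∷ ls) x = sym (begin
      fromℕ (toℕ (addp p (mulp p α i) e))                    ≡⟨ fromℕ-mod (toℕ (mulp p α i) + toℕ e) ⟩
      fromℕ (toℕ (mulp p α i) + toℕ e)                       ≡⟨ ×-homo-+ 1ᶠ (toℕ (mulp p α i)) (toℕ e) ⟩
      fromℕ (toℕ (mulp p α i)) +ᶠ fromℕ (toℕ e)              ≡⟨ cong₂ _+ᶠ_ (trans (fromℕ-mod (toℕ α * toℕ i)) (trans (×1-homo-* (toℕ α) (toℕ i)) (cong (fromℕ (toℕ α) *ᶠ_) (fromℕ-incHyp a x)))) (sym (ev-code ls x)) ⟩
      fromℕ (toℕ α) *ᶠ ind (dot a x) +ᶠ ev (code ls) x       ∎)
      where
      open ≡-Reasoning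
      i = incHyp p a x
      e = evalComb p ls x

    wt-nonzeros : ∀ {n} (c : Word p n) (ls : List (Fin p × Vec K (suc n))) → c ≗P evalComb p ls →
                  ΣV (off𝟎 (λ v → nz (ev (code ls) v))) ≡ (q ∸ 1) * wt {p} {n} c
    wt-nonzeros {n} c ls c≗ls = trans (ΣV-points (suc n) χ (nz-ev-scale (code ls)))
      (cong ((q ∸ 1) *_) (trans (ΣV-cong agree) (sym (count-allVecs (suc n) _))))
      where
      χ : Vec K (suc n) → ℕ
      χ v = nz (ev (code ls) v)
      nz-c : ∀ v → isPoint v ≡ true → χ v ≡ toBit (not (toℕ (c v) ≡ᵇ 0))
      nz-c v pt with toℕ (c v) in eq
      ... | zero = nz-0 (trans (ev-code ls v) (trans (cong (fromℕ ∘ toℕ) (sym (c≗ls v pt))) (cong fromℕ eq)))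
      ... | suc t = nz-≢0 λ ev≡0 → fromℕ≢0 (suc t) (s≤s z≤n) (subst (_< p) eq (toℕ<n (c v)))
              (trans (cong fromℕ (sym eq)) (trans (cong (fromℕ ∘ toℕ) (c≗ls v pt)) (trans (sym (ev-code ls v)) ev≡0)))
      agree : ∀ v → onPoints χ v ≡ toBit (isPoint v ∧ not (toℕ (c v) ≡ᵇ 0))
      agree v with isPoint v in eq
      ... | false = refl
      ... | true  = trans (+-identityʳ (χ v)) (nz-c v eq)

    Hyp₂⇒combination : ∀ {n} (c : Word p n) (ls : List (Fin p × Vec K (suc n))) → c ≗P evalComb p ls → Hyp₂ (code ls) →
      Σ (Fin p) λ α → Σ (Fin p) λ β → Σ (Vec K (suc n)) λ a → Σ (Vec K (suc n)) λ b →
        AllHyp ((α , a) ∷ (β , b) ∷ []) × (c ≗P evalComb p ((α , a) ∷ (β , b) ∷ []))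
    Hyp₂⇒combination c ls c≗ls (s , a , t , b , a≢0 , b≢0 , eq) =
      s mod p , t mod p , a , b , (Nonzero⇒¬isZeroVec a a≢0 ∷ Nonzero⇒¬isZeroVec b b≢0 ∷ []) , λ x pt → fromℕ-injective (begin
        fromℕ (toℕ (c x))                                       ≡⟨ cong (fromℕ ∘ toℕ) (c≗ls x pt) ⟩
        fromℕ (toℕ (evalComb p ls x))                           ≡⟨ sym (ev-code ls x) ⟩
        ev (code ls) x                                          ≡⟨ eq x ⟩
        fromℕ s *ᶠ ind (dot a x) +ᶠ fromℕ t *ᶠ ind (dot b x)    ≡⟨ cong₂ _+ᶠ_ (cong (_*ᶠ ind (dot a x)) (sym (fromℕ-mod s)))
                                                                     (trans (cong (_*ᶠ ind (dot b x)) (sym (fromℕ-mod t))) (sym (+ᶠ-identityʳ _))) ⟩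
        ev (code ((s mod p , a) ∷ (t mod p , b) ∷ [])) x        ≡⟨ ev-code ((s mod p , a) ∷ (t mod p , b) ∷ []) x ⟩
        fromℕ (toℕ (evalComb p ((s mod p , a) ∷ (t mod p , b) ∷ []) x)) ∎)
      where open ≡-Reasoning

  -- By `q·1≡0` a power of p is zero in `K`, which has no zero divisors.
  p^h≡q⇒p·1≡0 : ∀ p h → q ≡ p ^ h → fromℕ p ≡ 0ᶠ
  p^h≡q⇒p·1≡0 p h q≡p^h with fromℕ p ≟ 0ᶠ
  ... | yes eq = eq
  ... | no neq = contradiction (trans (cong fromℕ (sym q≡p^h)) q·1≡0) (power h)
    where
    power : ∀ h → fromℕ (p ^ h) ≢ 0ᶠ
    power zero    eq = 0≢1 (sym (trans (sym (+ᶠ-identityʳ 1ᶠ)) eq))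
    power (suc h) eq = *-nonzero neq (power h) (trans (sym (×1-homo-* p (p ^ h))) eq)

  -- Supplies the natural number that stands for -1 in `residual`.
  pred·1≡-1 : ∀ r → fromℕ (suc r) ≡ 0ᶠ → fromℕ r ≡ -ᶠ 1ᶠ
  pred·1≡-1 r eq = trans (Solver.solve 2 (λ a b → b Solver.:= Solver.:- a Solver.:+ (a Solver.:+ b)) refl 1ᶠ (fromℕ r))
    (trans (cong (-ᶠ 1ᶠ +ᶠ_) eq) (+ᶠ-identityʳ _))

-- Numerical bounds and the cases of q.

[q-1]θ : ∀ q m → suc (q * θ (suc q) m) ≡ suc q ^ suc m
[q-1]θ q zero    = cong suc (trans (*-identityʳ q) (sym (*-identityʳ q)))
[q-1]θ q (suc m) = begin
  suc (q * (θ (suc q) m + suc q ^ suc m))             ≡⟨ cong suc (*-distribˡ-+ q (θ (suc q) m) (suc q ^ suc m)) ⟩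
  suc (q * θ (suc q) m) + q * suc q ^ suc m           ≡⟨ cong (_+ q * suc q ^ suc m) ([q-1]θ q m) ⟩
  suc q ^ suc m + q * suc q ^ suc m                   ∎
  where open ≡-Reasoning

-- The field order is `suc q` here: multiplying by `q` passes from points to nonzero vectors and
-- turns θ into a power, the 2 of the weight bound becoming `2 * q`.
weight-bound : ∀ q m t {w} → w ≤ t * θ (suc q) m + 2 → q * w + t ≤ t * suc q ^ suc m + 2 * q
weight-bound q m t {w} le = begin
  q * w + t                                     ≤⟨ +-monoˡ-≤ t (*-monoʳ-≤ q le) ⟩
  q * (t * θ (suc q) m + 2) + t                 ≡⟨ S.solve 3 (λ q t θ → q S.:* (t S.:* θ S.:+ S.con 2) S.:+ t S.:= t S.:* (S.con 1 S.:+ q S.:* θ) S.:+ S.con 2 S.:* q) refl q t (θ (suc q) m) ⟩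
  t * suc (q * θ (suc q) m) + 2 * q             ≡⟨ cong (λ e → t * e + 2 * q) ([q-1]θ q m) ⟩
  t * suc q ^ suc m + 2 * q                     ∎
  where open ≤-Reasoning

two-hyperplane-word : ∀ j r h q → q ≡ suc r ^ h → (F : FiniteField q) → let open Codewords F; open Counting F; open OneHyperplane F; open ProjectiveCounting F in
  ∀ (ls : Code (3 + j)) w → ΣV (off𝟎 (λ v → FieldTheory.nz F (ev ls v))) ≡ (q ∸ 1) * w →
  w ≤ (3 * q ∸ 6) * θ q j + 2 → ≤B (2 + j) q w → Hyp₂ ls
two-hyperplane-word j r h 0 q≡ F = ⊥-elim (¬Fin0 (FiniteField.0F F))
two-hyperplane-word j r h 1 q≡ F = ⊥-elim (FiniteField.0≢1 F (Fin1 _ _))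
  where
  Fin1 : ∀ (a b : Fin 1) → a ≡ b
  Fin1 zero zero = refl
-- Now `3 * q ∸ 6` is 0: two points and `𝟎` stay below the minimum weight, so the word is zero.
two-hyperplane-word j r h 2 q≡ F ls w count≡ w≤ _ = Hyp₁⇒Hyp₂ ls (zero⇒Hyp₁ ls (minimum-weight ls (s≤s (s≤s z≤n)) (begin-strict
  nonzeros ls                              ≤⟨ nonzeros≤ ls ⟩
  suc (ΣV (off𝟎 (λ v → nz (ev ls v))))     ≡⟨ cong suc (trans count≡ (*-identityˡ w)) ⟩
  suc w                                    ≤⟨ s≤s w≤ ⟩
  3                                        <⟨ ≤-refl ⟩
  4                                        ≤⟨ *-monoʳ-≤ 2 (*-monoʳ-≤ 2 (m^n>0 2 j)) ⟩
  2 ^ (2 + j)                              ∎)))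
  where
  open ≤-Reasoning
  open FieldTheory F
  open Codewords F
  open Counting F
  open OneHyperplane F
  open ProjectiveCounting F
-- The bound becomes 2w ≤ 3^(2+j) + 1, and even with `𝟎` counted this is in the range of
-- `one-hyperplane₃`.
two-hyperplane-word j r h 3 q≡ F ls w count≡ w≤ _ = Hyp₁⇒Hyp₂ ls (one-hyperplane₃ ls (begin-strict
  nonzeros ls                              ≤⟨ nonzeros≤ ls ⟩
  suc (ΣV (off𝟎 (λ v → nz (ev ls v))))     ≡⟨ cong suc count≡ ⟩
  suc (2 * w)                              ≤⟨ s≤s (+-cancelʳ-≤ 3 (2 * w) _ (≤-trans (weight-bound 2 j 3 w≤) (≤-reflexive (sym (+-assoc (3 ^ (2 + j)) 1 3))))) ⟩
  suc (3 ^ (2 + j) + 1)                    ≡⟨ sym (+-suc (3 ^ (2 + j)) 1) ⟩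
  3 ^ (2 + j) + 2                          <⟨ +-monoʳ-< (3 ^ (2 + j)) (*-monoʳ-≤ 3 (m^n>0 3 j)) ⟩
  3 ^ (2 + j) + 3 ^ (1 + j)                ∎))
  where
  open ≤-Reasoning
  open FieldTheory F
  open Codewords F
  open Counting F
  open OneHyperplane F
  open ProjectiveCounting F
  open Weights F
  open Reduction r (pred·1≡-1 r (p^h≡q⇒p·1≡0 (suc r) h q≡)) (s≤s (s≤s (s≤s z≤n)))
-- For q = 4 and q = 5 the condition `≤B` reduces to `w ≤ 2 * q ^ suc j`; times `q ∸ 1` this is the
-- hypothesis of `two-hyperplanes-small`.
two-hyperplane-word j r h 4 q≡ F ls w count≡ _ w≤B = two-hyperplanes-small ls (begin
  _                                        ≡⟨ count≡ ⟩
  3 * w                                    ≤⟨ *-monoʳ-≤ 3 w≤B ⟩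
  3 * (2 * 4 ^ suc j)                      ≡⟨ sym (*-assoc 3 2 (4 ^ suc j)) ⟩
  6 * 4 ^ suc j                            ∎)
  where
  open ≤-Reasoning
  open Weights F
  open SmallField F r (pred·1≡-1 r (p^h≡q⇒p·1≡0 (suc r) h q≡)) (s≤s (s≤s (s≤s (s≤s z≤n))))
two-hyperplane-word j r h 5 q≡ F ls w count≡ _ w≤B = two-hyperplanes-small ls (begin
  _                                        ≡⟨ count≡ ⟩
  4 * w                                    ≤⟨ *-monoʳ-≤ 4 w≤B ⟩
  4 * (2 * 5 ^ suc j)                      ≡⟨ sym (*-assoc 4 2 (5 ^ suc j)) ⟩
  8 * 5 ^ suc j                            ∎)
  where
  open ≤-Reasoning
  open Weights F
  open SmallField F r (pred·1≡-1 r (p^h≡q⇒p·1≡0 (suc r) h q≡)) (s≤s (s≤s (s≤s (s≤s z≤n))))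
-- From q = 6 on, `3 * q ∸ 6` exceeds 2q - 1: the term saved by the -1 in the numerator of θ
-- outweighs the 2 of the weight bound and the vector `𝟎`.
two-hyperplane-word j r h q@(suc (suc (suc (suc (suc (suc t)))))) q≡ F ls w count≡ w≤ _ =
  two-hyperplanes-large ls (+-cancelʳ-< (3 * q ∸ 6) (nonzeros ls) _ (begin-strict
    nonzeros ls + (3 * q ∸ 6)                            ≤⟨ +-monoˡ-≤ (3 * q ∸ 6) (≤-trans (nonzeros≤ ls) (≤-reflexive (cong suc count≡))) ⟩
    suc ((5 + t) * w + (3 * q ∸ 6))                      ≤⟨ s≤s (weight-bound (5 + t) j (3 * q ∸ 6) w≤) ⟩
    suc ((3 * q ∸ 6) * q ^ suc j + 2 * (5 + t))          ≡⟨ sym (+-suc _ (2 * (5 + t))) ⟩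
    (3 * q ∸ 6) * q ^ suc j + suc (2 * (5 + t))          <⟨ +-monoʳ-< ((3 * q ∸ 6) * q ^ suc j) gap ⟩
    (3 * q ∸ 6) * q ^ suc j + (3 * q ∸ 6)                ∎))
  where
  open ≤-Reasoning
  open FieldTheory F
  open Codewords F
  open Counting F
  open OneHyperplane F
  open ProjectiveCounting F
  open Weights F
  open LargeField F r (pred·1≡-1 r (p^h≡q⇒p·1≡0 (suc r) h q≡)) (s≤s (s≤s (s≤s (s≤s (s≤s (s≤s z≤n))))))
  gap : suc (2 * (5 + t)) < 3 * (6 + t) ∸ 6
  gap = m+n≤o⇒n≤o∸m 6 (≤-trans (m≤m+n _ t) (≤-reflexive
    (S.solve 1 (λ t → S.con 8 S.:+ S.con 2 S.:* (S.con 5 S.:+ t) S.:+ t S.:= S.con 3 S.:* (S.con 6 S.:+ t)) refl t)))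

theorem3p11 : (n p h q : ℕ) → 2 ≤ n → Prime p → 1 ≤ h → q ≡ p ^ h →
    (F : FiniteField q) → .{{_ : NonZero p}} →
    let open PG F in
    (c : Word p n) → InCode p n c →
    wt c ≤ (3 * q ∸ 6) * θ q (n ∸ 2) + 2 → ≤B n q (wt c) →
    Σ (Fin p) λ α → Σ (Fin p) λ β →
    Σ (Vec (Fin q) (suc n)) λ a → Σ (Vec (Fin q) (suc n)) λ b →
    AllHyp ((α , a) ∷ (β , b) ∷ []) × (c ≗P evalComb p ((α , a) ∷ (β , b) ∷ []))
theorem3p11 (suc (suc j)) (suc r) h q (s≤s (s≤s z≤n)) p-prime 1≤h q≡p^h F c (ls , _ , c≗ls) wt≤ wt≤B =
  Hyp₂⇒combination c ls c≗ls (two-hyperplane-word j r h q q≡p^h F (code ls) (PG.wt F c) (wt-nonzeros c ls c≗ls) wt≤ wt≤B)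
  where
  open Weights F
  open Characteristic (suc r) p-prime (p^h≡q⇒p·1≡0 (suc r) h q≡p^h)
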